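{- Let $\mathcal P_4$ be the family of all 3-uniform minimal 4-paths. For every integer $r$ with $1\le r\le 4$, the $r$-color Ramsey number of $\mathcal P_4$ satisfies $R(\mathcal P_4;r)=r+6$.
   Context: A 3-graph consists of a finite vertex set and a set of 3-element subsets of it (edges). A (3-uniform) minimal 4-path is a 3-graph (without isolated vertices) with edge set $\{a_0,a_1,a_2,a_3\}$ such that $a_i\cap a_j\ne\emptyset$ if and only if $|i-j|\le 1$; $\mathcal P_4$ is the family of all of them. $K_n^{(3)}$ is the complete 3-graph on $n$ vertices. For a family $\mathcal F$ of 3-graphs and a positive integer $r$, $R(\mathcal F;r)$ is the smallest integer $n$ such that every coloring of the edges of $K_n^{(3)}$ with $r$ colors yields a monochromatic copy of a member of $\mathcal F$. -}

module Defs where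

open import Data.Fin using (Fin; toℕ)
open import Data.Fin.Properties using (any?; _≟_)
open import Data.Fin.Subset using (Subset; ∣_∣; Nonempty; _∩_)
  renaming (_∈_ to _∈ₛ_)
open import Data.Fin.Subset.Properties using (_∈?_)
open import Data.Nat using (ℕ; _≤_; ∣_-_∣)
open import Data.Product using (Σ-syntax; ∃-syntax; _×_; proj₁)
open import Data.Vec using (tabulate)
open import Function.Base using (id)
open import Function.Bundles using (_⇔_; _↣_; module Injection)
open import Level using (0ℓ)
open import Relation.Binary.PropositionalEquality using (_≡_)
open import Relation.Nullary.Decidable using (does; _×-dec_)
open import Relation.Unary using (Pred; _∈_)

record 3Graph : Set₁ where
  field
    order   : ℕ
    Edges   : Pred (Subset order) 0ℓ
    uniform : ∀ {e} → e ∈ Edges → ∣ e ∣ ≡ 3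

open 3Graph public

K : ℕ → 3Graph
K n = record { order = n ; Edges = λ e → ∣ e ∣ ≡ 3 ; uniform = id }

image : ∀ {m n} → (Fin m → Fin n) → Subset m → Subset n
image f p = tabulate λ y → does (any? λ x → (x ∈? p) ×-dec (f x ≟ y))

-- The copy need not be induced.
ContainsCopy : 3Graph → 3Graph → Set
ContainsCopy G H =
  Σ[ f ∈ Fin (order H) ↣ Fin (order G) ]
    (∀ e → e ∈ Edges H → image (Injection.to f) e ∈ Edges G)

NoIsolatedVertices : 3Graph → Set
NoIsolatedVertices H = ∀ v → ∃[ e ] (e ∈ Edges H × v ∈ₛ e)

-- The aᵢ are not required to be distinct: this follows from the
-- intersection condition, which also says that each aᵢ is nonempty.
𝒫₄ : Pred 3Graph 0ℓ
𝒫₄ H =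
  NoIsolatedVertices H ×
  (Σ[ a ∈ (Fin 4 → Subset (order H)) ]
    (∀ e → e ∈ Edges H ⇔ (∃[ i ] a i ≡ e)) ×
    (∀ i j → Nonempty (a i ∩ a j) ⇔ ∣ toℕ i - toℕ j ∣ ≤ 1))

-- The proof of being an edge is irrelevant, so a colour depends only on
-- the edge itself.
Coloring : ℕ → ℕ → Set
Coloring n r = (e : Subset n) → .(e ∈ Edges (K n)) → Fin r

colorClass : ∀ {n r} → Coloring n r → Fin r → 3Graph
colorClass {n} χ c = record
  { order   = n
  ; Edges   = λ e → Σ[ p ∈ e ∈ Edges (K n) ] χ e p ≡ c
  ; uniform = proj₁
  }

Arrows : ℕ → Pred 3Graph 0ℓ → ℕ → Set₁
Arrows n ℱ r =
  (χ : Coloring n r) →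
  ∃[ c ] ∃[ H ] (H ∈ ℱ × ContainsCopy (colorClass χ c) H)

-- R(ℱ; r) = N
IsRamseyNumber : Pred 3Graph 0ℓ → ℕ → ℕ → Set₁
IsRamseyNumber ℱ r N = Arrows N ℱ r × (∀ n → Arrows n ℱ r → N ≤ n)

module Submission where

{-
A 3-graph contains a minimal 4-path iff four of its edges induce a path in the
graph that joins two edges when they meet.

Upper bound.  Among r colours on n = r + 6 vertices, one class has more than the
average number of edges.  For n = 10 and n = 9 a path-free 3-graph that large
(at least 30, resp. 27 edges) is nearly a star: some vertex x lies in all of its
edges but at most 5, resp. 2.  Deleting x leaves n - 1 vertices on which the other r - 1
colours cover all but a few triples, and the argument repeats.  It stops at
n = 8, where a path-free 3-graph has at most 24 edges, so that two colours do not
cover the 56 - 5 - 2 triples that are left.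

The three facts about path-free 3-graphs come from a branch-and-bound search up
to symmetry.  The search trees are written down as certificates and verified by
evaluation of a checker that is proved sound.

Lower bound.  On r + 5 vertices, let r - 1 classes be stars and the last one a
complete 3-graph on six vertices; a minimal 4-path has at least seven.
-}

import Algebra.Properties.CommutativeSemigroup as CommutativeSemigroupProperties
open import Data.Bool as Bool using (Bool; true; false; _∧_; _∨_; not; if_then_else_; T)
open import Data.Bool.ListAction using (all)
open import Data.Bool.Properties using (∨-comm; ∨-assoc; ∨-identityʳ)
open import Data.Fin using (Fin; zero; suc; toℕ; fromℕ<)
open import Data.Fin.Patterns using (0F; 1F; 2F; 3F)
open import Data.Fin.Properties using (any?; toℕ-fromℕ<; toℕ<n; toℕ-injective)
  renaming (_≟_ to _≟ᶠ_; suc-injective to sucᶠ-injective)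
open import Data.Fin.Subset using (Subset; inside; outside; ∣_∣; Nonempty; _∩_; _∪_; _⊆_; ⁅_⁆)
  renaming (_∈_ to _∈ₛ_)
open import Data.Fin.Subset.Properties
  using (x∈p∩q⁺; x∈p∩q⁻; x∈p∪q⁺; x∈p∪q⁻; ∣p∣≤n; ∣⁅x⁆∣≡1; x∈⁅y⁆⇒x≡y; drop-∷-⊆)
  renaming (_∈?_ to _∈ₛ?_)
open import Data.List
  using (List; []; _∷_; _++_; map; filterᵇ; length; concatMap; applyUpTo; upTo; tabulate)
open import Data.List.Properties using (length-map; length-tabulate)
open import Data.List.Relation.Binary.Permutation.Propositional
  using (_↭_; prep; ↭-refl; ↭-trans) renaming (swap to ↭-swap)
open import Data.List.Relation.Binary.Permutation.Propositional.Properties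
  using (All-resp-↭; Any-resp-↭; ↭-length)
open import Data.List.Relation.Unary.All as All using (All; []; _∷_)
import Data.List.Relation.Unary.All.Properties as All
open import Data.List.Relation.Unary.Any using (Any; here; there)
import Data.List.Relation.Unary.Any.Properties as Any
open import Data.Nat
open import Data.Nat.DivMod using (_/_; _%_)
open import Data.Nat.ListAction using (sum)
open import Data.Nat.Properties
open import Data.Product using (Σ; ∃; ∃-syntax; _×_; _,_; proj₁; proj₂)
open import Data.Sum using (_⊎_; inj₁; inj₂)
open import Data.Vec as Vec using ([]; _∷_; lookup; here; there)
open import Data.Vec.Properties
  using (lookup∘tabulate; lookup⇒[]=; []=⇒lookup; tabulate∘lookup; tabulate-cong)
open import Function using (_∘_)
open import Function.Bundles using (_⇔_; mk⇔; mk↣; module Injection; module Equivalence)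
open import Relation.Binary.PropositionalEquality
open import Relation.Nullary using (¬_; contradiction)
open import Relation.Nullary.Decidable
  using (Dec; yes; no; does; map′; _×-dec_; ¬?; does-⇔; dec-true; dec-false; decidable-stable)
open import Defs

-- Path-free families of triples

-- The tolerances leave no room. After five exceptions, 84 - 5 = 79 triples on nine vertices force a
-- class of at least 27 edges; after two more, 56 - 7 = 49 triples on eight vertices force one of at
-- least 25. One further exception at either stage would leave 78 = 3 * 26 or 48 = 2 * 24 triples,
-- which classes within the bounds could cover as far as counting tells. On eight vertices even a
-- full star has only 21 edges, so there the descent has to end in a plain edge bound. Deletion of a
-- vertex and the symmetries of the search are both relabellings. For this reason a 3-graph is
-- represented by a Boolean predicate on ordered triples of natural numbers that is invariant under
-- reordering: relabelling is then precomposition with a map, and deleting a vertex is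
-- precomposition with an injection that misses it. The injections are defined on all natural
-- numbers, so that path-freeness passes to the relabelled family without any reference to the
-- number of vertices.

∧-true : ∀ {x y} → x ∧ y ≡ true → x ≡ true × y ≡ true
∧-true {true} {true} _ = refl , refl

∨-true : ∀ {x y} → x ∨ y ≡ true → x ≡ true ⊎ y ≡ true
∨-true {true}  _ = inj₁ refl
∨-true {false} p = inj₂ p

not-true : ∀ {x} → not x ≡ true → x ≡ false
not-true {false} _ = refl

≡ᵇ-sound : ∀ {m n} → (m ≡ᵇ n) ≡ true → m ≡ n
≡ᵇ-sound {m} {n} p = ≡ᵇ⇒≡ m n (subst T (sym p) _)

<ᵇ-sound : ∀ {m n} → (m <ᵇ n) ≡ true → m < n
<ᵇ-sound {m} {n} p = <ᵇ⇒< m n (subst T (sym p) _)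

≤ᵇ-sound : ∀ {m n} → (m ≤ᵇ n) ≡ true → m ≤ n
≤ᵇ-sound {m} {n} p = ≤ᵇ⇒≤ m n (subst T (sym p) _)

≡ᵇ-refl : ∀ n → (n ≡ᵇ n) ≡ true
≡ᵇ-refl zero    = refl
≡ᵇ-refl (suc n) = ≡ᵇ-refl n

≢⇒≡ᵇ-false : ∀ {m n} → m ≢ n → (m ≡ᵇ n) ≡ false
≢⇒≡ᵇ-false {m} {n} m≢n with m ≡ᵇ n in eq
... | true  = contradiction (≡ᵇ-sound eq) m≢n
... | false = refl

data Triple : Set where
  tri : ℕ → ℕ → ℕ → Triple

elem : ℕ → Triple → Bool
elem v (tri a b c) = (v ≡ᵇ a) ∨ (v ≡ᵇ b) ∨ (v ≡ᵇ c)

meets : Triple → Triple → Bool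
meets (tri a b c) t = elem a t ∨ elem b t ∨ elem c t

record Quad : Set where
  constructor quad
  field e₀ e₁ e₂ e₃ : Triple

path : Quad → Bool
path (quad e₀ e₁ e₂ e₃) =
  meets e₀ e₁ ∧ meets e₁ e₂ ∧ meets e₂ e₃ ∧
  not (meets e₀ e₂) ∧ not (meets e₀ e₃) ∧ not (meets e₁ e₃)

mapᵗ : (ℕ → ℕ) → Triple → Triple
mapᵗ σ (tri a b c) = tri (σ a) (σ b) (σ c)

mapQ : (ℕ → ℕ) → Quad → Quad
mapQ σ (quad e₀ e₁ e₂ e₃) = quad (mapᵗ σ e₀) (mapᵗ σ e₁) (mapᵗ σ e₂) (mapᵗ σ e₃)

Inj : (ℕ → ℕ) → Set
Inj σ = ∀ {u v} → σ u ≡ σ v → u ≡ v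

≡ᵇ-inj : ∀ {σ} → Inj σ → ∀ u v → (σ u ≡ᵇ σ v) ≡ (u ≡ᵇ v)
≡ᵇ-inj {σ} inj u v with u ≡ᵇ v in eq
... | true  = trans (cong (σ u ≡ᵇ_) (cong σ (sym (≡ᵇ-sound {u} {v} eq)))) (≡ᵇ-refl (σ u))
... | false = ≢⇒≡ᵇ-false λ p →
  contradiction (trans (sym eq) (subst (λ w → (u ≡ᵇ w) ≡ true) (inj p) (≡ᵇ-refl u))) λ ()

elem-map : ∀ {σ} → Inj σ → ∀ v t → elem (σ v) (mapᵗ σ t) ≡ elem v t
elem-map inj v (tri a b c)
  rewrite ≡ᵇ-inj inj v a | ≡ᵇ-inj inj v b | ≡ᵇ-inj inj v c = refl

meets-map : ∀ {σ} → Inj σ → ∀ t u → meets (mapᵗ σ t) (mapᵗ σ u) ≡ meets t u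
meets-map inj (tri a b c) u
  rewrite elem-map inj a u | elem-map inj b u | elem-map inj c u = refl

path-map : ∀ {σ} → Inj σ → ∀ q → path (mapQ σ q) ≡ path q
path-map inj (quad e₀ e₁ e₂ e₃)
  rewrite meets-map inj e₀ e₁ | meets-map inj e₁ e₂ | meets-map inj e₂ e₃
        | meets-map inj e₀ e₂ | meets-map inj e₀ e₃ | meets-map inj e₁ e₃ = refl

Family : Set
Family = Triple → Bool

members : Quad → List Triple
members (quad e₀ e₁ e₂ e₃) = e₀ ∷ e₁ ∷ e₂ ∷ e₃ ∷ []

record Symmetric (E : Family) : Set where
  field
    exchange₁ : ∀ a b c → E (tri a b c) ≡ E (tri b a c)
    exchange₂ : ∀ a b c → E (tri a b c) ≡ E (tri a c b)

open Symmetric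

-- The quadruples range over arbitrary triples, degenerate ones included, so that a path in a
-- certificate comes without a proof of being proper. Colour classes satisfy this form of the
-- condition because `class` is false off the proper triples.
PathFree : Family → Set
PathFree E = ∀ q → path q ≡ true → ¬ All (λ t → E t ≡ true) (members q)

-- The pullback of `E`, hence contravariant in the map. Along an injection that misses a vertex it
-- is what remains of `E` after deletion of that vertex.
relabel : (ℕ → ℕ) → Family → Family
relabel σ E t = E (mapᵗ σ t)

Symmetric-relabel : ∀ σ {E} → Symmetric E → Symmetric (relabel σ E)
Symmetric-relabel σ S = record
  { exchange₁ = λ a b c → exchange₁ S (σ a) (σ b) (σ c)
  ; exchange₂ = λ a b c → exchange₂ S (σ a) (σ b) (σ c) }

PathFree-relabel : ∀ {σ} → Inj σ → ∀ {E} → PathFree E → PathFree (relabel σ E)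
PathFree-relabel {σ} inj free q@(quad _ _ _ _) p (h₀ ∷ h₁ ∷ h₂ ∷ h₃ ∷ []) =
  free (mapQ σ q) (trans (path-map inj q) p) (h₀ ∷ h₁ ∷ h₂ ∷ h₃ ∷ [])

record Admissible (E : Family) : Set where
  field
    symmetric : Symmetric E
    pathFree  : PathFree E

open Admissible

Admissible-relabel : ∀ {σ} → Inj σ → ∀ {E} → Admissible E → Admissible (relabel σ E)
Admissible-relabel {σ} inj A = record
  { symmetric = Symmetric-relabel σ (symmetric A)
  ; pathFree  = PathFree-relabel inj (pathFree A) }

-- A canonical order of the entries: the lists of the checker hold increasing triples, and once the
-- image of a triple under a permutation is sorted, syntactic comparison decides whether the vertex
-- sets agree.
sort : Triple → Triple
sort (tri a b c) =
  if a <ᵇ b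
  then (if b <ᵇ c then tri a b c else if a <ᵇ c then tri a c b else tri c a b)
  else (if a <ᵇ c then tri b a c else if b <ᵇ c then tri b c a else tri c b a)

sort-invariant : ∀ {E} → Symmetric E → ∀ t → E (sort t) ≡ E t
sort-invariant S (tri a b c) with a <ᵇ b | b <ᵇ c | a <ᵇ c
... | true  | true  | _     = refl
... | true  | false | true  = sym (exchange₂ S a b c)
... | true  | false | false = trans (exchange₁ S c a b) (sym (exchange₂ S a b c))
... | false | _     | true  = sym (exchange₁ S a b c)
... | false | true  | false = trans (exchange₂ S b c a) (sym (exchange₁ S a b c))
... | false | false | false =
  trans (exchange₁ S c b a) (trans (exchange₂ S b c a) (sym (exchange₁ S a b c)))

-- Counting the members of a family in a list

bit : Bool → ℕ
bit b = if b then 1 else 0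

bit≤1 : ∀ b → bit b ≤ 1
bit≤1 true  = ≤-refl
bit≤1 false = z≤n

count : Family → List Triple → ℕ
count E []       = 0
count E (t ∷ ts) = bit (E t) + count E ts

count≤length : ∀ E ts → count E ts ≤ length ts
count≤length E []       = z≤n
count≤length E (t ∷ ts) = +-mono-≤ (bit≤1 (E t)) (count≤length E ts)

count-empty : ∀ {E ts} → All (λ t → E t ≡ false) ts → count E ts ≡ 0
count-empty []       = refl
count-empty (p ∷ ps) rewrite p = count-empty ps

count-full-or-less : ∀ E ts → All (λ t → E t ≡ true) ts ⊎ count E ts < length ts
count-full-or-less E [] = inj₁ []
count-full-or-less E (t ∷ ts) with E t in eq | count-full-or-less E ts
... | true  | inj₁ full = inj₁ (eq ∷ full)
... | true  | inj₂ lt   = inj₂ (s≤s lt)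
... | false | _         = inj₂ (s≤s (count≤length E ts))

count-cong : ∀ {E F : Family} → (∀ t → E t ≡ F t) → ∀ ts → count E ts ≡ count F ts
count-cong eq []       = refl
count-cong eq (t ∷ ts) = cong₂ _+_ (cong bit (eq t)) (count-cong eq ts)

count-map : ∀ {E F : Family} (f : Triple → Triple) → (∀ t → E (f t) ≡ F t) →
  ∀ ts → count E (map f ts) ≡ count F ts
count-map f eq []       = refl
count-map f eq (t ∷ ts) = cong₂ _+_ (cong bit (eq t)) (count-map f eq ts)

_≡ᵗ_ : Triple → Triple → Bool
tri a b c ≡ᵗ tri x y z = (a ≡ᵇ x) ∧ (b ≡ᵇ y) ∧ (c ≡ᵇ z)

≡ᵗ-sound : ∀ t u → (t ≡ᵗ u) ≡ true → t ≡ u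
≡ᵗ-sound (tri a b c) (tri x y z) p with ∧-true {a ≡ᵇ x} p
... | pa , q with ∧-true {b ≡ᵇ y} q
... | pb , pc with ≡ᵇ-sound {a} pa | ≡ᵇ-sound {b} pb | ≡ᵇ-sound {c} pc
... | refl | refl | refl = refl

member : Triple → List Triple → Bool
member t []       = false
member t (u ∷ us) = (t ≡ᵗ u) ∨ member t us

member-lookup : ∀ {P : Triple → Set} {t us} → member t us ≡ true → All P us → P t
member-lookup {P} {t} {u ∷ us} p (q ∷ qs) with t ≡ᵗ u in eq
... | true  = subst P (sym (≡ᵗ-sound t u eq)) q
... | false = member-lookup p qs

remove : Triple → List Triple → List Triple
remove t []       = []
remove t (u ∷ us) = if t ≡ᵗ u then us else u ∷ remove t us

removeAll : List Triple → List Triple → List Triple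
removeAll []       us = us
removeAll (t ∷ ts) us = removeAll ts (remove t us)

-- An equality if `t` occurs in `us`, since exactly one occurrence is removed; otherwise the list is
-- unchanged and the right-hand side can only be larger.
count-remove : ∀ E t us → count E us ≤ bit (E t) + count E (remove t us)
count-remove E t [] = z≤n
count-remove E t (u ∷ us) with t ≡ᵗ u in eq
... | true  rewrite ≡ᵗ-sound t u eq = ≤-refl
... | false = begin
  bit (E u) + count E us                       ≤⟨ +-monoʳ-≤ (bit (E u)) (count-remove E t us) ⟩
  bit (E u) + (bit (E t) + count E (remove t us)) ≡⟨ +-assoc (bit (E u)) _ _ ⟨
  (bit (E u) + bit (E t)) + count E (remove t us) ≡⟨ cong (_+ count E (remove t us)) (+-comm (bit (E u)) _) ⟩
  (bit (E t) + bit (E u)) + count E (remove t us) ≡⟨ +-assoc (bit (E t)) _ _ ⟩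
  bit (E t) + (bit (E u) + count E (remove t us)) ∎
  where open ≤-Reasoning

count-removeAll : ∀ E ts us → count E us ≤ count E ts + count E (removeAll ts us)
count-removeAll E []       us = ≤-refl
count-removeAll E (t ∷ ts) us = begin
  count E us                                                  ≤⟨ count-remove E t us ⟩
  bit (E t) + count E (remove t us)                           ≤⟨ +-monoʳ-≤ (bit (E t)) (count-removeAll E ts (remove t us)) ⟩
  bit (E t) + (count E ts + count E (removeAll ts (remove t us))) ≡⟨ +-assoc (bit (E t)) _ _ ⟨
  bit (E t) + count E ts + count E (removeAll ts (remove t us))   ∎
  where open ≤-Reasoning

null : List Triple → Bool
null []      = true
null (_ ∷ _) = false

-- An empty remainder says that `us` is contained in `ts` as a multiset.
count-null : ∀ E ts us → null (removeAll ts us) ≡ true → count E us ≤ count E ts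
count-null E ts us p with removeAll ts us | count-removeAll E ts us
... | [] | le = subst (count E us ≤_) (+-identityʳ (count E ts)) le

-- The triples a < b < c < n.
triples : ℕ → List Triple
triples zero    = []
triples (suc n) =
  concatMap (λ b → map (λ c → tri 0 (suc b) (suc c)) (applyUpTo (λ i → suc b + i) (n ∸ suc b))) (upTo n)
    ++ map (mapᵗ suc) (triples n)

-- Permutations and embeddings of the vertex set

swap : ℕ → ℕ → ℕ → ℕ
swap a b x = if x ≡ᵇ a then b else if x ≡ᵇ b then a else x

swap-involutive : ∀ a b x → swap a b (swap a b x) ≡ x
swap-involutive a b x with x ≡ᵇ a in xa | x ≡ᵇ b in xb
... | true  | _ with b ≡ᵇ a in ba
...   | true  = trans (≡ᵇ-sound {b} ba) (sym (≡ᵇ-sound {x} xa))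
...   | false rewrite ≡ᵇ-refl b = sym (≡ᵇ-sound {x} xa)
swap-involutive a b x | false | true  rewrite ≡ᵇ-refl a = sym (≡ᵇ-sound {x} xb)
swap-involutive a b x | false | false rewrite xa | xb = refl

swap-inj : ∀ a b → Inj (swap a b)
swap-inj a b {u} {v} p =
  trans (sym (swap-involutive a b u)) (trans (cong (swap a b) p) (swap-involutive a b v))

swap-< : ∀ {n a b x} → a < n → b < n → x < n → swap a b x < n
swap-< {a = a} {b} {x} a<n b<n x<n with x ≡ᵇ a
... | true  = b<n
... | false with x ≡ᵇ b
...   | true  = a<n
...   | false = x<n

-- A permutation is coded by transpositions, each written as a two-digit
-- number, the first one being applied first.
swaps : List ℕ → ℕ → ℕ
swaps []       x = x
swaps (s ∷ ss) x = swaps ss (swap (s / 10) (s % 10) x)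

swaps-inj : ∀ π → Inj (swaps π)
swaps-inj []      p = p
swaps-inj (s ∷ π) p = swap-inj (s / 10) (s % 10) (swaps-inj π p)

swapsBelow : ℕ → List ℕ → Bool
swapsBelow n []      = true
swapsBelow n (s ∷ π) = (s / 10 <ᵇ n) ∧ (s % 10 <ᵇ n) ∧ swapsBelow n π

swaps-< : ∀ {n} π → swapsBelow n π ≡ true → ∀ {x} → x < n → swaps π x < n
swaps-< []      _ x<n = x<n
swaps-< (s ∷ π) p x<n with ∧-true p
... | a<n , q with ∧-true q
... | b<n , r = swaps-< π r (swap-< (<ᵇ-sound {s / 10} a<n) (<ᵇ-sound {s % 10} b<n) x<n)

act : (ℕ → ℕ) → Triple → Triple
act σ t = sort (mapᵗ σ t)

act-relabel : ∀ {E} → Symmetric E → ∀ σ t → E (act σ t) ≡ relabel σ E t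
act-relabel S σ t = sort-invariant S (mapᵗ σ t)

-- An injection of {0,…,m-1} into {0,…,n-1}, extended to ℕ.
record Embedding (m n : ℕ) : Set where
  field
    to         : ℕ → ℕ
    injective  : Inj to
    bounded    : ∀ {x} → x < m → to x < n
    decreasing : ∀ {E} → Symmetric E → count (relabel to E) (triples m) ≤ count E (triples n)

open Embedding

-- The hypothesis is a finite computation: the sorted images of the triples below `m` form a
-- sub-multiset of the triples below `n`. It takes the place of a general argument that injections
-- do not increase counts.
covered : ∀ {m n σ} → null (removeAll (triples n) (map (act σ) (triples m))) ≡ true →
  ∀ {E} → Symmetric E → count (relabel σ E) (triples m) ≤ count E (triples n)
covered {m} {n} {σ} p {E} S = begin
  count (relabel σ E) (triples m)        ≡⟨ count-map (act σ) (act-relabel S σ) (triples m) ⟨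
  count E (map (act σ) (triples m))      ≤⟨ count-null E (triples n) _ p ⟩
  count E (triples n)                    ∎
  where open ≤-Reasoning

relabel-∘ : ∀ E σ τ t → relabel (σ ∘ τ) E t ≡ relabel τ (relabel σ E) t
relabel-∘ E σ τ (tri _ _ _) = refl

_∘ₑ_ : ∀ {l m n} → Embedding m n → Embedding l m → Embedding l n
_∘ₑ_ {l} {m} {n} σ τ = record
  { to         = to σ ∘ to τ
  ; injective  = λ p → injective τ (injective σ p)
  ; bounded    = λ x<l → bounded σ (bounded τ x<l)
  ; decreasing = λ {E} S → begin
      count (relabel (to σ ∘ to τ) E) (triples l)        ≡⟨ count-cong (relabel-∘ E (to σ) (to τ)) (triples l) ⟩
      count (relabel (to τ) (relabel (to σ) E)) (triples l) ≤⟨ decreasing τ (Symmetric-relabel (to σ) S) ⟩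
      count (relabel (to σ) E) (triples m)               ≤⟨ decreasing σ S ⟩
      count E (triples n)                                ∎
  }
  where open ≤-Reasoning

-- Certificates

-- In certificates a triple is written as a three-digit number and a path as the
-- concatenation of its four triples.

decode : ℕ → Triple
decode c = tri (c / 100) (c / 10 % 10) (c % 10)

decode⁴ : ℕ → Quad
decode⁴ q = quad (decode (q / 1000000000)) (decode (q / 1000000 % 1000))
                 (decode (q / 1000 % 1000)) (decode (q % 1000))

-- group π es: each e in es is the image under π of a triple met earlier in the orbit.
data Group : Set where
  group : (π es : List ℕ) → Group

-- At each node some triples (ins) are known to be edges and others (dead) not to
-- be; the remaining triples and ins form the pool.
--   bound qs:         at least one unknown triple of each path in qs is missing;
--   star x:           few triples outside dead avoid x;
--   drop qs c:        each path in qs has one unknown triple, which is dead;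
--   split e c gs c′:  c treats the case that e is an edge; by symmetry, the whole
--                     orbit of e is dead in c′.
data Certificate : Set where
  bound : (paths : List ℕ) → Certificate
  star  : (centre : ℕ) → Certificate
  drop  : (paths : List ℕ) → Certificate → Certificate
  split : (e : ℕ) → Certificate → (orbit : List Group) → Certificate → Certificate

-- A path-free family misses some member of the path; as the members in `ins` are edges, the missing
-- one is among these.
unknowns : List Triple → Quad → List Triple
unknowns ins q = filterᵇ (λ t → not (member t ins)) (members q)

-- One inclusion is enough: if `σ` maps `ins` and `dead` into themselves, then the pullback of `E`
-- contains `ins` and avoids `dead` whenever `E` does.
preserves : (ℕ → ℕ) → List Triple → Bool
preserves σ ts = all (λ t → member (act σ t) ts) ts

grow : List ℕ → List Triple → List Triple
grow []       orb = orb
grow (e ∷ es) orb = grow es (decode e ∷ orb)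

growable : (ℕ → ℕ) → List ℕ → List Triple → Bool
growable σ []       orb = true
growable σ (e ∷ es) orb = member (decode e) (map (act σ) orb) ∧ growable σ es (decode e ∷ orb)

orbit : List Group → List Triple → List Triple
orbit []                orb = orb
orbit (group π es ∷ gs) orb = orbit gs (grow es orb)

-- Removing a triple that is no longer in the pool does not shorten the pool, so
-- the blocks need not be tested for disjointness.
isBound : ℕ → (ins : List Triple) → List ℕ → (pool : List Triple) (slack : ℕ) → Bool
isBound b ins []       pool slack = slack + length pool ≤ᵇ b
isBound b ins (q ∷ qs) pool slack =
  path (decode⁴ q) ∧
  isBound b ins qs (removeAll (unknowns ins (decode⁴ q)) pool)
                   (slack + pred (length (unknowns ins (decode⁴ q))))

-- The successor leaves a gap at 0 and the transposition moves it to `x`: an injection of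
-- {0,...,m-1} onto {0,...,m} without `x`, for `x` at most `m`.
recentre : ℕ → ℕ → ℕ
recentre x v = swap 0 x (suc v)

-- An upper bound for the number of edges that avoid `x`: every triple not known to be absent is
-- counted.
alive : (dead : List Triple) → ℕ → List Triple → ℕ
alive dead x []       = 0
alive dead x (t ∷ ts) = bit (not (member (act (recentre x) t) dead)) + alive dead x ts

-- The checker and its soundness

module Checker (m b d : ℕ) where

  -- A generator has to permute the vertices and to fix the node, that is, to map `ins` and `dead`
  -- into themselves. The two `null` tests are the two inclusions between the triples and their
  -- images; the first lets `π` be an embedding, the second carries an edge bound back from the
  -- relabelled family.
  isOrbit : List Group → (ins dead orb : List Triple) → Bool
  isOrbit []                ins dead orb = true
  isOrbit (group π es ∷ gs) ins dead orb =
    swapsBelow (suc m) π ∧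
    null (removeAll (triples (suc m)) (map (act (swaps π)) (triples (suc m)))) ∧
    null (removeAll (map (act (swaps π)) (triples (suc m))) (triples (suc m))) ∧
    preserves (swaps π) ins ∧ preserves (swaps π) dead ∧ growable (swaps π) es orb ∧
    isOrbit gs ins dead (grow es orb)

  isStar : ℕ → List Triple → Bool
  isStar x dead =
    (x <ᵇ suc m) ∧
    null (removeAll (triples (suc m)) (map (act (recentre x)) (triples m))) ∧
    (alive dead x (triples m) <ᵇ d)

  check      : Certificate → (ins dead pool : List Triple) → Bool
  checkDrops : List ℕ → Certificate → (ins dead pool : List Triple) → Bool
  checkDrop  : Bool → List Triple → List ℕ → Certificate → (ins dead pool : List Triple) → Bool

  check (bound qs)        ins dead pool = isBound b ins qs pool 0
  check (star x)          ins dead pool = isStar x dead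
  check (drop qs c)       ins dead pool = checkDrops qs c ins dead pool
  check (split e c gs c′) ins dead pool =
    -- `e` stays in the pool: known edges have to be counted in the final bound, and `unknowns`
    -- keeps them out of the blocks that lose a triple.
    check c (decode e ∷ ins) dead pool ∧
    isOrbit gs ins dead (decode e ∷ []) ∧
    check c′ ins (orbit gs (decode e ∷ []) ++ dead) (removeAll (orbit gs (decode e ∷ [])) pool)

  checkDrops []       c ins dead pool = check c ins dead pool
  checkDrops (q ∷ qs) c ins dead pool =
    checkDrop (path (decode⁴ q)) (unknowns ins (decode⁴ q)) qs c ins dead pool

  checkDrop p (e ∷ []) qs c ins dead pool = p ∧ checkDrops qs c ins (e ∷ dead) (remove e pool)
  checkDrop p _        qs c ins dead pool = false

  -- The dichotomy to be certified on `suc m` vertices. The embedding stands for the deletion of a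
  -- vertex, and the inequality is strict so that `d = 0` makes the second alternative impossible
  -- and turns the dichotomy into a plain edge bound.
  Sparse Starlike SparseOrStarlike : Family → Set
  Sparse E = count E (triples (suc m)) ≤ b
  Starlike E = Σ (Embedding m (suc m)) λ τ → count (relabel (to τ) E) (triples m) < d
  SparseOrStarlike E = Sparse E ⊎ Starlike E

  record Consistent (E : Family) (ins dead : List Triple) : Set where
    field
      present : All (λ t → E t ≡ true) ins
      absent  : All (λ t → E t ≡ false) dead

  open Consistent

  -- The invariant of the pool. It is stated for every family that avoids `dead`, because at a split
  -- the soundness of a subtree is used for all families consistent with the node and not only for
  -- the given one.
  Covers : (dead pool : List Triple) → Set
  Covers dead pool = ∀ E → All (λ t → E t ≡ false) dead → count E (triples (suc m)) ≤ count E pool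

  all-filter : ∀ (E : Family) {ins} → All (λ t → E t ≡ true) ins → ∀ ts →
    All (λ t → E t ≡ true) (filterᵇ (λ t → not (member t ins)) ts) → All (λ t → E t ≡ true) ts
  all-filter E present []       _ = []
  all-filter E {ins} present (t ∷ ts) h with member t ins in eq
  all-filter E present (t ∷ ts) h        | true  = member-lookup eq present ∷ all-filter E present ts h
  all-filter E present (t ∷ ts) (p ∷ ps) | false = p ∷ all-filter E present ts ps

  -- Otherwise the whole path would lie in `E`, its other members being in `ins`.
  unknowns-< : ∀ {E ins} → PathFree E → All (λ t → E t ≡ true) ins → ∀ q → path q ≡ true →
    count E (unknowns ins q) < length (unknowns ins q)
  unknowns-< {E} {ins} free present q p with count-full-or-less E (unknowns ins q)
  ... | inj₁ full = contradiction (all-filter E present (members q) full) (free q p)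
  ... | inj₂ lt   = lt

  -- `slack` carries the bounds for the blocks already taken out of the pool: each block contributes
  -- at most its size minus one.
  isBound-sound : ∀ {E ins} → PathFree E → All (λ t → E t ≡ true) ins → ∀ qs pool slack →
    isBound b ins qs pool slack ≡ true → slack + count E pool ≤ b
  isBound-sound {E} free present [] pool slack p =
    ≤-trans (+-monoʳ-≤ slack (count≤length E pool)) (≤ᵇ-sound p)
  isBound-sound {E} {ins} free present (q ∷ qs) pool slack p with ∧-true p
  ... | isPath , r = begin
    slack + count E pool                      ≤⟨ +-monoʳ-≤ slack (count-removeAll E us pool) ⟩
    slack + (count E us + count E pool′)      ≡⟨ +-assoc slack (count E us) _ ⟨
    slack + count E us + count E pool′        ≤⟨ +-monoˡ-≤ _ (+-monoʳ-≤ slack (<⇒≤pred (unknowns-< free present (decode⁴ q) isPath))) ⟩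
    slack + pred (length us) + count E pool′  ≤⟨ isBound-sound free present qs pool′ _ r ⟩
    b                                         ∎
    where
    open ≤-Reasoning
    us = unknowns ins (decode⁴ q)
    pool′ = removeAll us pool

  preserves-sound : ∀ {E} → Symmetric E → ∀ {x} σ ts us → all (λ t → member (act σ t) us) ts ≡ true →
    All (λ t → E t ≡ x) us → All (λ t → relabel σ E t ≡ x) ts
  preserves-sound S σ []       us p h = []
  preserves-sound S σ (t ∷ ts) us p h with ∧-true {member (act σ t) us} p
  ... | q , r = trans (sym (act-relabel S σ t)) (member-lookup q h) ∷ preserves-sound S σ ts us r h

  Starlike-relabel : ∀ {E} (σ : Embedding (suc m) (suc m)) → Starlike (relabel (to σ) E) → Starlike E
  Starlike-relabel {E} σ (τ , lt) =
    (σ ∘ₑ τ) , subst (_< d) (sym (count-cong (relabel-∘ E (to σ) (to τ)) (triples m))) lt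

  module _ {ins dead : List Triple} where

    -- The presence of `t` settles the goal at this node. Quantifying over all families makes this a
    -- property of the node, invariant under its symmetries; for one fixed `E` it could not be moved
    -- along an orbit.
    Refuted : Triple → Set
    Refuted t = ∀ E → Admissible E → Consistent E ins dead → E t ≡ true → SparseOrStarlike E

    module _ (π : List ℕ)
             (below : swapsBelow (suc m) π ≡ true)
             (onto : null (removeAll (triples (suc m)) (map (act (swaps π)) (triples (suc m)))) ≡ true)
             (into : null (removeAll (map (act (swaps π)) (triples (suc m))) (triples (suc m))) ≡ true)
             (insFixed : preserves (swaps π) ins ≡ true)
             (deadFixed : preserves (swaps π) dead ≡ true) where

      private
        σ : Embedding (suc m) (suc m)
        σ = record
          { to = swaps π ; injective = swaps-inj π ; bounded = swaps-< π below
          ; decreasing = covered {suc m} {suc m} onto }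

      -- If the image of `t` is an edge of `E`, then `t` itself is an edge of the pullback of `E`.
      -- The pullback is admissible and consistent with the same node, since `π` preserves `ins` and
      -- `dead`, so `Refuted t` applies to it.
      transport : ∀ {t} → Refuted t → Refuted (act (swaps π) t)
      transport {t} r E A C h with r (relabel (to σ) E) (Admissible-relabel (injective σ) A)
        (record { present = preserves-sound (symmetric A) (to σ) ins ins insFixed (present C)
                ; absent = preserves-sound (symmetric A) (to σ) dead dead deadFixed (absent C) })
        (trans (sym (act-relabel (symmetric A) (to σ) t)) h)
      ... | inj₂ s = inj₂ (Starlike-relabel {E} σ s)
      -- The edge bound returns to `E` because every triple is the image of a triple.
      ... | inj₁ s = inj₁ (begin
        count E ts                        ≤⟨ count-null E (map (act (to σ)) ts) ts into ⟩
        count E (map (act (to σ)) ts)     ≡⟨ count-map (act (to σ)) (act-relabel (symmetric A) (to σ)) ts ⟩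
        count (relabel (to σ) E) ts       ≤⟨ s ⟩
        b                                 ∎)
        where
        open ≤-Reasoning
        ts = triples (suc m)

      transport-member : ∀ {u} ts → member u (map (act (swaps π)) ts) ≡ true → All Refuted ts → Refuted u
      transport-member {u} (t ∷ ts) p (r ∷ rs) with u ≡ᵗ act (swaps π) t in eq
      ... | true  rewrite ≡ᵗ-sound u (act (swaps π) t) eq = transport r
      ... | false = transport-member ts p rs

      grow-sound : ∀ es orb → growable (swaps π) es orb ≡ true → All Refuted orb → All Refuted (grow es orb)
      grow-sound []       orb p rs = rs
      grow-sound (e ∷ es) orb p rs with ∧-true p
      ... | q , r = grow-sound es (decode e ∷ orb) r (transport-member orb q rs ∷ rs)

    isOrbit-sound : ∀ gs orb → isOrbit gs ins dead orb ≡ true → All Refuted orb → All Refuted (orbit gs orb)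
    isOrbit-sound []                orb p rs = rs
    isOrbit-sound (group π es ∷ gs) orb p rs with ∧-true p
    ... | p₁ , q₁ with ∧-true q₁
    ... | p₂ , q₂ with ∧-true q₂
    ... | p₃ , q₃ with ∧-true q₃
    ... | p₄ , q₄ with ∧-true q₄
    ... | p₅ , q₅ with ∧-true q₅
    ... | p₆ , q₆ = isOrbit-sound gs (grow es orb) q₆ (grow-sound π p₁ p₂ p₃ p₄ p₅ es orb p₆ rs)

    -- The symmetry breaking at a split: an orbit member that is present settles the goal, and
    -- otherwise the whole orbit may be declared dead.
    goal-or-absent : ∀ {E} → Admissible E → Consistent E ins dead → ∀ ts → All Refuted ts →
      SparseOrStarlike E ⊎ All (λ t → E t ≡ false) ts
    goal-or-absent A C []       []       = inj₂ []
    goal-or-absent {E} A C (t ∷ ts) (r ∷ rs) with E t in eq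
    ... | true  = inj₁ (r E A C eq)
    ... | false with goal-or-absent A C ts rs
    ...   | inj₁ g = inj₁ g
    ...   | inj₂ h = inj₂ (eq ∷ h)

  alive-sound : ∀ {E} → Symmetric E → ∀ {dead} → All (λ t → E t ≡ false) dead → ∀ x ts →
    count (relabel (recentre x) E) ts ≤ alive dead x ts
  alive-sound S absent x [] = z≤n
  alive-sound {E} S {dead} absent x (t ∷ ts) = +-mono-≤ first (alive-sound S absent x ts)
    where
    first : bit (relabel (recentre x) E t) ≤ bit (not (member (act (recentre x) t) dead))
    first with member (act (recentre x) t) dead in eq
    ... | false = bit≤1 _
    ... | true  rewrite trans (sym (act-relabel S (recentre x) t)) (member-lookup eq absent) = z≤n

  isStar-sound : ∀ {E} → Symmetric E → ∀ {dead} → All (λ t → E t ≡ false) dead → ∀ x →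
    isStar x dead ≡ true → Starlike E
  isStar-sound {E} S absent x p with ∧-true p
  ... | x<m , q with ∧-true q
  ... | onto , small = τ , ≤-<-trans (alive-sound S absent x (triples m)) (<ᵇ-sound small)
    where
    τ : Embedding m (suc m)
    τ = record
      { to = recentre x
      ; injective = λ {u} {v} r → suc-injective (swap-inj 0 x r)
      ; bounded = λ y<m → swap-< {a = 0} {b = x} z<s (<ᵇ-sound {x} x<m) (s<s y<m)
      ; decreasing = covered {m} {suc m} onto }

  check-sound : ∀ c {ins dead pool} → check c ins dead pool ≡ true → Covers dead pool →
    ∀ E → Admissible E → Consistent E ins dead → SparseOrStarlike E
  drops-sound : ∀ qs c {ins dead pool} → checkDrops qs c ins dead pool ≡ true → Covers dead pool →
    ∀ E → Admissible E → Consistent E ins dead → SparseOrStarlike E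

  check-sound (bound qs) p cov E A C =
    inj₁ (≤-trans (cov E (absent C)) (isBound-sound (pathFree A) (present C) qs _ 0 p))
  check-sound (star x) p cov E A C = inj₂ (isStar-sound (symmetric A) (absent C) x p)
  check-sound (drop qs c) p cov E A C = drops-sound qs c p cov E A C
  check-sound (split e c gs c′) {ins} {dead} {pool} p cov E A C with ∧-true p
  ... | p₁ , q₁ with ∧-true q₁
  ... | p₂ , p₃ with goal-or-absent A C orb (isOrbit-sound gs (decode e ∷ []) p₂ (refuted ∷ []))
    where
    orb = orbit gs (decode e ∷ [])
    refuted : Refuted (decode e)
    refuted F A′ C′ h = check-sound c p₁ cov F A′ (record { present = h ∷ present C′ ; absent = absent C′ })
  ... | inj₁ g = g
  ... | inj₂ h = check-sound c′ p₃ cov′ E A (record { present = present C ; absent = All.++⁺ h (absent C) })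
    where
    orb = orbit gs (decode e ∷ [])
    cov′ : Covers (orb ++ dead) (removeAll orb pool)
    cov′ F none = begin
      count F (triples (suc m))                     ≤⟨ cov F (All.++⁻ʳ orb none) ⟩
      count F pool                                  ≤⟨ count-removeAll F orb pool ⟩
      count F orb + count F (removeAll orb pool)    ≡⟨ cong (_+ count F (removeAll orb pool)) (count-empty (All.++⁻ˡ orb none)) ⟩
      count F (removeAll orb pool)                  ∎
      where open ≤-Reasoning

  drops-sound []       c p cov E A C = check-sound c p cov E A C
  drops-sound (q ∷ qs) c {ins} {dead} {pool} p cov E A C = go (unknowns ins (decode⁴ q)) refl p
    where
    go : ∀ us → unknowns ins (decode⁴ q) ≡ us →
      checkDrop (path (decode⁴ q)) us qs c ins dead pool ≡ true → SparseOrStarlike E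
    go (e ∷ []) eq r with ∧-true r
    ... | isPath , s = drops-sound qs c s cov′ E A
        (record { present = present C ; absent = missing ∷ absent C })
      where
      missing : E e ≡ false
      -- `e` is the only unknown triple of the path, and fewer than one of the unknown triples is
      -- present.
      missing with E e in Ee | subst (λ us → count E us < length us) eq (unknowns-< (pathFree A) (present C) (decode⁴ q) isPath)
      ... | false | _ = refl
      ... | true  | lt = contradiction lt (<-irrefl refl)
      cov′ : Covers (e ∷ dead) (remove e pool)
      cov′ F (x ∷ none) = begin
        count F (triples (suc m))              ≤⟨ cov F none ⟩
        count F pool                           ≤⟨ count-remove F e pool ⟩
        bit (F e) + count F (remove e pool)    ≡⟨ cong (λ y → bit y + count F (remove e pool)) x ⟩
        count F (remove e pool)                ∎
        where open ≤-Reasoning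

  certified : ∀ c → check c [] [] (triples (suc m)) ≡ true → ∀ E → Admissible E → SparseOrStarlike E
  certified c p E A = check-sound c p (λ _ _ → ≤-refl) E A (record { present = [] ; absent = [] })

-- Deletion of the centre of a starlike class

data Proper (n : ℕ) : Triple → Set where
  proper : ∀ {a b c} → a < n → b < n → c < n → a ≢ b → a ≢ c → b ≢ c → Proper n (tri a b c)

Proper-map : ∀ {m n} (τ : Embedding m n) {t} → Proper m t → Proper n (mapᵗ (to τ) t)
Proper-map τ (proper a<m b<m c<m a≢b a≢c b≢c) =
  proper (bounded τ a<m) (bounded τ b<m) (bounded τ c<m)
         (a≢b ∘ injective τ) (a≢c ∘ injective τ) (b≢c ∘ injective τ)

increasing : ℕ → Triple → Bool
increasing n (tri a b c) = (a <ᵇ b) ∧ (b <ᵇ c) ∧ (c <ᵇ n)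

increasing⇒Proper : ∀ {n} t → increasing n t ≡ true → Proper n t
increasing⇒Proper {n} (tri a b c) p with ∧-true {a <ᵇ b} p
... | q , r with ∧-true {b <ᵇ c} r
... | s , u with <ᵇ-sound {a} q | <ᵇ-sound {b} s | <ᵇ-sound {c} u
... | a<b | b<c | c<n =
  proper (<-trans a<b (<-trans b<c c<n)) (<-trans b<c c<n) c<n
         (<⇒≢ a<b) (<⇒≢ (<-trans a<b b<c)) (<⇒≢ b<c)

all⇒All : ∀ (f : Triple → Bool) ts → all f ts ≡ true → All (λ t → f t ≡ true) ts
all⇒All f []       p = []
all⇒All f (t ∷ ts) p with ∧-true {f t} p
... | q , r = q ∷ all⇒All f ts r

_∪ᶠ_ : Family → Family → Family
(X ∪ᶠ E) t = X t ∨ E t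

Symmetric-∪ᶠ : ∀ {X E} → Symmetric X → Symmetric E → Symmetric (X ∪ᶠ E)
Symmetric-∪ᶠ S S′ = record
  { exchange₁ = λ a b c → cong₂ _∨_ (exchange₁ S a b c) (exchange₁ S′ a b c)
  ; exchange₂ = λ a b c → cong₂ _∨_ (exchange₂ S a b c) (exchange₂ S′ a b c) }

count-∪ᶠ : ∀ X E ts → count (X ∪ᶠ E) ts ≤ count X ts + count E ts
count-∪ᶠ X E []       = z≤n
count-∪ᶠ X E (t ∷ ts) = begin
  bit (X t ∨ E t) + count (X ∪ᶠ E) ts               ≤⟨ +-mono-≤ (bit-∨ (X t) (E t)) (count-∪ᶠ X E ts) ⟩
  (bit (X t) + bit (E t)) + (count X ts + count E ts) ≡⟨ interchange (bit (X t)) (bit (E t)) (count X ts) (count E ts) ⟩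
  (bit (X t) + count X ts) + (bit (E t) + count E ts) ∎
  where
  open ≤-Reasoning
  open CommutativeSemigroupProperties +-commutativeSemigroup using (interchange)
  bit-∨ : ∀ x y → bit (x ∨ y) ≤ bit x + bit y
  bit-∨ true  y = s≤s z≤n
  bit-∨ false y = ≤-refl

Covered : Family → List Family → Triple → Set
Covered X Es t = X t ≡ true ⊎ Any (λ E → E t ≡ true) Es

absorb : ∀ {X E Es t} → Covered X (E ∷ Es) t → Covered (X ∪ᶠ E) Es t
absorb {X} {E} {t = t} (inj₁ x) = inj₁ (cong (_∨ E t) x)
absorb {X} {E} {t = t} (inj₂ (here e)) = inj₁ (trans (∨-comm (X t) (E t)) (cong (_∨ X t) e))
absorb (inj₂ (there p)) = inj₂ p

-- A union bound. The classes are absorbed one after another into the exceptional family, which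
-- keeps the form of the hypothesis during the induction on `Es`.
count-Covered : ∀ X Es ts → All (Covered X Es) ts →
  length ts ≤ count X ts + sum (map (λ E → count E ts) Es)
count-Covered X [] ts cov = ≤-trans (full ts cov) (m≤m+n _ 0)
  where
  full : ∀ ts → All (Covered X []) ts → length ts ≤ count X ts
  full []       []              = z≤n
  full (t ∷ ts) (inj₁ p ∷ ps) rewrite p = s≤s (full ts ps)
count-Covered X (E ∷ Es) ts cov = begin
  length ts                                         ≤⟨ count-Covered (X ∪ᶠ E) Es ts (All.map (absorb {X} {E}) cov) ⟩
  count (X ∪ᶠ E) ts + rest                          ≤⟨ +-monoˡ-≤ rest (count-∪ᶠ X E ts) ⟩
  count X ts + count E ts + rest                    ≡⟨ +-assoc (count X ts) _ _ ⟩
  count X ts + (count E ts + rest)                  ∎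
  where
  open ≤-Reasoning
  rest = sum (map (λ E → count E ts) Es)

-- A colouring of the triples below n with r colours, except that k
-- triples may be left without a colour.
record Cover (n r k : ℕ) : Set₁ where
  field
    families     : List Family
    size         : length families ≡ r
    admissible   : All Admissible families
    exceptions   : Family
    symmetricᵉ   : Symmetric exceptions
    rare         : count exceptions (triples n) ≤ k
    covers       : ∀ {t} → Proper n t → Covered exceptions families t

Cover-mono : ∀ {n r k l} → k ≤ l → Cover n r k → Cover n r l
Cover-mono k≤l C = record
  { families = families ; size = size ; admissible = admissible ; exceptions = exceptions
  ; symmetricᵉ = symmetricᵉ ; rare = ≤-trans rare k≤l ; covers = covers }
  where open Cover C

module _ {m b d : ℕ} (goal : ∀ E → Admissible E → Checker.SparseOrStarlike m b d E) where

  open Checker m b d using (Starlike)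

  private
    ts = triples (suc m)

  -- The pigeonhole step: without a starlike class the edge bounds add up. The starlike class may
  -- stand anywhere in the list, hence the permutation.
  starlike-or-sparse : ∀ Es → All Admissible Es →
    (∃[ E ] ∃[ Es′ ] Es ↭ E ∷ Es′ × Starlike E) ⊎ sum (map (λ E → count E ts) Es) ≤ length Es * b
  starlike-or-sparse []       []       = inj₂ z≤n
  starlike-or-sparse (E ∷ Es) (A ∷ As) with goal E A | starlike-or-sparse Es As
  ... | inj₂ s | _                          = inj₁ (E , Es , ↭-refl , s)
  ... | inj₁ _ | inj₁ (F , Es′ , perm , s)  = inj₁ (F , E ∷ Es′ , ↭-trans (prep E perm) (↭-swap E F ↭-refl) , s)
  ... | inj₁ p | inj₂ q                     = inj₂ (+-mono-≤ p q)

  -- If all classes were sparse, classes and exceptions together would be too few for the triples.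
  -- So some class is starlike, and it is given up: pulled back along `τ` it keeps fewer than `d`
  -- triples, which become exceptions, while the pullbacks of the other classes form the new list.
  delete-centre : ∀ {r k} → all (increasing (suc m)) ts ≡ true → (k + suc r * b <ᵇ length ts) ≡ true →
    Cover (suc m) (suc r) k → ∃[ e ] e < d × Cover m r (k + e)
  delete-centre {r} {k} inc few C with starlike-or-sparse families admissible
    where open Cover C
  ... | inj₂ sparse = contradiction (<ᵇ-sound few) (≤⇒≯ (begin
    length ts                                                  ≤⟨ count-Covered exceptions families ts
                                                                    (All.map (covers ∘ increasing⇒Proper _) (all⇒All _ ts inc)) ⟩
    count exceptions ts + sum (map (λ E → count E ts) families) ≤⟨ +-mono-≤ rare sparse ⟩
    k + length families * b                                     ≡⟨ cong (λ s → k + s * b) size ⟩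
    k + suc r * b                                               ∎))
    where
    open ≤-Reasoning
    open Cover C
  ... | inj₁ (E , Es , perm , τ , lt) with All-resp-↭ perm admissible
    where open Cover C
  ... | A ∷ As = count (relabel (to τ) E) (triples m) , lt , record
    { families   = map (relabel (to τ)) Es
    ; size       = trans (length-map _ Es) (suc-injective (trans (sym (↭-length perm)) size))
    ; admissible = All.map⁺ (All.map (Admissible-relabel (injective τ)) As)
    ; exceptions = relabel (to τ) (exceptions ∪ᶠ E)
    ; symmetricᵉ = Symmetric-relabel (to τ) (Symmetric-∪ᶠ symmetricᵉ (Admissible.symmetric A))
    -- The old exceptions do not become more numerous under the pullback, and the new ones
    -- contribute at most `e`, the number of triples kept by the class given up.
    ; rare       = ≤-trans (count-∪ᶠ (relabel (to τ) exceptions) (relabel (to τ) E) (triples m))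
                     (+-monoˡ-≤ _ (≤-trans (decreasing τ symmetricᵉ) rare))
    ; covers     = λ p → Covered-map (absorb {exceptions} {E} (Covered-↭ (covers (Proper-map τ p))))
    }
    where
    open Cover C
    Covered-↭ : ∀ {t} → Covered exceptions families t → Covered exceptions (E ∷ Es) t
    Covered-↭ (inj₁ p) = inj₁ p
    Covered-↭ (inj₂ p) = inj₂ (Any-resp-↭ perm p)
    Covered-map : ∀ {t} → Covered (exceptions ∪ᶠ E) Es (mapᵗ (to τ) t) →
      Covered (relabel (to τ) (exceptions ∪ᶠ E)) (map (relabel (to τ)) Es) t
    Covered-map (inj₁ p) = inj₁ p
    Covered-map (inj₂ p) = inj₂ (Any.map⁺ p)

-- From colourings to families of triples

vertices : ∀ n → Triple → Subset n
vertices n t = Vec.tabulate (λ x → elem (toℕ x) t)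

∈-vertices⁺ : ∀ {n} {x : Fin n} {t} → elem (toℕ x) t ≡ true → x ∈ₛ vertices n t
∈-vertices⁺ {n} {x} {t} p = lookup⇒[]= x (vertices n t) (trans (lookup∘tabulate _ x) p)

∈-vertices⁻ : ∀ {n} {x : Fin n} {t} → x ∈ₛ vertices n t → elem (toℕ x) t ≡ true
∈-vertices⁻ {n} {x} {t} p = trans (sym (lookup∘tabulate _ x)) ([]=⇒lookup p)

∣tabulate-insert∣ : ∀ {n a} (g : ℕ → Bool) → a < n → g a ≡ false →
  ∣ Vec.tabulate {n = n} (λ x → (toℕ x ≡ᵇ a) ∨ g (toℕ x)) ∣ ≡ suc ∣ Vec.tabulate {n = n} (g ∘ toℕ) ∣
∣tabulate-insert∣ {suc n} {zero}  g _       p rewrite p = refl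
∣tabulate-insert∣ {suc n} {suc a} g (s≤s q) p with g 0
... | true  = cong suc (∣tabulate-insert∣ (g ∘ suc) q p)
... | false = ∣tabulate-insert∣ (g ∘ suc) q p

∣tabulate-false∣ : ∀ n → ∣ Vec.tabulate {n = n} (λ _ → false) ∣ ≡ 0
∣tabulate-false∣ zero    = refl
∣tabulate-false∣ (suc n) = ∣tabulate-false∣ n

∣vertices∣ : ∀ {n t} → Proper n t → ∣ vertices n t ∣ ≡ 3
∣vertices∣ {n} {tri a b c} (proper a<n b<n c<n a≢b a≢c b≢c) = begin
  ∣ vertices n (tri a b c) ∣
    ≡⟨ ∣tabulate-insert∣ (λ v → (v ≡ᵇ b) ∨ (v ≡ᵇ c)) a<n (cong₂ _∨_ (≢⇒≡ᵇ-false a≢b) (≢⇒≡ᵇ-false a≢c)) ⟩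
  1 + ∣ Vec.tabulate {n = n} (λ x → (toℕ x ≡ᵇ b) ∨ (toℕ x ≡ᵇ c)) ∣
    ≡⟨ cong suc (∣tabulate-insert∣ (λ v → v ≡ᵇ c) b<n (≢⇒≡ᵇ-false b≢c)) ⟩
  2 + ∣ Vec.tabulate {n = n} (λ x → toℕ x ≡ᵇ c) ∣
    -- The last vertex is written as an insertion into the empty set, so that the count of an
    -- insertion applies a third time.
    ≡⟨ cong (λ (p : Subset n) → 2 + ∣ p ∣) (tabulate-cong (λ x → sym (∨-identityʳ (toℕ x ≡ᵇ c)))) ⟩
  2 + ∣ Vec.tabulate {n = n} (λ x → (toℕ x ≡ᵇ c) ∨ false) ∣
    ≡⟨ cong (2 +_) (∣tabulate-insert∣ (λ _ → false) c<n refl) ⟩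
  3 + ∣ Vec.tabulate {n = n} (λ _ → false) ∣
    ≡⟨ cong (3 +_) (∣tabulate-false∣ n) ⟩
  3 ∎
  where open ≡-Reasoning

∨-trueˡ : ∀ {x y} → x ≡ true → x ∨ y ≡ true
∨-trueˡ refl = refl

∨-trueʳ : ∀ {x y} → y ≡ true → x ∨ y ≡ true
∨-trueʳ {true}  _ = refl
∨-trueʳ {false} p = p

common⇒Nonempty : ∀ {n v} t u → v < n → elem v t ≡ true → elem v u ≡ true → Nonempty (vertices n t ∩ vertices n u)
common⇒Nonempty {n} t u v<n h h′ = fromℕ< v<n , x∈p∩q⁺
  ( ∈-vertices⁺ {t = t} (trans (cong (λ w → elem w t) (toℕ-fromℕ< v<n)) h)
  , ∈-vertices⁺ {t = u} (trans (cong (λ w → elem w u) (toℕ-fromℕ< v<n)) h′))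

-- Properness of `t` puts the common vertex below `n`, where it is an element of the subsets.
meets⇒Nonempty : ∀ {n t u} → Proper n t → meets t u ≡ true → Nonempty (vertices n t ∩ vertices n u)
meets⇒Nonempty {t = t@(tri a b c)} {u} (proper a<n b<n c<n _ _ _) p with ∨-true {elem a u} p
... | inj₁ q = common⇒Nonempty t u a<n (∨-trueˡ (≡ᵇ-refl a)) q
... | inj₂ r with ∨-true {elem b u} r
...   | inj₁ q = common⇒Nonempty t u b<n (∨-trueʳ {b ≡ᵇ a} (∨-trueˡ (≡ᵇ-refl b))) q
...   | inj₂ q = common⇒Nonempty t u c<n (∨-trueʳ {c ≡ᵇ a} (∨-trueʳ {c ≡ᵇ b} (≡ᵇ-refl c))) q

Nonempty⇒meets : ∀ {n} t u → Nonempty (vertices n t ∩ vertices n u) → meets t u ≡ true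
Nonempty⇒meets t@(tri a b c) u (x , x∈) with x∈p∩q⁻ _ _ x∈
... | x∈t , x∈u with ∈-vertices⁻ {t = u} x∈u | ∨-true {toℕ x ≡ᵇ a} (∈-vertices⁻ {t = t} x∈t)
... | h | inj₁ p = ∨-trueˡ (subst (λ v → elem v u ≡ true) (≡ᵇ-sound p) h)
... | h | inj₂ q with ∨-true {toℕ x ≡ᵇ b} q
...   | inj₁ p = ∨-trueʳ {elem a u} (∨-trueˡ (subst (λ v → elem v u ≡ true) (≡ᵇ-sound p) h))
...   | inj₂ p = ∨-trueʳ {elem a u} (∨-trueʳ {elem b u} (subst (λ v → elem v u ≡ true) (≡ᵇ-sound p) h))

edge : Quad → Fin 4 → Triple
edge q zero                   = Quad.e₀ q
edge q 1F = Quad.e₁ q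
edge q 2F = Quad.e₂ q
edge q 3F = Quad.e₃ q

All-members : ∀ {P : Triple → Set} q → All P (members q) → ∀ i → P (edge q i)
All-members q (p₀ ∷ p₁ ∷ p₂ ∷ p₃ ∷ []) 0F = p₀
All-members q (p₀ ∷ p₁ ∷ p₂ ∷ p₃ ∷ []) 1F = p₁
All-members q (p₀ ∷ p₁ ∷ p₂ ∷ p₃ ∷ []) 2F = p₂
All-members q (p₀ ∷ p₁ ∷ p₂ ∷ p₃ ∷ []) 3F = p₃

module _ {n : ℕ} (q : Quad) (isPath : path q ≡ true) (allProper : All (Proper n) (members q)) where

  private
    open Quad q
    a : Fin 4 → Subset n
    a i = vertices n (edge q i)

    links : (meets e₀ e₁ ≡ true × meets e₁ e₂ ≡ true × meets e₂ e₃ ≡ true) ×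
            (meets e₀ e₂ ≡ false × meets e₀ e₃ ≡ false × meets e₁ e₃ ≡ false)
    links with ∧-true {meets e₀ e₁} isPath
    ... | p₀₁ , r₁ with ∧-true {meets e₁ e₂} r₁
    ... | p₁₂ , r₂ with ∧-true {meets e₂ e₃} r₂
    ... | p₂₃ , r₃ with ∧-true {not (meets e₀ e₂)} r₃
    ... | p₀₂ , r₄ with ∧-true {not (meets e₀ e₃)} r₄
    ... | p₀₃ , p₁₃ = (p₀₁ , p₁₂ , p₂₃) , (not-true p₀₂ , not-true p₀₃ , not-true p₁₃)

    meets-self : ∀ i → meets (edge q i) (edge q i) ≡ true
    meets-self i with edge q i
    ... | tri a b c = ∨-trueˡ (∨-trueˡ (≡ᵇ-refl a))

    flip : ∀ {p r : Subset n} → Nonempty (p ∩ r) → Nonempty (r ∩ p)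
    flip {p} {r} (x , x∈) with x∈p∩q⁻ p r x∈
    ... | x∈p , x∈r = x , x∈p∩q⁺ (x∈r , x∈p)

    near : ∀ i j → meets (edge q i) (edge q j) ≡ true → ∣ toℕ i - toℕ j ∣ ≤ 1 →
      Nonempty (a i ∩ a j) ⇔ ∣ toℕ i - toℕ j ∣ ≤ 1
    near i j p le = mk⇔ (λ _ → le) (λ _ → meets⇒Nonempty (All-members q allProper i) p)

    -- `path` tests each pair of edges in one order only; the pairs with `i` above `j` are obtained
    -- from the symmetry of the intersection.
    near′ : ∀ i j → meets (edge q j) (edge q i) ≡ true → ∣ toℕ i - toℕ j ∣ ≤ 1 →
      Nonempty (a i ∩ a j) ⇔ ∣ toℕ i - toℕ j ∣ ≤ 1
    near′ i j p le = mk⇔ (λ _ → le) (λ _ → flip {a j} {a i} (meets⇒Nonempty (All-members q allProper j) p))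

    far : ∀ i j → meets (edge q i) (edge q j) ≡ false → ¬ ∣ toℕ i - toℕ j ∣ ≤ 1 →
      Nonempty (a i ∩ a j) ⇔ ∣ toℕ i - toℕ j ∣ ≤ 1
    far i j p ≰1 = mk⇔ (λ ne → contradiction (trans (sym p) (Nonempty⇒meets (edge q i) (edge q j) ne)) λ ())
                       (λ le → contradiction le ≰1)

    far′ : ∀ i j → meets (edge q j) (edge q i) ≡ false → ¬ ∣ toℕ i - toℕ j ∣ ≤ 1 →
      Nonempty (a i ∩ a j) ⇔ ∣ toℕ i - toℕ j ∣ ≤ 1
    far′ i j p ≰1 = mk⇔ (λ ne → contradiction (trans (sym p) (Nonempty⇒meets (edge q j) (edge q i) (flip {a i} {a j} ne))) λ ())
                        (λ le → contradiction le ≰1)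

  path-pattern : ∀ i j → Nonempty (vertices n (edge q i) ∩ vertices n (edge q j)) ⇔ ∣ toℕ i - toℕ j ∣ ≤ 1
  path-pattern i j with links
  path-pattern 0F 0F | _ = near 0F 0F (meets-self 0F) z≤n
  path-pattern 0F 1F | (p₀₁ , _) , _ = near 0F 1F p₀₁ (s≤s z≤n)
  path-pattern 0F 2F | _ , (p₀₂ , _) = far 0F 2F p₀₂ λ { (s≤s ()) }
  path-pattern 0F 3F | _ , (_ , p₀₃ , _) = far 0F 3F p₀₃ λ { (s≤s ()) }
  path-pattern 1F 0F | (p₀₁ , _) , _ = near′ 1F 0F p₀₁ (s≤s z≤n)
  path-pattern 1F 1F | _ = near 1F 1F (meets-self 1F) z≤n
  path-pattern 1F 2F | (_ , p₁₂ , _) , _ = near 1F 2F p₁₂ (s≤s z≤n)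
  path-pattern 1F 3F | _ , (_ , _ , p₁₃) = far 1F 3F p₁₃ λ { (s≤s ()) }
  path-pattern 2F 0F | _ , (p₀₂ , _) = far′ 2F 0F p₀₂ λ { (s≤s ()) }
  path-pattern 2F 1F | (_ , p₁₂ , _) , _ = near′ 2F 1F p₁₂ (s≤s z≤n)
  path-pattern 2F 2F | _ = near 2F 2F (meets-self 2F) z≤n
  path-pattern 2F 3F | (_ , _ , p₂₃) , _ = near 2F 3F p₂₃ (s≤s z≤n)
  path-pattern 3F 0F | _ , (_ , p₀₃ , _) = far′ 3F 0F p₀₃ λ { (s≤s ()) }
  path-pattern 3F 1F | _ , (_ , _ , p₁₃) = far′ 3F 1F p₁₃ λ { (s≤s ()) }
  path-pattern 3F 2F | (_ , _ , p₂₃) , _ = near′ 3F 2F p₂₃ (s≤s z≤n)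
  path-pattern 3F 3F | _ = near 3F 3F (meets-self 3F) z≤n

-- Passage from the ambient vertices to the union of the edges

restrict : ∀ {n} (U : Subset n) → Subset n → Subset ∣ U ∣
restrict []            []      = []
restrict (inside  ∷ U) (x ∷ p) = x ∷ restrict U p
restrict (outside ∷ U) (x ∷ p) = restrict U p

-- The increasing enumeration of `U`; `restrict U p` is the preimage of `p` under it.
embed : ∀ {n} (U : Subset n) → Fin ∣ U ∣ → Fin n
embed (inside  ∷ U) zero    = zero
embed (inside  ∷ U) (suc i) = suc (embed U i)
embed (outside ∷ U) i       = suc (embed U i)

embed-injective : ∀ {n} (U : Subset n) {i j} → embed U i ≡ embed U j → i ≡ j
embed-injective (inside  ∷ U) {zero}  {zero}  p = refl
embed-injective (inside  ∷ U) {suc i} {suc j} p = cong suc (embed-injective U (sucᶠ-injective p))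
embed-injective (outside ∷ U)                 p = embed-injective U (sucᶠ-injective p)

embed-∈ : ∀ {n} (U : Subset n) i → embed U i ∈ₛ U
embed-∈ (inside  ∷ U) zero    = here
embed-∈ (inside  ∷ U) (suc i) = there (embed-∈ U i)
embed-∈ (outside ∷ U) i       = there (embed-∈ U i)

embed-onto : ∀ {n} (U : Subset n) {x} → x ∈ₛ U → ∃[ i ] embed U i ≡ x
embed-onto (inside  ∷ U) here       = zero , refl
embed-onto (inside  ∷ U) (there x∈) with embed-onto U x∈
... | i , p = suc i , cong suc p
embed-onto (outside ∷ U) (there x∈) with embed-onto U x∈
... | i , p = i , cong suc p

∈-restrict⁺ : ∀ {n} (U : Subset n) {p i} → embed U i ∈ₛ p → i ∈ₛ restrict U p
∈-restrict⁺ (inside  ∷ U) {x ∷ p} {zero}  here       = here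
∈-restrict⁺ (inside  ∷ U) {x ∷ p} {suc i} (there x∈) = there (∈-restrict⁺ U x∈)
∈-restrict⁺ (outside ∷ U) {x ∷ p}         (there x∈) = ∈-restrict⁺ U x∈

∈-restrict⁻ : ∀ {n} (U : Subset n) {p i} → i ∈ₛ restrict U p → embed U i ∈ₛ p
∈-restrict⁻ (inside  ∷ U) {x ∷ p} {zero}  here       = here
∈-restrict⁻ (inside  ∷ U) {x ∷ p} {suc i} (there x∈) = there (∈-restrict⁻ U x∈)
∈-restrict⁻ (outside ∷ U) {x ∷ p}         x∈         = there (∈-restrict⁻ U x∈)

∣restrict∣ : ∀ {n} (U : Subset n) {p} → p ⊆ U → ∣ restrict U p ∣ ≡ ∣ p ∣
∣restrict∣ []            {[]}          _   = refl
∣restrict∣ (inside  ∷ U) {inside  ∷ p} p⊆U = cong suc (∣restrict∣ U (drop-∷-⊆ p⊆U))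
∣restrict∣ (inside  ∷ U) {outside ∷ p} p⊆U = ∣restrict∣ U (drop-∷-⊆ p⊆U)
∣restrict∣ (outside ∷ U) {inside  ∷ p} p⊆U with p⊆U here
... | ()
∣restrict∣ (outside ∷ U) {outside ∷ p} p⊆U = ∣restrict∣ U (drop-∷-⊆ p⊆U)

image-restrict : ∀ {n} (U : Subset n) {p} → p ⊆ U → image (embed U) (restrict U p) ≡ p
image-restrict U {p} p⊆U = trans (tabulate-cong pointwise) (tabulate∘lookup p)
  where
  preimage? : ∀ y → Dec (∃[ x ] (x ∈ₛ restrict U p × embed U x ≡ y))
  preimage? y = any? λ x → (x ∈ₛ? restrict U p) ×-dec (embed U x ≟ᶠ y)
  pointwise : ∀ y → does (preimage? y) ≡ lookup p y
  pointwise y with lookup p y in eq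
  ... | false = dec-false (preimage? y) λ { (x , x∈ , refl) →
                  contradiction (trans (sym eq) ([]=⇒lookup (∈-restrict⁻ U x∈))) λ () }
  ... | true with embed-onto U (p⊆U (lookup⇒[]= y p eq))
  ...   | i , refl = dec-true (preimage? y) (i , ∈-restrict⁺ U (lookup⇒[]= y p eq) , refl)

-- A copy has no vertices outside its edges, so it lives on their union U.
copy : ∀ {n r} (χ : Coloring n r) c (a : Fin 4 → Subset n) →
  (∀ i j → Nonempty (a i ∩ a j) ⇔ ∣ toℕ i - toℕ j ∣ ≤ 1) →
  (∀ i → 3Graph.Edges (colorClass χ c) (a i)) →
  ∃[ H ] (𝒫₄ H × ContainsCopy (colorClass χ c) H)
copy {n} χ c a pattern₄ edges = H , (noIsolated , a′ , (λ e → mk⇔ (λ h → h) (λ h → h)) , pattern′) ,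
  (mk↣ (embed-injective U) , λ { _ (i , refl) → subst (3Graph.Edges (colorClass χ c)) (sym (image-restrict U (a⊆U i))) (edges i) })
  where
  U : Subset n
  U = a 0F ∪ (a 1F ∪ (a 2F ∪ a 3F))
  a⊆U : ∀ i → a i ⊆ U
  a⊆U 0F x∈ = x∈p∪q⁺ (inj₁ x∈)
  a⊆U 1F x∈ = x∈p∪q⁺ (inj₂ (x∈p∪q⁺ (inj₁ x∈)))
  a⊆U 2F x∈ = x∈p∪q⁺ (inj₂ (x∈p∪q⁺ (inj₂ (x∈p∪q⁺ (inj₁ x∈)))))
  a⊆U 3F x∈ = x∈p∪q⁺ (inj₂ (x∈p∪q⁺ (inj₂ (x∈p∪q⁺ (inj₂ x∈)))))
  U⊆a : ∀ {x} → x ∈ₛ U → ∃[ i ] x ∈ₛ a i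
  U⊆a x∈ with x∈p∪q⁻ (a 0F) _ x∈
  ... | inj₁ h = 0F , h
  ... | inj₂ x∈′ with x∈p∪q⁻ (a 1F) _ x∈′
  ...   | inj₁ h = 1F , h
  ...   | inj₂ x∈″ with x∈p∪q⁻ (a 2F) _ x∈″
  ...     | inj₁ h = 2F , h
  ...     | inj₂ h = 3F , h
  a′ : Fin 4 → Subset ∣ U ∣
  a′ i = restrict U (a i)
  H : 3Graph
  H = record { order = ∣ U ∣ ; Edges = λ e → ∃[ i ] a′ i ≡ e
             ; uniform = λ { (i , refl) → trans (∣restrict∣ U (a⊆U i)) (proj₁ (edges i)) } }
  noIsolated : NoIsolatedVertices H
  noIsolated v with U⊆a (embed-∈ U v)
  ... | i , h = a′ i , (i , refl) , ∈-restrict⁺ U h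
  pattern′ : ∀ i j → Nonempty (a′ i ∩ a′ j) ⇔ ∣ toℕ i - toℕ j ∣ ≤ 1
  pattern′ i j = mk⇔
    (λ { (x , x∈) → let x∈i , x∈j = x∈p∩q⁻ (a′ i) (a′ j) x∈ in
         Equivalence.to (pattern₄ i j) (embed U x , x∈p∩q⁺ (∈-restrict⁻ U x∈i , ∈-restrict⁻ U x∈j)) })
    (λ le → lower (Equivalence.from (pattern₄ i j) le))
    where
    lower : Nonempty (a i ∩ a j) → Nonempty (a′ i ∩ a′ j)
    lower (x , x∈) with x∈p∩q⁻ (a i) (a j) x∈
    ... | x∈i , x∈j with embed-onto U (a⊆U i x∈i)
    ... | y , refl = y , x∈p∩q⁺ (∈-restrict⁺ U x∈i , ∈-restrict⁺ U x∈j)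

-- Colour classes and the search for a monochromatic path

Proper? : ∀ n t → Dec (Proper n t)
Proper? n (tri a b c) = map′
  (λ { (p₁ , p₂ , p₃ , p₄ , p₅ , p₆) → proper p₁ p₂ p₃ p₄ p₅ p₆ })
  (λ { (proper p₁ p₂ p₃ p₄ p₅ p₆) → p₁ , p₂ , p₃ , p₄ , p₅ , p₆ })
  (a <? n ×-dec b <? n ×-dec c <? n ×-dec ¬? (a ≟ b) ×-dec ¬? (a ≟ c) ×-dec ¬? (b ≟ c))

-- Properness bounds the three entries by `n`, so that the unbounded search reduces to a finite one.
∃-triple? : ∀ {n} {P : Triple → Set} → (∀ t → Dec (P t)) → (∀ {t} → P t → Proper n t) → Dec (∃ P)
∃-triple? {n} {P} P? isProper = map′
  (λ { (i , j , k , p) → tri (toℕ i) (toℕ j) (toℕ k) , p })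
  (λ { (t , p) → code t p (isProper p) })
  (any? λ i → any? λ j → any? λ k → P? (tri (toℕ i) (toℕ j) (toℕ k)))
  where
  code : ∀ t → P t → Proper n t → ∃[ i ] ∃[ j ] ∃[ k ] P (tri (toℕ {n} i) (toℕ {n} j) (toℕ {n} k))
  code (tri a b c) p (proper a<n b<n c<n _ _ _) = fromℕ< a<n , fromℕ< b<n , fromℕ< c<n ,
    subst P (sym (cong₂ (λ f x → f x) (cong₂ tri (toℕ-fromℕ< a<n) (toℕ-fromℕ< b<n)) (toℕ-fromℕ< c<n))) p

module _ {n r : ℕ} (χ : Coloring n r) where

  HasColour : Fin r → Triple → Set
  HasColour c t = Σ (Proper n t) λ p → χ (vertices n t) (∣vertices∣ p) ≡ c

  hasColour? : ∀ c t → Dec (HasColour c t)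
  hasColour? c t with Proper? n t
  ... | no ¬p = no (¬p ∘ proj₁)
  -- The colour does not depend on the proof that the triple is an edge, so an equation obtained
  -- with any other proof of properness is one for `p`.
  ... | yes p = map′ (p ,_) proj₂ (χ (vertices n t) (∣vertices∣ p) ≟ᶠ c)

  class : Fin r → Family
  class c t = does (hasColour? c t)

  class⇒HasColour : ∀ {c t} → class c t ≡ true → HasColour c t
  class⇒HasColour {c} {t} p with hasColour? c t
  ... | yes h = h

  HasColour-cong : ∀ {c t u} → (Proper n t → Proper n u) → vertices n t ≡ vertices n u → HasColour c t → HasColour c u
  HasColour-cong {c} {t} {u} f eq (p , h) = f p , trans (χ-cong (sym eq)) h
    where
    χ-cong : ∀ {e e′} .{q q′} → e ≡ e′ → χ e q ≡ χ e′ q′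
    χ-cong refl = refl

  class-Symmetric : ∀ c → Symmetric (class c)
  class-Symmetric c = record
    { exchange₁ = λ a b d → does-⇔ (mk⇔ (HasColour-cong exchange (eq₁ a b d)) (HasColour-cong exchange (eq₁ b a d)))
                              (hasColour? c (tri a b d)) (hasColour? c (tri b a d))
    ; exchange₂ = λ a b d → does-⇔ (mk⇔ (HasColour-cong rotate (eq₂ a b d)) (HasColour-cong rotate (eq₂ a d b)))
                              (hasColour? c (tri a b d)) (hasColour? c (tri a d b)) }
    where
    exchange : ∀ {a b d} → Proper n (tri a b d) → Proper n (tri b a d)
    exchange (proper p₁ p₂ p₃ p₄ p₅ p₆) = proper p₂ p₁ p₃ (≢-sym p₄) p₆ p₅
    rotate : ∀ {a b d} → Proper n (tri a b d) → Proper n (tri a d b)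
    rotate (proper p₁ p₂ p₃ p₄ p₅ p₆) = proper p₁ p₃ p₂ p₅ p₄ (≢-sym p₆)
    eq₁ : ∀ a b d → vertices n (tri a b d) ≡ vertices n (tri b a d)
    eq₁ a b d = tabulate-cong λ x → ∨-swap (toℕ x ≡ᵇ a) (toℕ x ≡ᵇ b) (toℕ x ≡ᵇ d)
      where
      ∨-swap : ∀ x y z → x ∨ y ∨ z ≡ y ∨ x ∨ z
      ∨-swap x y z = trans (sym (∨-assoc x y z)) (trans (cong (_∨ z) (∨-comm x y)) (∨-assoc y x z))
    eq₂ : ∀ a b d → vertices n (tri a b d) ≡ vertices n (tri a d b)
    eq₂ a b d = tabulate-cong λ x → cong ((toℕ x ≡ᵇ a) ∨_) (∨-comm (toℕ x ≡ᵇ b) (toℕ x ≡ᵇ d))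

  Monochromatic : Set
  Monochromatic = ∃[ c ] ∃[ e₀ ] ∃[ e₁ ] ∃[ e₂ ] ∃[ e₃ ]
    (path (quad e₀ e₁ e₂ e₃) ≡ true × HasColour c e₀ × HasColour c e₁ × HasColour c e₂ × HasColour c e₃)

  -- `Arrows` asks for a witness, whereas the counting argument only refutes the absence of
  -- monochromatic paths. The finite search bridges this gap.
  monochromatic? : Dec Monochromatic
  monochromatic? = any? λ c →
    ∃-triple? (λ e₀ → ∃-triple? (λ e₁ → ∃-triple? (λ e₂ → ∃-triple? (λ e₃ →
      (path (quad e₀ e₁ e₂ e₃) Bool.≟ true) ×-dec
      hasColour? c e₀ ×-dec hasColour? c e₁ ×-dec hasColour? c e₂ ×-dec hasColour? c e₃)
      (λ { (_ , _ , _ , _ , h) → proj₁ h }))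
      (λ { (_ , _ , _ , _ , h , _) → proj₁ h }))
      (λ { (_ , _ , _ , _ , h , _) → proj₁ h }))
      (λ { (_ , _ , _ , _ , h , _) → proj₁ h })

  colouring⇒Cover : ¬ Monochromatic → Cover n r 0
  colouring⇒Cover none = record
    { families   = tabulate class
    ; size       = length-tabulate class
    ; admissible = All.tabulate⁺ λ c → record { symmetric = class-Symmetric c ; pathFree = λ
        { (quad e₀ e₁ e₂ e₃) p (h₀ ∷ h₁ ∷ h₂ ∷ h₃ ∷ []) → none
          (c , e₀ , e₁ , e₂ , e₃ , p , class⇒HasColour h₀ , class⇒HasColour h₁ , class⇒HasColour h₂ , class⇒HasColour h₃) } }
    ; exceptions = λ _ → false
    ; symmetricᵉ = record { exchange₁ = λ _ _ _ → refl ; exchange₂ = λ _ _ _ → refl }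
    ; rare       = ≤-reflexive (count-empty (All.universal (λ _ → refl) (triples n)))
    ; covers     = λ {t} p → inj₂ (Any.tabulate⁺ (χ (vertices n t) (∣vertices∣ p)) (dec-true (hasColour? _ t) (p , refl)))
    }

-- The lower bound

-- The empty subset gets the value `n`, which is no vertex; `least-∈` therefore assumes a nonempty
-- one.
least : ∀ {n} → Subset n → ℕ
least []            = 0
least (inside  ∷ p) = 0
least (outside ∷ p) = suc (least p)

least-≤ : ∀ {n} {p : Subset n} {x} → x ∈ₛ p → least p ≤ toℕ x
least-≤ {p = inside  ∷ p} _          = z≤n
least-≤ {p = outside ∷ p} (there x∈) = s≤s (least-≤ x∈)

least-∈ : ∀ {n} (p : Subset n) → 0 < ∣ p ∣ → ∃[ x ] (x ∈ₛ p × toℕ x ≡ least p)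
least-∈ (inside  ∷ p) _ = zero , here , refl
least-∈ (outside ∷ p) h with least-∈ p h
... | x , x∈ , eq = suc x , there x∈ , cong suc eq

∣disjoint∪∣ : ∀ {n} (p q : Subset n) → ¬ Nonempty (p ∩ q) → ∣ p ∣ + ∣ q ∣ ≤ ∣ p ∪ q ∣
∣disjoint∪∣ []            []            _ = z≤n
∣disjoint∪∣ (inside  ∷ p) (inside  ∷ q) d = contradiction (zero , here) d
∣disjoint∪∣ (inside  ∷ p) (outside ∷ q) d = s≤s (∣disjoint∪∣ p q λ { (x , x∈) → d (suc x , there x∈) })
∣disjoint∪∣ (outside ∷ p) (inside  ∷ q) d =
  subst (_≤ suc ∣ p ∪ q ∣) (sym (+-suc ∣ p ∣ ∣ q ∣)) (s≤s (∣disjoint∪∣ p q λ { (x , x∈) → d (suc x , there x∈) }))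
∣disjoint∪∣ (outside ∷ p) (outside ∷ q) d = ∣disjoint∪∣ p q λ { (x , x∈) → d (suc x , there x∈) }

-- Only `n ∸ k` vertices are available from `k` on. Nonemptiness rules out `k` beyond `n`, where the
-- empty set would violate the inequality.
∣above∣ : ∀ {n} k (p : Subset n) → 0 < ∣ p ∣ → (∀ {x} → x ∈ₛ p → k ≤ toℕ x) → ∣ p ∣ + k ≤ n
∣above∣ zero    p             _ above = ≤-trans (≤-reflexive (+-identityʳ ∣ p ∣)) (∣p∣≤n p)
∣above∣ (suc k) (inside  ∷ p) _ above with above here
... | ()
∣above∣ (suc k) (outside ∷ p) h above =
  ≤-trans (≤-reflexive (+-suc ∣ p ∣ k)) (s≤s (∣above∣ k p h λ x∈ → s≤s⁻¹ (above (there x∈))))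

∈-image⁻ : ∀ {m n} (f : Fin m → Fin n) {p y} → y ∈ₛ image f p → ∃[ x ] (x ∈ₛ p × f x ≡ y)
∈-image⁻ f {p} {y} y∈ with any? (λ x → (x ∈ₛ? p) ×-dec (f x ≟ᶠ y)) in eq
... | yes h = h
... | no _  = contradiction (trans (sym (cong does eq)) (trans (sym (lookup∘tabulate _ y)) ([]=⇒lookup y∈))) λ ()

∈-image⁺ : ∀ {m n} (f : Fin m → Fin n) {p x} → x ∈ₛ p → f x ∈ₛ image f p
∈-image⁺ f {p} {x} x∈ = lookup⇒[]= (f x) _ (trans (lookup∘tabulate _ (f x))
  (dec-true (any? (λ x′ → (x′ ∈ₛ? p) ×-dec (f x′ ≟ᶠ f x))) (x , x∈ , refl)))

-- The first r - 1 colours are stars, and the last one lives on the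
-- remaining vertices, at most six of them when n ≤ r + 5.
starColouring : ∀ n r → Coloring n (suc r)
starColouring n r e _ = fromℕ< (s≤s (m⊓n≤n (least e) r))

module _ {n r : ℕ} {c : Fin (suc r)} {H : 3Graph} (path₄ : 𝒫₄ H)
         (contains : ContainsCopy (colorClass (starColouring n r) c) H) where

  private
    a = proj₁ (proj₂ path₄)
    isEdge = proj₁ (proj₂ (proj₂ path₄))
    pattern₄ = proj₂ (proj₂ (proj₂ path₄))
    f = Injection.to (proj₁ contains)

    b : Fin 4 → Subset n
    b i = image f (a i)

    b-edge : ∀ i → 3Graph.Edges (colorClass (starColouring n r) c) (b i)
    b-edge i = proj₂ contains (a i) (Equivalence.from (isEdge (a i)) (i , refl))

    b-nonempty : ∀ i → 0 < ∣ b i ∣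
    b-nonempty i = subst (0 <_) (sym (proj₁ (b-edge i))) z<s

    b-colour : ∀ i → least (b i) ⊓ r ≡ toℕ c
    b-colour i = trans (sym (toℕ-fromℕ< _)) (cong toℕ (proj₂ (b-edge i)))

    common : ∀ {i j x} → x ∈ₛ b i → x ∈ₛ b j → ∣ toℕ i - toℕ j ∣ ≤ 1
    common {i} {j} x∈i x∈j with ∈-image⁻ f x∈i | ∈-image⁻ f x∈j
    ... | y , y∈ , p | z , z∈ , q =
      -- A common vertex of two image edges has a single preimage, `f` being injective, so the edges
      -- of `H` already meet.
      Equivalence.to (pattern₄ i j) (y , x∈p∩q⁺ (y∈ , subst (_∈ₛ a j) (sym (Injection.injective (proj₁ contains) (trans p (sym q)))) z∈))

    disjoint : ∀ i j → ¬ ∣ toℕ i - toℕ j ∣ ≤ 1 → ∀ {x} → x ∈ₛ b i → ¬ x ∈ₛ b j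
    disjoint i j far x∈i x∈j = far (common {i} {j} x∈i x∈j)

  -- All edges of such a colour have the vertex `c` as least element, but the edges with indices 0
  -- and 2 of a minimal 4-path are disjoint.
  not-star : ¬ toℕ c < r
  not-star c<r with least-∈ (b 0F) (b-nonempty 0F) | least-∈ (b 2F) (b-nonempty 2F)
  ... | x , x∈ , p | y , y∈ , q = disjoint 0F 2F (λ { (s≤s ()) }) x∈ (subst (_∈ₛ b 2F) (toℕ-injective (trans (centre 2F q) (sym (centre 0F p)))) y∈)
    where
    centre : ∀ i {x : Fin n} → toℕ x ≡ least (b i) → toℕ x ≡ toℕ c
    centre i p with ⊓-sel (least (b i)) r
    ... | inj₁ s = trans p (trans (sym s) (b-colour i))
    ... | inj₂ s = contradiction c<r (<-irrefl (trans (sym (b-colour i)) s))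

  -- The outer edges are disjoint and give six vertices. A common vertex of the two middle edges is
  -- a seventh: the edge with index 2 misses that with index 0, and the edge with index 1 misses
  -- that with index 3. In the last colour all seven are at least `r`.
  seven-vertices : toℕ c ≡ r → 7 + r ≤ n
  seven-vertices c≡r with Equivalence.from (pattern₄ 1F 2F) (s≤s z≤n)
  ... | x , x∈ with x∈p∩q⁻ (a 1F) (a 2F) x∈
  ... | x∈₁ , x∈₂ = ≤-trans (+-monoˡ-≤ r seven) (∣above∣ r V (≤-trans (s≤s z≤n) seven) above)
    where
    w = f x
    V = (b 0F ∪ b 3F) ∪ ⁅ w ⁆
    seven : 7 ≤ ∣ V ∣
    seven = begin
      7                                     ≡⟨ cong₂ (λ s t → s + t + 1) (proj₁ (b-edge 0F)) (proj₁ (b-edge 3F)) ⟨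
      ∣ b 0F ∣ + ∣ b 3F ∣ + 1               ≡⟨ cong (∣ b 0F ∣ + ∣ b 3F ∣ +_) (∣⁅x⁆∣≡1 w) ⟨
      ∣ b 0F ∣ + ∣ b 3F ∣ + ∣ ⁅ w ⁆ ∣       ≤⟨ +-monoˡ-≤ ∣ ⁅ w ⁆ ∣ (∣disjoint∪∣ (b 0F) (b 3F) disjoint₀₃) ⟩
      ∣ b 0F ∪ b 3F ∣ + ∣ ⁅ w ⁆ ∣           ≤⟨ ∣disjoint∪∣ (b 0F ∪ b 3F) ⁅ w ⁆ new ⟩
      ∣ V ∣                                 ∎
      where
      open ≤-Reasoning
      disjoint₀₃ : ¬ Nonempty (b 0F ∩ b 3F)
      disjoint₀₃ (y , y∈) with x∈p∩q⁻ (b 0F) (b 3F) y∈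
      ... | y∈₀ , y∈₃ = disjoint 0F 3F (λ { (s≤s ()) }) y∈₀ y∈₃
      new : ¬ Nonempty ((b 0F ∪ b 3F) ∩ ⁅ w ⁆)
      new (y , y∈) with x∈p∩q⁻ (b 0F ∪ b 3F) ⁅ w ⁆ y∈
      ... | y∈b , y∈w with x∈⁅y⁆⇒x≡y w y∈w
      ... | refl with x∈p∪q⁻ (b 0F) (b 3F) y∈b
      ...   | inj₁ h = disjoint 0F 2F (λ { (s≤s ()) }) h (∈-image⁺ f x∈₂)
      ...   | inj₂ h = disjoint 1F 3F (λ { (s≤s ()) }) (∈-image⁺ f x∈₁) h
    beyond : ∀ i {y} → y ∈ₛ b i → r ≤ toℕ y
    beyond i y∈ = ≤-trans (m⊓n≡n⇒n≤m (trans (b-colour i) c≡r)) (least-≤ y∈)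
    above : ∀ {y} → y ∈ₛ V → r ≤ toℕ y
    above y∈ with x∈p∪q⁻ (b 0F ∪ b 3F) ⁅ w ⁆ y∈
    ... | inj₂ h rewrite x∈⁅y⁆⇒x≡y w h = beyond 1F (∈-image⁺ f x∈₁)
    ... | inj₁ h with x∈p∪q⁻ (b 0F) (b 3F) h
    ...   | inj₁ k = beyond 0F k
    ...   | inj₂ k = beyond 3F k

arrows⇒≥ : ∀ r n → 1 ≤ r → Arrows n 𝒫₄ r → r + 6 ≤ n
arrows⇒≥ (suc r) n _ arr with arr (starColouring n r)
... | c , H , path₄ , contains with m≤n⇒m<n∨m≡n (s≤s⁻¹ (toℕ<n c))
...   | inj₁ c<r = contradiction c<r (not-star {H = H} path₄ contains)
...   | inj₂ c≡r = subst (_≤ n) (cong suc (+-comm 6 r)) (seven-vertices {H = H} path₄ contains c≡r)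

-- The certificates

infixr 5 _&_
pattern _&_ c cs = c ∷ cs

-- One path inside the seven vertices excludes the complete 3-graph, whence 34 = 35 - 1.
certificate₇ : Certificate
certificate₇ = bound (012123345456 & [])

-- This tree and the next two share their upper part. The root takes 012 to be an edge; the orbit of
-- 012 consists of all triples, so the other branch is the empty family. Then edges are
-- distinguished by their intersection with 012: some edge is disjoint from it (345), or else some
-- edge meets it in one vertex (034), or else every edge shares at least two vertices with it.
certificate₈ : Certificate
certificate₈ =
 split 012 (
 split 345 (
 -- Given the disjoint edges 012 and 345, the first question is whether some edge contains both
 -- remaining vertices.
 split 067 (
 drop (345123012067 & 345124012067 & 345125012067 & 345134012067 & 345135012067 & 345145012067 & 345234012067 & 345235012067 & 345245012067 & 012067346345 & 012067347345 & 012067356345 & 012067357345 & 012067367345 & 012067456345 & 012067457345 & 012067467345 & 012067567345 & []) (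
 split 126 (
 drop (345034012126 & 345035012126 & 345037012126 & 345045012126 & 345047012126 & 345057012126 & []) (
 bound (267012013345 & 167012023345 & 127012036345 & 027012136345 & 026012137345 & 017012236345 & 016012237345 & 147014025256 & [])))
 (group (12 & 27 & 16 & []) (167 & 127 & 267 & []) & []) (
 split 136 (
 drop (345136012027 & []) (
 split 147 (
 drop (345147012026 & []) (
 bound (025023136147 & 035136147247 & 036136147257 & 016012237345 & 045147136236 & 047147136256 & 017012246345 & 024034136156 & [])))
 (group (45 & []) (157 & []) & group (27 & 16 & []) (246 & 256 & []) & []) (
 bound (017012236345 & 026012137345 & 016012237345 & 136013024247 & 136014025257 & []))))
 (group (12 & []) (236 & []) & group (67 & []) (137 & 237 & []) & group (35 & []) (156 & 157 & 256 & 257 & []) & group (34 & []) (146 & 147 & 246 & 247 & []) & []) (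
 bound []))))
 -- The permutation is the cycle 0, 4, 1, 5, 2, 3, which exchanges 012 and 345; its powers produce
 -- the whole orbit of 067.
 (group (10 & 02 & 25 & 14 & 03 & []) (467 & 167 & 567 & 267 & 367 & []) & []) (
 split 016 (
 drop (345234012016 & 345235012016 & 345237012016 & 345245012016 & 345247012016 & 345257012016 & 012016346345 & 012016356345 & 012016456345 & []) (
 split 347 (
 drop (012015345347 & 012017347345 & 012025345347 & 012027347345 & 012056345347 & 012125345347 & 012127347345 & 012156345347 & 012256345347 & []) (
 bound (457345013012 & 357345014012 & 126012034345 & 026012134345 & 023024145157 & 035036146124 & 137037045246 & 046057135123 & [])))
 (group (45 & []) (357 & []) & group (35 & []) (457 & []) & []) (
 split 026 (
 drop (345134012026 & 345135012026 & 345137012026 & 345145012026 & 345147012026 & 345157012026 & []) (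
 split 136 (
 drop (345136012027 & []) (
 bound (127012036345 & 126012034345 & 017012236345 & 057013136246 & 047014136256 & 025023136146 & 024037136156 & [])))
 (group (12 & []) (236 & []) & group (35 & []) (156 & 256 & []) & group (34 & []) (146 & 246 & []) & []) (
 bound (127012036345 & 126012034345 & []))))
 (group (01 & []) (126 & []) & []) (
 split 027 (
 drop (345134012027 & 345135012027 & 345136012027 & 345145012027 & 345146012027 & 345156012027 & []) (
 bound (127012034345 & 017012236345 & 013014246256 & 023024147157 & 045025123137 & 036035125124 & [])))
 (group (01 & []) (127 & []) & []) (
 split 023 (
 split 146 (
 bound (157146046023 & 156146024023 & 147146056023 & 145146036023 & 057023123146 & 037023125146 & 035023124146 & 025023134146 & 017012236345 & 013014246256 & []))
 (group (45 & []) (156 & []) & []) (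
 split 246 (
 drop (345246012017 & []) (
 bound (157013023246 & 035023246147 & 037023246145 & 015014246236 & 246024057135 & 025246134137 & 034036256125 & [])))
 (group (45 & []) (256 & []) & []) (
 bound (017012236345 & 024023135157 & 025023134147 & 036023124145 & 046034123125 & 045047137136 & []))))
 (group (01 & []) (123 & []) & group (26 & []) (036 & 136 & []) & group (35 & []) (025 & 056 & 125 & 156 & []) & group (34 & []) (024 & 046 & 124 & 146 & []) & []) (
 bound []))))))
 (group (10 & 02 & 25 & 14 & 03 & []) (456 & 126 & 356 & 026 & 346 & []) & group (67 & []) (017 & 027 & 127 & 347 & 357 & 457 & []) & []) (
 split 013 (
 split 246 (
 split 057 (
 drop (246123013057 & 246124013057 & 246134013057 & 246136013057 & 246146013057 & 246234013057 & 246236013057 & 013057245246 & []) (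
 bound (015013237246 & 157013023246 & 137013025246 & 135013024246 & 035013147246 & 037013125246 & [])))
 (group (01 & []) (157 & []) & []) (
 bound (137013025246 & 135013024246 & 257246046013 & 256246014013 & 247246056013 & 245246036013 & 037013125246 & 035013124246 & 015013234246 & 023034145156 & 045047237123 & 147146236235 & [])))
 (group (45 & []) (256 & []) & group (67 & []) (247 & 257 & []) & []) (
 split 245 (
 split 024 (
 drop (245024013136 & 245024013137 & []) (
 bound (037013146245 & 036013124245 & 157014024236 & 156015024234 & 046024123135 & 023025145147 & 047034235125 & 056045134237 & [])))
 (group (45 & []) (025 & []) & group (01 & []) (124 & 125 & []) & []) (
 bound (137013046245 & 136013045245 & 037013146245 & 036013145245 & 014015235236 & 023034147156 & [])))
 [] (
 split 046 (
 split 123 (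
 bound (237123015046 & 235123014046 & 157123023046 & 137123025046 & 135123024046 & 125123034046 & 057046146123 & 056046124123 & 047046156123 & []))
 [] (
 split 124 (
 bound (037046124125 & 036046124157 & 137124046056 & 014046236235 & 015046234237 & 035023124146 & 024046136135 & 057025124134 & []))
 [] (
 bound (014046236235 & 015046234237 & 023046145157 & 024046136135 & 025046134137 & 034046156125 & 035036146147 & []))))
 (group (67 & []) (047 & []) & group (45 & []) (056 & 057 & []) & group (01 & []) (146 & 147 & 156 & 157 & []) & []) (
 bound (014015235236 & [])))))
 (group (35 & 02 & 01 & []) (025 & 123 & 015 & 023 & 125 & []) & group (21 & 24 & 15 & 03 & []) (034 & 035 & 045 & 134 & 135 & 145 & 014 & 024 & 124 & 234 & 235 & 245 & []) & []) (
 bound []))))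
 (group (47 & []) (357 & []) & group (56 & []) (346 & 367 & []) & group (37 & []) (457 & 467 & []) & group (36 & []) (347 & 456 & 567 & []) & group (37 & []) (356 & []) & []) (
 -- From here on every edge meets 012.
 split 034 (
 split 156 (
 split 237 (
 drop (156014034237 & 156015034237 & 156016034237 & 156045034237 & 156046034237 & 156056034237 & 034237125156 & 034237126156 & 034237127156 & 156145034237 & 156146034237 & 034237157156 & 034237167156 & 034237256156 & 034237257156 & []) (
 bound (247034013156 & 234034017156 & 023034147156 & 047034123156 & 037034124156 & 027034134156 & 024034135156 & [])))
 (group (34 & []) (247 & []) & group (45 & 36 & 01 & []) (257 & 267 & []) & []) (
 split 037 (
 drop (156124034037 & 034037127156 & 156145034037 & 156146034037 & 034037157156 & 034037167156 & 156245034037 & 156246034037 & []) (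
 bound (256156013034 & 234034015156 & 126156035034 & 125156036034 & 023034147156 & 047034123156 & 027034134156 & 024034135156 & 014016236235 & 025026136137 & [])))
 (group (34 & []) (047 & []) & group (45 & 36 & 01 & []) (157 & 167 & []) & []) (
 split 023 (
 drop (034023125156 & 034023126156 & 034023127156 & 156145034023 & 156146034023 & 156147034023 & 034023256156 & []) (
 bound (234034015156 & 027034134156 & 024034135156 & 013016246245 & 014045235236 & 025026136137 & 056035123124 & [])))
 (group (34 & []) (024 & []) & group (45 & 36 & 01 & []) (125 & 126 & []) & []) (
 split 035 (
 drop (034035156127 & []) (
 bound (256156013034 & 234034015156 & 027034134156 & 146014035235 & 017035236246 & 025035136147 & 036035145124 & 137016026245 & 046045135123 & [])))
 (group (34 & 46 & 35 & 01 & []) (136 & 046 & 145 & []) & group (56 & []) (036 & 045 & 135 & 146 & []) & []) (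
 bound (256156013034 & 234034015156 & []))))))
 (group (12 & []) (256 & []) & group (67 & []) (157 & 257 & []) & group (57 & []) (167 & 267 & []) & []) (
 split 123 (
 split 056 (
 drop (056034123127 & []) (
 split 135 (
 drop (123135056046 & 123135056047 & 123135056067 & 056135123247 & []) (
 bound (237123014056 & 234123015056 & 147123023056 & 137123024056 & 134123025056 & 124123035056 & 057056146123 & 126123034045 & 135013026246 & 027036135145 & 037034245125 & [])))
 (group (56 & []) (136 & []) & group (12 & []) (235 & 236 & []) & []) (
 bound (247123013056 & 237123014056 & 234123015056 & 147123023056 & 137123024056 & 134123025056 & 124123035056 & 045034123126 & 046034123125 & 067056145123 & 057056146123 & []))))
 (group (67 & []) (057 & []) & group (57 & []) (067 & []) & []) (
 split 045 (
 drop (045034123126 & 045034123127 & []) (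
 split 136 (
 drop (045024123136 & 045025123136 & 045027123136 & 123136046045 & 045245123136 & 045247123136 & []) (
 bound (237123016045 & 236123014045 & 137123026045 & 125123034047 & 035013124246 & [])))
 (group (67 & []) (137 & []) & group (12 & []) (236 & 237 & []) & []) (
 bound (125123034046 & 047045135123 & 013015245246 & 146014023235 & 016017247234 & 025027147134 & 036026124145 & []))))
 (group (56 & []) (046 & []) & group (57 & []) (047 & []) & []) (
 split 035 (
 split 126 (
 drop (035034124126 & 034035125126 & 035034146126 & 035034147126 & 035034246126 & 035034247126 & []) (
 bound (127126036034 & 037034145126 & 136013024245 & 014015235236 & [])))
 (group (67 & []) (127 & []) & []) (
 bound (013035245246 & 146014035235 & 015035234247 & 147017035236 & 036034124125 & 145016023237 & 024025135136 & 026027137134 & [])))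
 (group (56 & []) (036 & []) & group (57 & []) (037 & []) & []) (
 split 014 (
 split 235 (
 bound (147014026235 & 146014023235 & 017014246235 & 016014234235 & 236235015014 & 237235145014 & 136013024245 & []))
 (group (56 & []) (236 & []) & group (57 & []) (237 & []) & []) (
 bound (013015245246 & 016017247234 & 023025145146 & 024026136135 & [])))
 (group (03 & []) (134 & []) & group (12 & []) (024 & 234 & []) & []) (
 bound (013015245246 & 016017237235 & 023025145146 & []))))))
 (group (34 & []) (124 & []) & []) (
 split 135 (
 split 246 (
 bound (247246016135 & 137135025246 & 127246034035 & 026246147135 & 015135237246 & 126135034047 & 017135236246 & 057135234246 & 027246134135 & 024246136135 & 037135146246 & 067246145135 & 125135034046 & 013135245246 & []))
 (group (67 & []) (247 & []) & []) (
 split 046 (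
 drop (046034135125 & 046034135127 & []) (
 bound (237135015046 & 235135014046 & 024046136135 & 137135025046 & 126135034047 & 027046146135 & 026046147135 & 067046134135 & 036013145245 & 017016236234 & [])))
 (group (67 & []) (047 & []) & []) (
 split 026 (
 bound (147135035026 & 145135023026 & 137135045026 & 134135025026 & 024026136135 & 027026146135 & 125135034067 & 036034245127 & 057034234126 & 014015235236 & []))
 (group (67 & []) (027 & []) & []) (
 bound (067034135125 & 024025135136 & 035034146126 & 036034145127 & 137013045245 & 014015235236 & 016017237234 & 056023134147 & [])))))
 (group (12 & []) (235 & []) & group (56 & []) (136 & 236 & []) & group (34 & []) (145 & 146 & 245 & 246 & []) & group (57 & []) (137 & 147 & 237 & 247 & []) & []) (
 bound (034035125126 & 056034134127 & [])))))
 (group (02 & []) (234 & []) & group (47 & []) (037 & 237 & []) & group (36 & []) (046 & 067 & 246 & 267 & []) & group (46 & 01 & []) (136 & 137 & 146 & 147 & 236 & 247 & []) & group (45 & 01 & []) (036 & 056 & 057 & 135 & 156 & 167 & 235 & 256 & 257 & []) & group (46 & 01 & []) (035 & 045 & 047 & 134 & 145 & 157 & 245 & []) & []) (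
 -- The pool consists of the 1 + 3 * 5 = 16 triples that share at least two vertices with 012.
 bound [])))
 (group (03 & []) (123 & []) & group (14 & []) (024 & 234 & []) & group (25 & []) (015 & 045 & 135 & 345 & []) & group (01 & []) (023 & 035 & 124 & 145 & []) & group (02 & []) (013 & 014 & 034 & 125 & 235 & 245 & []) & group (06 & []) (126 & 136 & 146 & 156 & 236 & 246 & 346 & 356 & 456 & []) & group (17 & []) (027 & 037 & 047 & 057 & 237 & 247 & 257 & 267 & 357 & 367 & 457 & 467 & 567 & []) & group (01 & []) (025 & 026 & 036 & 046 & 056 & 127 & 134 & 137 & 147 & 157 & []) & group (27 & []) (017 & 067 & 167 & 256 & 347 & []) & group (02 & []) (016 & []) & [])
 (bound [])

-- A full star on nine vertices has 28 edges, above the bound 26, so counting cannot close the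
-- branches compatible with one; these end in `star 0`, with at most two triples avoiding 0 that are
-- not known to be absent.
certificate₉ : Certificate
certificate₉ =
 split 012 (
 split 345 (
 split 067 (
 drop (345123012067 & 345124012067 & 345125012067 & 345134012067 & 345135012067 & 345138012067 & 345145012067 & 345148012067 & 345158012067 & 345234012067 & 345235012067 & 345238012067 & 345245012067 & 345248012067 & 345258012067 & 012067346345 & 012067347345 & 012067356345 & 012067357345 & 012067367345 & 012067368345 & 012067378345 & 012067456345 & 012067457345 & 012067467345 & 012067468345 & 012067478345 & 012067567345 & 012067568345 & 012067578345 & []) (
 split 126 (
 drop (345034012126 & 345035012126 & 345037012126 & 345038012126 & 345045012126 & 345047012126 & 345048012126 & 345057012126 & 345058012126 & []) (
 bound (016012237345 & 017012236345 & 026012137345 & 027012136345 & 127012036345 & 167012023345 & 267012013345 & 268012014345 & 678067015345 & 168012024345 & 178012025345 & 128012046345 & 278012056345 & 028012146345 & 358345147012 & 078012156345 & 018012246345 & 068012247345 & 348345157012 & [])))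
 (group (67 & []) (127 & []) & group (26 & 17 & []) (167 & 267 & []) & []) (
 split 168 (
 drop (345023012168 & 345024012168 & 345025012168 & 345034012168 & 345035012168 & 345037012168 & 345045012168 & 345047012168 & 345057012168 & 345237012168 & 345247012168 & 345257012168 & []) (
 bound (678067013345 & 268012014345 & 278012015345 & 128012036345 & 178012046345 & 017012236345 & 018012246345 & 078012256345 & 027012136345 & 028012146345 & 026012137345 & 068012147345 & [])))
 (group (12 & []) (268 & []) & group (67 & []) (178 & 278 & []) & []) (
 split 348 (
 drop (012015345348 & 012018348345 & 012025345348 & 012028348345 & 012056345348 & 012057345348 & 012068348345 & 012078348345 & 012128348345 & 012156345348 & 012157345348 & 012256345348 & 012257345348 & 012067678348 & []) (
 bound (458345013012 & 358345014012 & 027012136345 & 026012137345 & 017012236345 & 016012237345 & [])))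
 (group (45 & []) (358 & []) & group (35 & []) (458 & []) & []) (
 split 128 (
 drop (345034012128 & 345035012128 & 345036012128 & 345037012128 & 345045012128 & 345046012128 & 345047012128 & 345056012128 & []) (
 bound (678067013345 & 016012237345 & 018012247345 & 068012257345 & 026012137345 & 028012147345 & 027012136345 & 078012146345 & 017012236345 & [])))
 (group (27 & 16 & []) (678 & []) & []) (
 split 136 (
 drop (345136012027 & 345136012028 & 345136012078 & []) (
 split 147 (
 drop (345147012026 & 345147012068 & []) (
 bound (058023136147 & 025024147136 & 035136147247 & 036136147257 & 016012237345 & 045147136236 & 047147136256 & 017012246345 & 048034136156 & 057037136146 & [])))
 (group (45 & []) (157 & []) & group (27 & 16 & []) (246 & 256 & []) & []) (
 split 247 (
 bound (257247014136 & 017012236345 & 156136023247 & 026012137345 & 025247146136 & 015136237247 & 136013024247 & 136035045247 & []))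
 (group (45 & []) (257 & []) & []) (
 split 137 (
 bound (016012237345 & 017012236345 & 024046136137 & 025047137136 & 045056136137 & 048057137136 & []))
 (group (27 & 16 & []) (236 & []) & []) (
 split 237 (
 bound (048014136237 & 058015136237 & 045046136237 & 024237136156 & []))
 [] (
 split 146 (
 bound (025023136146 & 057024146136 & 058035136146 & []))
 (group (45 & []) (156 & []) & []) (
 star 0)))))))
 (group (12 & []) (236 & []) & group (67 & []) (137 & 237 & []) & group (35 & []) (156 & 157 & 256 & 257 & []) & group (34 & []) (146 & 147 & 246 & 247 & []) & []) (
 star 0)))))))
 (group (78 & []) (068 & []) & group (02 & []) (267 & 268 & []) & group (24 & 15 & 03 & []) (367 & 368 & 467 & 468 & []) & group (68 & 01 & []) (168 & 178 & 278 & 378 & 478 & []) & group (25 & 13 & 04 & []) (078 & 167 & 567 & 568 & 578 & []) & []) (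
 split 016 (
 drop (345234012016 & 345235012016 & 345237012016 & 345238012016 & 345245012016 & 345247012016 & 345248012016 & 345257012016 & 345258012016 & 012016346345 & 012016356345 & 012016456345 & []) (
 split 678 (
 drop (345013016678 & 345014016678 & 345015016678 & 345023016678 & 345024016678 & 345025016678 & 345034016678 & 345035016678 & 345045016678 & 345123016678 & 345124016678 & 345125016678 & 345134016678 & 345135016678 & 345145016678 & 012016678347 & 012016678348 & 012016678357 & 012016678358 & 012016678457 & []) (
 bound (127012036345 & 126012038345 & 128012037345 & 027012136345 & 026012138345 & 028012137345 & 017012236345 & 018012246345 & [])))
 [] (
 split 347 (
 drop (012015345347 & 012017347345 & 012025345347 & 012027347345 & 012056345347 & 012058345347 & 012125345347 & 012127347345 & 012156345347 & 012158345347 & 012256345347 & []) (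
 split 028 (
 drop (345134012028 & 345135012028 & 345136012028 & 345137012028 & 345145012028 & 345146012028 & 345147012028 & 345157012028 & 012028348345 & 012028358345 & []) (
 bound (457345013012 & 357345014012 & 128012036345 & 126012034345 & 026012138345 & 018012236345 & [])))
 (group (01 & []) (128 & []) & group (67 & 25 & 13 & 04 & []) (358 & 458 & []) & []) (
 split 057 (
 drop (345057012126 & 012057345348 & []) (
 bound (457345013012 & 357345014012 & 026012134345 & 018012236345 & 023057145146 & 024057135136 & 246034057157 & 035057147124 & 057036123148 & 045057137138 & [])))
 (group (01 & []) (157 & []) & group (67 & 25 & 13 & 04 & []) (236 & 246 & []) & []) (
 bound (457345013012 & 357345014012 & 012018348345 & 126012034345 & 026012134345 & 023035145146 & 024045135136 & 036037147124 & [])))))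
 (group (78 & []) (348 & []) & group (35 & []) (457 & 458 & []) & group (45 & []) (357 & 358 & []) & []) (
 split 027 (
 drop (345134012027 & 345135012027 & 345136012027 & 345138012027 & 345145012027 & 345146012027 & 345148012027 & 345156012027 & 345158012027 & []) (
 split 137 (
 drop (345137012026 & 345137012028 & []) (
 bound (127012036345 & 126012038345 & 128012034345 & 017012236345 & 018012246345 & 137013024256 & 025023137147 & 056035137124 & 046037137125 & 045047137123 & [])))
 (group (34 & []) (147 & []) & group (67 & 12 & []) (236 & 246 & []) & group (35 & []) (157 & 256 & []) & []) (
 split 126 (
 drop (345034012126 & 345035012126 & 345037012126 & 345038012126 & 345045012126 & 345047012126 & []) (
 bound []))
 (group (67 & 12 & []) (127 & []) & []) (
 split 128 (
 drop (345034012128 & 345035012128 & 345036012128 & 345037012128 & []) (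
 bound []))
 [] (
 split 123 (
 split 124 (
 bound (056035123124 & 057036123124 & 058037123124 & []))
 (group (45 & []) (125 & []) & []) (
 star 0))
 (group (34 & []) (124 & []) & group (35 & []) (125 & []) & []) (
 bound []))))))
 (group (78 & []) (028 & []) & group (01 & []) (127 & 128 & []) & []) (
 split 026 (
 drop (345134012026 & 345135012026 & 345137012026 & 345138012026 & 345145012026 & 345147012026 & 345148012026 & 345157012026 & 345158012026 & []) (
 split 123 (
 bound (126012034345 & 017012236345 & 018012246345 & 047013123256 & 057023123146 & 045024123136 & 056035123124 & 046036123125 & []))
 (group (26 & []) (136 & []) & group (34 & []) (124 & 146 & []) & group (35 & []) (125 & 156 & []) & []) (
 bound (126012034345 & 017012236345 & []))))
 (group (01 & []) (126 & []) & []) (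
 split 236 (
 drop (345236012017 & 345236012018 & []) (
 split 047 (
 bound (256236013047 & 147047035236 & 048047137236 & 057047124236 & 058047134236 & 136236025047 & 125236034047 & 236135045047 & 236123014047 & 138236046047 & 148047056236 & 015047246236 & 157047024236 & []))
 (group (78 & []) (048 & []) & group (01 & []) (147 & 148 & []) & group (45 & []) (057 & 058 & 157 & 158 & []) & []) (
 bound (015013236246 & 145014023236 & 045024236136 & 256025034134 & 035036146124 & []))))
 (group (34 & []) (246 & []) & group (35 & []) (256 & []) & []) (
 split 023 (
 split 147 (
 bound (157147046023 & 156147048023 & 158147024023 & 035023124147 & 036023125147 & 023038148147 & 146147057023 & 145147037023 & 056023123147 & 025023138147 & 058023134147 & 045047137136 & []))
 (group (78 & []) (148 & []) & group (45 & []) (157 & 158 & []) & []) (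
 split 124 (
 bound (035023124146 & 036023124145 & 037023124156 & 057024124136 & 056025124134 & 038034124125 & 058045124123 & 046047137135 & []))
 (group (45 & []) (125 & []) & []) (
 split 146 (
 bound (156146024023 & 023035145146 & 057023123146 & 025023138146 & 058023134146 & 045046136137 & []))
 (group (45 & []) (156 & []) & []) (
 split 134 (
 bound (025024134136 & 056045134123 & 058046134137 & 057047134138 & []))
 (group (45 & []) (135 & []) & []) (
 bound (024046136137 & 045025123138 & []))))))
 (group (26 & []) (036 & []) & group (34 & []) (024 & 046 & []) & group (01 & []) (123 & 124 & 136 & 146 & []) & group (35 & []) (025 & 056 & 125 & 156 & []) & []) (
 bound []))))))))
 (group (67 & []) (017 & []) & group (12 & []) (026 & 027 & []) & group (24 & 15 & 03 & []) (346 & 347 & 356 & 357 & []) & group (68 & 02 & []) (028 & 127 & 128 & 348 & 358 & []) & group (25 & 13 & 04 & []) (018 & 126 & 456 & 457 & 458 & []) & []) (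
 split 678 (
 split 013 (
 drop (678246012013 & 678247012013 & 678248012013 & 678256012013 & 678257012013 & []) (
 bound (014012236678 & 015012237678 & 045012238678 & 034012156678 & 035012146678 & 134012056678 & 234012057678 & 123012058678 & 023012157678 & 024012158678 & 025012136678 & 245012137678 & 235012147678 & 135012046678 & 125012047678 & 124012036678 & 145012037678 & [])))
 (group (10 & 02 & 25 & 14 & 03 & []) (045 & 124 & 135 & 025 & 234 & []) & group (34 & 12 & []) (015 & 024 & 035 & 123 & 134 & 245 & []) & group (35 & 02 & []) (014 & 023 & 034 & 125 & 145 & 235 & []) & []) (
 bound (036037147148 & 038046146157 & 047048138136 & 056057137238 & [])))
 [] (
 split 036 (
 split 147 (
 bound (157147024036 & 236036045147 & 056036123147 & 247147135036 & 238036015147 & 158147234036 & 235036014147 & 125147046036 & 256036047147 & 257147034036 & 245147013036 & 025036138147 & 058036134147 & 248147136036 & 124147057036 & 023036156147 & 145147037036 & 148147237036 & 035036146147 & 038036246147 & 258048036137 & []))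
 (group (12 & 25 & 14 & 03 & []) (157 & 257 & 247 & []) & group (78 & []) (148 & 158 & 248 & 258 & []) & []) (
 split 124 (
 split 137 (
 drop (124137036056 & 124137036058 & 036137124245 & []) (
 bound (145124023036 & 125124034036 & 057036123124 & 035036146124 & 037036156124 & 038036246124 & 137013024256 & 046014137235 & 045015137236 & 025047137136 & [])))
 (group (12 & []) (237 & []) & group (78 & []) (138 & 238 & []) & []) (
 bound (245124013036 & 145124023036 & 125124034036 & 035036146124 & 057036136124 & 058036236124 & 056036123124 & 037036156124 & 038036246124 & [])))
 (group (12 & 25 & 14 & 03 & []) (145 & 125 & 245 & []) & []) (
 split 146 (
 bound (035013146246 & 146014023235 & 146015025237 & 057024146136 & 037034146156 & 238038045146 & 058046146123 & 047048138135 & 056256234134 & []))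
 (group (12 & 25 & 14 & 03 & []) (156 & 256 & 246 & []) & []) (
 bound (014015235236 & 024025135136 & 045047137123 & 046048138237 & 056058238134 & [])))))
 (group (67 & 35 & 34 & 02 & 01 & []) (257 & 146 & 037 & 256 & 147 & []) & group (23 & 15 & 04 & []) (056 & 057 & 136 & 137 & 246 & 247 & []) & group (68 & 35 & []) (038 & 058 & 148 & 157 & 158 & 237 & 238 & 248 & []) & group (68 & 01 & []) (046 & 047 & 048 & 138 & 156 & 236 & 258 & []) & []) (
 bound [])))))
 (group (56 & []) (346 & []) & group (48 & []) (358 & 368 & []) & group (37 & []) (457 & 467 & 578 & 678 & []) & group (57 & 46 & []) (348 & 367 & 378 & 456 & 458 & 567 & []) & group (56 & 48 & 37 & []) (347 & 356 & 357 & 468 & 478 & 568 & []) & []) (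
 split 034 (
 split 156 (
 split 237 (
 drop (156014034237 & 156015034237 & 156016034237 & 156018034237 & 156045034237 & 156046034237 & 156056034237 & 156058034237 & 156068034237 & 034237125156 & 034237126156 & 034237127156 & 034237128156 & 156145034237 & 156146034237 & 156148034237 & 034237157156 & 034237167156 & 034237178156 & 034237256156 & 034237257156 & 034237258156 & []) (
 bound (023034147156 & 168156025034 & 158156026034 & 247034013156 & 278237035156 & 248034036156 & 234034017156 & 238034057156 & 037034124156 & 038034245156 & 078034246156 & 047034123156 & 048034235156 & 027034134156 & 024034138156 & 028034135156 & [])))
 (group (43 & 45 & 36 & 01 & []) (257 & 247 & 267 & []) & group (78 & []) (238 & 248 & 258 & 268 & []) & []) (
 split 234 (
 drop (156015034234 & 156016034234 & 156017034234 & 156018034234 & 156056034234 & 156057034234 & 156058034234 & 156067034234 & 156068034234 & 034234125156 & 034234126156 & 034234127156 & 034234128156 & 034234256156 & []) (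
 split 037 (
 drop (156124034037 & 156145034037 & 156146034037 & 156148034037 & 034037157156 & 034037167156 & []) (
 bound (278234013156 & 023034147156 & 168156025034 & 158156026034 & 047034123156 & 024034138156 & 028034137156 & 027034134156 & 048034135156 & 078034136156 & [])))
 (group (78 & []) (038 & []) & group (34 & []) (047 & 048 & []) & []) (
 bound (278234013156 & 078034123156 & 027034134156 & 024034138156 & 028034135156 & 023034145156 & 167156025034 & 168156035034 & 178156045034 & 157156026034 & 158156036034 & 014046236235 & []))))
 (group (43 & 45 & 36 & 01 & []) (256 & []) & []) (
 split 078 (
 drop (156123034078 & 156124034078 & 034078127156 & 034078128156 & 156134034078 & 156135034078 & 156136034078 & 156145034078 & 156146034078 & 034078157156 & 034078158156 & 034078167156 & 034078168156 & 034078178156 & 156235034078 & 156236034078 & 156245034078 & 156246034078 & []) (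
 split 125 (
 drop (034023125156 & 034024125156 & 034027125156 & 034028125156 & 034036156125 & []) (
 bound (126156035034 & 037034148156 & 038034147156 & 047034138156 & 048034137156 & [])))
 (group (56 & []) (126 & []) & []) (
 split 278 (
 drop (156013078278 & 156014078278 & 156015078278 & 156016078278 & 156035078278 & 156036078278 & 156045078278 & 156046078278 & []) (
 bound []))
 [] (
 split 137 (
 drop (156137034024 & 156137034028 & 156137034048 & []) (
 split 138 (
 bound (037034148156 & 023034147156 & 025057137138 & 026058138137 & []))
 (group (48 & 37 & []) (147 & []) & []) (
 split 148 (
 drop (156148034023 & 156148034027 & []) (
 bound []))
 [] (
 star 0))))
 (group (78 & []) (138 & []) & group (34 & []) (147 & 148 & []) & []) (
 star 0)))))
 (group (43 & 45 & 36 & 01 & []) (178 & []) & []) (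
 split 027 (
 drop (034027125156 & 034027126156 & 034027127156 & 034027128156 & 156134034027 & 156135034027 & 156136034027 & 156138034027 & 156145034027 & 156146034027 & 156148034027 & 034027157156 & 034027167156 & []) (
 split 158 (
 drop (034026156158 & 034028158156 & 034036156158 & 034038158156 & 034046156158 & 034048158156 & 034067156158 & 034236156158 & []) (
 bound (023034147156 & 024034137156 & 168156025034 & 047034123156 & 037034124156 & [])))
 (group (56 & []) (168 & []) & []) (
 split 278 (
 drop (156013027278 & 156014027278 & 156015027278 & 156016027278 & 156035027278 & []) (
 bound (023034147156 & 024034137156 & 047034123156 & 048034235156 & 037034124156 & 038034245156 & [])))
 [] (
 split 137 (
 drop (156137034024 & 156137034028 & 156137034048 & []) (
 bound (023034147156 & 047034123156 & 037034124156 & 038034245156 & 137013025246 & 046014137235 & 045015137236 & [])))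
 (group (34 & []) (147 & []) & []) (
 split 235 (
 drop (156235034047 & 156235034048 & []) (
 split 124 (
 drop (156124034037 & 156124034038 & []) (
 bound (067014124235 & 068016124235 & 036013124245 & 057015124236 & [])))
 [] (
 split 245 (
 drop (156245034037 & []) (
 bound (016013235245 & 017014245235 & 018036235245 & 067046245235 & [])))
 [] (
 split 246 (
 drop (156246034037 & 156246034038 & []) (
 bound (017013235246 & 018014246235 & [])))
 [] (
 split 123 (
 bound (046014123235 & 067016123235 & 068017123235 & []))
 [] (
 split 236 (
 bound (014015235236 & 017016236235 & []))
 [] (
 star 0)))))))
 (group (34 & []) (245 & []) & group (56 & []) (236 & 246 & []) & []) (
 split 037 (
 drop (156124034037 & []) (
 star 0))
 (group (34 & []) (047 & []) & []) (
 bound (038034124156 & 048034123156 & []))))))))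
 (group (78 & []) (028 & []) & group (43 & 45 & 36 & 01 & []) (127 & 128 & []) & []) (
 split 278 (
 split 037 (
 drop (156013037278 & 156014037278 & 156015037278 & 156016037278 & 156035037278 & 156036037278 & 156045037278 & 156046037278 & 156056037278 & 156124034037 & 034037278125 & 034037278126 & 156134037278 & 156135037278 & 156136037278 & 156145034037 & 156146034037 & 156148034037 & 034037157156 & 034037278158 & 034037167156 & 034037278168 & []) (
 bound []))
 (group (43 & 45 & 36 & 01 & []) (157 & 047 & 167 & []) & group (78 & []) (038 & 048 & 158 & 168 & []) & []) (
 bound (136034025278 & 135034026278 & 146034057278 & 134034058278 & 145034067278 & 125156068034 & 045034123278 & 014034236278 & 016034235278 & 013034245278 & 015034246278 & 035034124278 & 046034137278 & 024034138156 & [])))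
 [] (
 split 235 (
 drop (156235034047 & 156235034048 & 034235156167 & 034235156168 & []) (
 split 067 (
 drop (034067156125 & []) (
 bound (245235013067 & 024034136156 & 068067137235 & 023034148156 & 126156045034 & 146067035235 & 138235025067 & 123235057067 & 134235056067 & 147067058235 & 235135016067 & 157156026034 & 124235036067 & 235145046067 & 014067236235 & 017067246235 & [])))
 (group (78 & []) (068 & []) & group (46 & 35 & 01 & []) (147 & 148 & []) & []) (
 bound (126156035034 & 024034135156 & 157156026034 & 158156236034 & 125156036034 & 023034145156 & 037034124156 & 038034146156 & 016013235245 & 046014123235 & 017015235246 & 025045134136 & 056057137138 & []))))
 (group (43 & 45 & 36 & 01 & []) (245 & 246 & 236 & []) & []) (
 split 037 (
 drop (156124034037 & 156145034037 & 156146034037 & 156148034037 & 034037157156 & 034037167156 & []) (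
 split 135 (
 drop (156135034024 & 156135034047 & 156135034048 & []) (
 bound (168156025034 & 158156026034 & 126156035034 & 125156036034 & 023034147156 & 046045135123 & 067056135134 & 068058135137 & [])))
 (group (56 & []) (136 & []) & []) (
 split 125 (
 drop (034023125156 & 034024125156 & 034036156125 & []) (
 bound (168156025034 & 158156026034 & 126156035034 & 038034147156 & 048034137156 & 047034123156 & [])))
 (group (56 & []) (126 & []) & []) (
 split 158 (
 drop (034026156158 & 034036156158 & 034038158156 & []) (
 bound (023034147156 & 168156025034 & 047034123156 & 024034137156 & [])))
 (group (56 & []) (168 & []) & []) (
 split 123 (
 drop (156123034047 & 156123034048 & []) (
 bound (023034147156 & 024034137156 & 056025123134 & [])))
 [] (
 split 137 (
 drop (156137034024 & 156137034048 & []) (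
 bound (023034147156 & 047034138156 & [])))
 [] (
 split 138 (
 drop (156138034024 & 156138034047 & []) (
 bound (023034147156 & [])))
 [] (
 split 147 (
 drop (156147034023 & 156147034038 & []) (
 bound []))
 [] (
 star 0)))))))))
 (group (43 & 45 & 36 & 01 & []) (157 & 047 & 167 & []) & group (78 & []) (038 & 048 & 158 & 168 & []) & []) (
 split 023 (
 drop (034023125156 & 034023126156 & 156145034023 & 156146034023 & 156147034023 & 156148034023 & []) (
 bound (024034135156 & 025026136134 & 056035123124 & [])))
 (group (43 & 45 & 36 & 01 & []) (125 & 024 & 126 & []) & []) (
 bound (025026136134 & 035036146124 & 045057137123 & 046056135138 & 068058145147 & []))))))))))
 (group (57 & []) (167 & []) & group (12 & []) (256 & 267 & []) & group (68 & []) (158 & 178 & 258 & 278 & []) & group (58 & []) (157 & 168 & 257 & 268 & []) & []) (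
 split 125 (
 split 067 (
 drop (125123034067 & 125124034067 & 034067126125 & 034067127125 & 125134034067 & 125135034067 & 125138034067 & 125145034067 & 125148034067 & 125234034067 & 125235034067 & 125238034067 & 125245034067 & 125248034067 & []) (
 split 128 (
 drop (034035125128 & 034038128125 & 034045125128 & 034048128125 & 034056125128 & 034057125128 & 034068128125 & 034078128125 & []) (
 bound (047034136125 & 046034137125 & 037034146125 & 036034147125 & [])))
 [] (
 split 136 (
 drop (125136034047 & 125136034048 & 125136034078 & []) (
 split 137 (
 bound (036034147125 & 037034146125 & 038034246125 & 058026136137 & 024027137136 & 025057137136 & 028056136137 & 045247137136 & []))
 (group (47 & 36 & []) (146 & []) & []) (
 split 237 (
 drop (125237034046 & []) (
 bound (037034246125 & 058014136237 & 045024237136 & 015136237247 & 036034147125 & [])))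
 (group (47 & 36 & []) (246 & []) & []) (
 split 147 (
 bound (058023136147 & 025024147136 & 028026136147 & 035136147247 & []))
 [] (
 split 247 (
 drop (125247034036 & 125247034038 & 125247034068 & []) (
 bound []))
 [] (
 split 236 (
 bound (045014136236 & 057015136236 & []))
 [] (
 star 0)))))))
 (group (43 & 46 & 37 & []) (146 & 147 & 137 & []) & group (12 & []) (236 & 237 & 246 & 247 & []) & []) (
 star 0))))
 (group (78 & []) (068 & []) & group (68 & []) (078 & []) & []) (
 split 036 (
 drop (125124034036 & 034036126125 & 125145034036 & 125147034036 & 125148034036 & 125245034036 & 125247034036 & 125248034036 & []) (
 split 127 (
 drop (034035125127 & 034037127125 & 034045125127 & 034047127125 & 034056125127 & 034058125127 & []) (
 split 135 (
 drop (125135034046 & 125135034048 & []) (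
 bound (128125057034 & 038034146125 & 135013024246 & 026025135134 & 027028138135 & 014015235236 & 016017237234 & [])))
 (group (12 & []) (235 & []) & group (57 & []) (137 & 237 & []) & []) (
 bound (128125057034 & 048034136125 & 046034123125 & 038034146125 & 138013024246 & []))))
 (group (78 & []) (128 & []) & []) (
 split 146 (
 drop (125146034037 & 125146034038 & []) (
 bound (047034136125 & 046034138125 & 048034123125 & 035013146246 & 146014023235 & 146015025237 & 146016027238 & 057017146234 & 058018146236 & 028024146135 & 026045134137 & [])))
 (group (12 & []) (246 & []) & []) (
 split 137 (
 drop (125137034046 & 125137034048 & []) (
 split 047 (
 drop (125123034047 & 125135034047 & 125136034047 & 125138034047 & 125235034047 & 125236034047 & 125238034047 & []) (
 bound (045014137237 & 056015137234 & [])))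
 [] (
 split 024 (
 bound (025024134137 & 137136026024 & 137138028024 & 135137027024 & 056024234137 & 045024238137 & 058024123137 & 014015235236 & []))
 (group (46 & []) (026 & []) & []) (
 bound (045014137236 & 056015137234 & 058016137237 & 025027137134 & 028057137136 & 017018238235 & [])))))
 (group (12 & []) (237 & []) & group (78 & []) (138 & 238 & []) & []) (
 split 135 (
 drop (125135034046 & 125135034047 & 125135034048 & []) (
 bound (024025135136 & 026056135134 & 014015235236 & 057016123234 & [])))
 (group (12 & []) (235 & []) & []) (
 split 136 (
 drop (125136034047 & 125136034048 & []) (
 bound (046034123125 & 045014136236 & 057015136234 & [])))
 (group (12 & []) (236 & []) & []) (
 split 123 (
 drop (125123034046 & 125123034047 & 125123034048 & []) (
 bound []))
 [] (
 -- At most 28 triples are left in the pool. In each alternative of the chain of splits below, the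
 -- triples newly declared absent and at most one path bring the count down to 26; if the whole
 -- chain is present, the family is recognised as starlike.
 split 013 (
 split 014 (
 split 015 (
 split 016 (
 split 017 (
 split 018 (
 split 023 (
 split 024 (
 split 025 (
 split 026 (
 split 027 (
 split 028 (
 split 035 (
 split 037 (
 split 038 (
 split 045 (
 split 046 (
 split 047 (
 split 048 (
 split 056 (
 split 134 (
 drop (056015134234 & []) (
 star 0))
 [] (
 star 0))
 [] (
 bound (057015134234 & [])))
 [] (
 bound (056015134234 & [])))
 [] (
 bound (056015134234 & [])))
 [] (
 bound (056015134234 & [])))
 [] (
 bound (056015134234 & [])))
 [] (
 bound (056015134234 & [])))
 [] (
 bound (056015134234 & [])))
 [] (
 bound (056015134234 & [])))
 [] (
 bound (056015134234 & [])))
 [] (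
 bound (056015134234 & [])))
 [] (
 bound (056015134234 & [])))
 [] (
 bound (056015134234 & [])))
 [] (
 bound (056015134234 & [])))
 [] (
 bound (056015134234 & [])))
 [] (
 bound (056015134234 & [])))
 [] (
 bound (056015134234 & [])))
 [] (
 bound (056015134234 & [])))
 [] (
 bound (056016134234 & [])))
 [] (
 bound (056015134234 & [])))
 (group (12 & []) (023 & []) & []) (
 bound [])))))))))
 (group (67 & []) (037 & []) & group (34 & []) (046 & 047 & []) & group (68 & []) (038 & 048 & []) & []) (
 split 056 (
 drop (034056125127 & 034056125128 & []) (
 split 137 (
 bound (237137014056 & 147137023056 & 148137235056 & 138137027056 & 058056236137 & 245056013137 & 234137016056 & 238137017056 & 246056015137 & 247137018056 & 126125035034 & 026056145137 & 024056135137 & 056045134137 & 123137057056 & []))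
 (group (12 & []) (237 & []) & group (78 & []) (138 & 238 & []) & group (34 & []) (147 & 148 & 247 & 248 & []) & []) (
 bound (126125035034 & 015056236234 & 025056136134 & 056045124123 & 013016246245 & 146014023235 & 026024145135 & []))))
 (group (67 & []) (057 & []) & group (68 & []) (058 & []) & []) (
 split 035 (
 drop (034035125126 & 034035125127 & 034035125128 & []) (
 split 146 (
 bound (147146026035 & 148146236035 & 237035045146 & 235035014146 & 246146018035 & 247146013035 & 238035015146 & 248146016035 & 023035145146 & 027035135146 & 025035138146 & []))
 (group (12 & []) (246 & []) & group (67 & []) (147 & 247 & []) & group (68 & []) (148 & 248 & []) & []) (
 bound (136013024245 & 014015235236 & 016017237234 & 238023045145 & 025027137134 & []))))
 (group (34 & []) (045 & []) & []) (
 split 016 (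
 split 237 (
 bound (146016025237 & 145016028237 & 148016023237 & 247237135016 & 245237138016 & 248237013016 & 016014234237 & 235237017016 & 238237147016 & 015016236237 & 018016246237 & 024026136137 & []))
 (group (78 & []) (238 & []) & group (34 & []) (247 & 248 & []) & []) (
 split 235 (
 bound (245235013016 & 234235015016 & 014016236235 & 017016246235 & 147016026235 & 146016028235 & 148016023235 & 024025135136 & []))
 (group (34 & []) (245 & []) & []) (
 split 023 (
 bound (145014023236 & 015016246234 & 025023134146 & 026023135147 & 027023136148 & 024028138137 & []))
 (group (34 & []) (024 & []) & []) (
 split 025 (
 bound (137013025246 & 147014025236 & 026025135134 & 027025145136 & []))
 [] (
 bound (015016236234 & 135013026246 & 027028138134 & []))))))
 (group (12 & []) (026 & []) & group (67 & []) (017 & 027 & []) & group (68 & []) (018 & 028 & []) & []) (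
 split 015 (
 bound (013015245246 & 014015235236 & 237023015145 & 247024015135 & 248025015136 & 015146234238 & []))
 (group (12 & []) (025 & []) & []) (
 bound (136013024245 & 146014023235 & 135137247246 & 145147237236 & []))))))))
 (group (57 & []) (127 & []) & group (56 & []) (126 & []) & group (58 & []) (128 & []) & []) (
 split 135 (
 split 246 (
 split 017 (
 drop (135017024246 & 135017026246 & 135017027246 & 135017028246 & 135017046246 & 135017047246 & 135017048246 & 135017067246 & 135017068246 & 246234135017 & 246235135017 & 246236135017 & []) (
 bound (015135237246 & 248246016135 & 137135025246 & 138135045246 & 057135123246 & 058135134246 & 078017136246 & 037135145246 & 035135148246 & 038135124246 & [])))
 (group (78 & []) (018 & []) & group (24 & 13 & []) (037 & 038 & []) & group (56 & 23 & 14 & []) (027 & 028 & 047 & 048 & []) & []) (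
 bound (247246016135 & 248246036135 & 137135025246 & 138135045246 & 024246136135 & 026246145135 & 035135146246 & 058135147246 & 057135148246 & 015135236246 & 067246124135 & 068246134135 & 046246123135 & 013135245246 & [])))
 (group (67 & []) (247 & []) & group (68 & []) (248 & []) & []) (
 split 067 (
 split 148 (
 drop (067023135148 & 135148024067 & 067025135148 & 135148028067 & 067035135148 & 067036135148 & 067037135148 & 135148046067 & 135148047067 & 135148048067 & []) (
 bound (245135013067 & 134135058067 & 027067136135 & 026067137135 & 123135045067 & 124135038067 & 235135014067 & 234135018067 & 238135015067 & [])))
 (group (24 & 13 & []) (238 & []) & []) (
 split 124 (
 drop (135124024067 & 135124026067 & 135124027067 & 135124028067 & 067035135124 & 067036135124 & 067037135124 & 067038135124 & 135124046067 & []) (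
 bound (245135013067 & 235135014067 & 234135015067 & 145135023067 & 123135045067 & 134135025067 & 078067136135 & 068067137135 & [])))
 (group (24 & 13 & []) (234 & []) & []) (
 split 145 (
 drop (067023135145 & 135145024067 & 067036135145 & 067037135145 & 067038135145 & 135145046067 & []) (
 bound (245135013067 & 235135014067 & 134135025067 & 123135058067 & 138135045067 & 026067137135 & 068067147135 & 027067136135 & 028067146135 & [])))
 (group (24 & 13 & []) (235 & []) & []) (
 split 123 (
 drop (135123024067 & 135123026067 & 135123027067 & 135123028067 & 067045135123 & 067056135123 & []) (
 bound (245135013067 & 078067146135 & 068067147135 & 138135025067 & 047067136135 & 048067236135 & 135134046067 & [])))
 (group (24 & 13 & []) (134 & []) & []) (
 split 245 (
 drop (067013135245 & 067016135245 & 067017135245 & 067018135245 & 135245024067 & 135245026067 & 135245027067 & 135245028067 & 067036135245 & 067037135245 & 067038135245 & []) (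
 bound []))
 [] (
 split 136 (
 drop (135136067024 & 135136067027 & 135136067028 & 135136067047 & 135136067048 & 135136067078 & []) (
 bound (138135025067 & 026067147135 & 046067137135 & 068067237135 & [])))
 (group (67 & []) (137 & []) & []) (
 split 138 (
 drop (067025135138 & 135138028067 & 067045135138 & 135138048067 & 067056135138 & 067057135138 & 135138068067 & 135138078067 & []) (
 bound []))
 [] (
 split 146 (
 drop (135146067027 & 135146067028 & 135146067078 & []) (
 split 237 (
 bound (026067147135 & 047067236135 & 146014023237 & 146015025237 & 146016035237 & 146018037237 & 146045038237 & []))
 [] (
 split 147 (
 drop (135147067026 & []) (
 bound (047067236135 & 023036146147 & 025037147146 & 035056146147 & 038057147146 & [])))
 [] (
 split 236 (
 drop (135236067047 & 135236067048 & []) (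
 bound []))
 [] (
 star 0)))))
 (group (67 & []) (147 & []) & group (24 & 13 & []) (236 & 237 & []) & []) (
 star 0)))))))))
 (group (78 & []) (068 & []) & group (68 & []) (078 & []) & []) (
 split 026 (
 split 237 (
 drop (135237026046 & 135237026048 & 026237135145 & 026237135148 & []) (
 bound (147135023026 & 047026123135 & 024026136135 & 027026146135 & 135138028026 & 137135045026 & 134135025026 & 016013237245 & 014015235237 & 018017237234 & 056035237124 & 058057237236 & [])))
 (group (78 & []) (238 & []) & []) (
 split 147 (
 drop (026023135147 & 135147024026 & 026025135147 & 135147027026 & 026035135147 & 026036135147 & 026038135147 & 135147046026 & 135147047026 & 135147048026 & 026056135147 & 026058135147 & 026235135147 & 026236135147 & []) (
 bound []))
 (group (78 & []) (148 & []) & []) (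
 split 137 (
 drop (026025135137 & 135137027026 & 026045135137 & 135137047026 & 026056135137 & 026058135137 & []) (
 bound (145135023026 & 028026146135 & 048026236135 & 046026123135 & 024026136135 & 134135057026 & [])))
 (group (78 & []) (138 & []) & []) (
 split 145 (
 drop (026023135145 & 135145024026 & 026036135145 & 026037135145 & 026038135145 & 135145046026 & 135145047026 & []) (
 bound (134135025026 & 027026136135 & 028026146135 & [])))
 [] (
 split 134 (
 drop (135134024026 & 026025135134 & 135134046026 & 135134047026 & 135134048026 & 026056135134 & 026057135134 & []) (
 bound (027026136135 & 028026146135 & [])))
 [] (
 split 136 (
 drop (135136026024 & 135136026027 & 135136026028 & 135136026047 & 135136026048 & []) (
 bound (046026123135 & 136013025245 & 045014136236 & [])))
 [] (
 split 123 (
 drop (135123026046 & 135123026047 & 135123026048 & []) (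
 bound (027026146135 & 045014123236 & 056015123234 & 057035123124 & [])))
 [] (
 split 235 (
 drop (135235026046 & 135235026047 & 135235026048 & []) (
 bound (027026146135 & 016013235245 & 014015235236 & [])))
 [] (
 split 146 (
 drop (135146026027 & 135146026028 & []) (
 bound (047026236135 & 037013146245 & 057015146234 & [])))
 [] (
 split 236 (
 drop (135236026047 & 135236026048 & []) (
 bound (017013236245 & 057014124236 & [])))
 [] (
 split 124 (
 split 234 (
 bound (056015124234 & 057016124234 & 058017124234 & []))
 [] (
 split 245 (
 bound (036013124245 & 037016124245 & []))
 [] (
 star 0)))
 [] (
 split 013 (
 split 014 (
 split 015 (
 split 016 (
 split 234 (
 drop (016013234245 & []) (
 star 0))
 [] (
 star 0))
 [] (
 bound (017013234245 & [])))
 [] (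
 bound (016013234245 & [])))
 [] (
 bound (016013234245 & [])))
 [] (
 bound (016015245234 & []))))))))))))))
 (group (67 & []) (027 & []) & group (24 & 13 & []) (046 & 047 & []) & group (68 & []) (028 & 048 & []) & []) (
 split 245 (
 bound (136135245024 & 137013025245 & 016014245235 & 017015245234 & 018036236245 & 037023245145 & 038035245124 & 045245123138 & 056057147134 & 146148238237 & []))
 [] (
 split 014 (
 split 236 (
 bound (015014234236 & 014017237236 & 014018238236 & 235236016014 & 147014025236 & 148014035236 & 145014023236 & 057014124236 & 058014134236 & []))
 (group (67 & []) (237 & []) & group (68 & []) (238 & []) & []) (
 bound (016014234235 & 024025135136 & 023035145146 & 036037147124 & 045057137123 & 056058138134 & [])))
 (group (24 & 13 & []) (023 & []) & []) (
 bound (024025135136 & 015016236234 & 017018238235 & 035036146124 & 037038148145 & 045057137123 & 056058138134 & [])))))))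
 (group (57 & []) (137 & []) & group (12 & []) (235 & 237 & []) & group (34 & []) (145 & 147 & 245 & 247 & []) & group (58 & []) (138 & 148 & 238 & 248 & []) & group (56 & []) (136 & 146 & 236 & 246 & []) & []) (
 split 123 (
 split 134 (
 bound (056025123134 & 057026123134 & 058027123134 & 067028123134 & 068045134123 & 078046134123 & []))
 (group (12 & []) (234 & []) & []) (
 star 0))
 (group (34 & []) (124 & []) & group (23 & 14 & []) (134 & 234 & []) & []) (
 star 0)))))
 (group (36 & []) (046 & []) & group (48 & []) (038 & 068 & []) & group (02 & []) (234 & 238 & 246 & 268 & []) & group (47 & 01 & []) (137 & 138 & 167 & 168 & 237 & 267 & []) & group (46 & 01 & []) (037 & 047 & 048 & 136 & 146 & 148 & 236 & 247 & 248 & []) & group (45 & 37 & []) (035 & 056 & 057 & 058 & 078 & 156 & 158 & 178 & 235 & 256 & 257 & 258 & 278 & []) & group (48 & 01 & []) (036 & 045 & 067 & 134 & 135 & 145 & 147 & 157 & 245 & []) & []) (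
 -- The remaining triples share at least two vertices with 012: 1 + 3 * 6 = 19 in all.
 bound [])))
 (group (03 & []) (123 & []) & group (14 & []) (024 & 234 & []) & group (25 & []) (015 & 045 & 135 & 345 & []) & group (01 & []) (023 & 035 & 124 & 145 & []) & group (02 & []) (013 & 014 & 034 & 125 & 235 & 245 & []) & group (06 & []) (126 & 136 & 146 & 156 & 236 & 246 & 346 & 356 & 456 & []) & group (17 & []) (027 & 037 & 047 & 057 & 237 & 247 & 257 & 267 & 357 & 367 & 457 & 467 & 567 & []) & group (28 & []) (018 & 038 & 048 & 078 & 138 & 148 & 158 & 168 & 348 & 358 & 368 & 378 & 458 & 468 & 478 & 578 & 678 & []) & group (01 & []) (025 & 026 & 036 & 046 & 056 & 058 & 068 & 127 & 134 & 137 & 147 & 157 & 178 & []) & group (27 & []) (017 & 028 & 067 & 128 & 167 & 238 & 248 & 256 & 258 & 268 & 347 & []) & group (08 & []) (016 & 278 & 568 & []) & [])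
 (bound [])

-- A full star on ten vertices has 36 edges, above the bound 29. Once 012 and 034 are edges, the
-- centre of a starlike family may be 0, or it may be 1 with 034 as one of at most five triples that
-- avoid it; hence both kinds of `star` leaves.
certificate₁₀ : Certificate
certificate₁₀ =
 split 012 (
 split 345 (
 split 067 (
 drop (345123012067 & 345124012067 & 345125012067 & 345134012067 & 345135012067 & 345138012067 & 345139012067 & 345145012067 & 345148012067 & 345149012067 & 345158012067 & 345159012067 & 345234012067 & 345235012067 & 345238012067 & 345239012067 & 345245012067 & 345248012067 & 345249012067 & 345258012067 & 345259012067 & 012067346345 & 012067347345 & 012067356345 & 012067357345 & 012067367345 & 012067368345 & 012067369345 & 012067378345 & 012067379345 & 012067456345 & 012067457345 & 012067467345 & 012067468345 & 012067469345 & 012067478345 & 012067479345 & 012067567345 & 012067568345 & 012067569345 & 012067578345 & 012067579345 & []) (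
 split 348 (
 drop (012015345348 & 012018348345 & 012025345348 & 012028348345 & 012056345348 & 012057345348 & 012059345348 & 012068348345 & 012078348345 & 012089348345 & 012128348345 & 012156345348 & 012157345348 & 012168348345 & 012178348345 & 012189348345 & 012256345348 & 012257345348 & 012268348345 & 012278348345 & 012289348345 & 012067678348 & 012067689348 & 012067789348 & []) (
 bound (016012237345 & 017012236345 & 026012137345 & 027012136345 & 458345039012 & 126012049345 & 459345037012 & 267012013345 & 167012023345 & 127012036345 & 129012038345 & 679067034345 & 489345035012 & 169012045345 & 179012048345 & 349345058012 & 358345024012 & 279012046345 & 269012014345 & 359345047012 & 019012246345 & 079012146345 & 029012147345 & 012069389345 & 589345247012 & [])))
 (group (35 & []) (458 & []) & group (89 & []) (349 & 459 & []) & group (45 & []) (358 & 359 & []) & []) (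
 split 389 (
 drop (012014345389 & 012015345389 & 012018389345 & 012019389345 & 012024345389 & 012025345389 & 012028389345 & 012029389345 & 012045345389 & 012046345389 & 012047345389 & 012056345389 & 012057345389 & 012068389345 & 012069389345 & 012078389345 & 012079389345 & 012089389345 & 012128389345 & 012129389345 & 012146345389 & 012147345389 & 012156345389 & 012157345389 & 012168389345 & 012169389345 & 012178389345 & 012179389345 & 012189389345 & 012246345389 & 012247345389 & 012256345389 & 012257345389 & []) (
 bound (016012237345 & 017012236345 & 026012137345 & 027012136345 & 489345013012 & 589345023012 & 127012036345 & 126012037345 & 167012034345 & 267012035345 & [])))
 (group (35 & []) (589 & []) & group (34 & []) (489 & []) & []) (
 split 189 (
 drop (345023012189 & 345024012189 & 345025012189 & 345034012189 & 345035012189 & 345036012189 & 345037012189 & 345045012189 & 345046012189 & 345047012189 & 345056012189 & 345057012189 & 345236012189 & 345237012189 & 345246012189 & 345247012189 & 345256012189 & 345257012189 & []) (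
 bound (289189016067 & 267067018189 & 129189068067 & 078012136345 & 128189079067 & 069012137345 & 028012146345 & 029012147345 & 089012156345 & 027067168189 & 169012038345 & 026067179189 & 689067157345 & 178012039345 & 789067013345 & 126012048345 & 127012049345 & 167012058345 & 269012014345 & 279012015345 & 268012059345 & 019012278678 & [])))
 (group (12 & 27 & 16 & []) (789 & 289 & 689 & []) & []) (
 split 168 (
 drop (345023012168 & 345024012168 & 345025012168 & 345034012168 & 345035012168 & 345037012168 & 345039012168 & 345045012168 & 345047012168 & 345049012168 & 345057012168 & 345059012168 & 345237012168 & 345247012168 & 345257012168 & []) (
 bound (017012236345 & 018012246345 & 019012256345 & 026012137345 & 068012147345 & 069012157345 & 027012136345 & 028012146345 & 078012156345 & 029012168678 & 079067168128 & 126012038345 & 167012048345 & 169012058345 & 127012036345 & 129012046345 & 178012056345 & 267012013345 & 268012014345 & 269012015345 & 016168278279 & [])))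
 (group (21 & 26 & 17 & []) (268 & 278 & 178 & []) & group (89 & []) (169 & 179 & 269 & 279 & []) & []) (
 split 128 (
 drop (345034012128 & 345035012128 & 345036012128 & 345037012128 & 345039012128 & 345045012128 & 345046012128 & 345047012128 & 345049012128 & 345056012128 & []) (
 bound (267012013345 & 678067014345 & 167012023345 & 016012237345 & 017012236345 & 026012137345 & 027012136345 & 126012038345 & 127012048345 & 129012058345 & 018012246345 & 019012247345 & 068012257345 & 069012147345 & 028012157345 & 029012146345 & 078012156345 & 079012256345 & [])))
 (group (89 & []) (129 & []) & group (21 & 26 & 17 & []) (678 & 679 & []) & []) (
 split 089 (
 drop (345136012089 & 345137012089 & 345146012089 & 345147012089 & 345156012089 & 345157012089 & 345236012089 & 345237012089 & 345246012089 & 345247012089 & 345256012089 & 345257012089 & []) (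
 star 0))
 [] (
 split 126 (
 drop (345034012126 & 345035012126 & 345037012126 & 345038012126 & 345039012126 & 345045012126 & 345047012126 & 345048012126 & []) (
 bound (267012013345 & 167012023345 & 127012036345 & 016012237345 & 017012236345 & 026012137345 & 027012136345 & 018012246345 & 019012247345 & 078012256345 & 079012146345 & 028012156345 & 029012147345 & 068012157345 & 069012257345 & [])))
 (group (12 & 27 & 16 & []) (167 & 127 & 267 & []) & []) (
 split 136 (
 drop (345136012027 & 345136012028 & 345136012029 & 345136012078 & 345136012079 & []) (
 split 147 (
 drop (345147012026 & 345147012068 & 345147012069 & []) (
 bound (016012237345 & 017012246345 & 058023136147 & 059024147136 & 035136147247 & 025056136147 & 036136147257 & 045147136236 & 018012256345 & 047034136156 & 057037136146 & [])))
 (group (45 & []) (157 & []) & group (27 & 16 & []) (246 & 256 & []) & []) (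
 split 018 (
 drop (345236012018 & 345237012018 & 345247012018 & 345257012018 & []) (
 star 0))
 (group (89 & []) (019 & []) & group (27 & 16 & []) (068 & 069 & []) & []) (
 bound (017012236345 & 026012137345 & 016012237345 & 136013024247 & 136014025257 & 057023136146 & [])))))
 (group (21 & 26 & 17 & []) (236 & 237 & 137 & []) & group (35 & []) (156 & 157 & 256 & 257 & []) & group (34 & []) (146 & 147 & 246 & 247 & []) & []) (
 star 0))))))))))
 (group (02 & []) (267 & []) & group (69 & []) (079 & 279 & []) & group (78 & []) (068 & 089 & 268 & 289 & []) & group (25 & 14 & 03 & []) (367 & 368 & 379 & 389 & 567 & 568 & 579 & 589 & []) & group (79 & 01 & []) (168 & 169 & 178 & 179 & 269 & 278 & 369 & 378 & 569 & 578 & []) & group (24 & 13 & 05 & []) (069 & 078 & 167 & 189 & 467 & 468 & 469 & 478 & 479 & 489 & []) & []) (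
 split 016 (
 drop (345234012016 & 345235012016 & 345237012016 & 345238012016 & 345239012016 & 345245012016 & 345247012016 & 345248012016 & 345249012016 & 345257012016 & 345258012016 & 345259012016 & 012016346345 & 012016356345 & 012016456345 & []) (
 split 678 (
 drop (345013016678 & 345014016678 & 345015016678 & 345023016678 & 345024016678 & 345025016678 & 345034016678 & 345035016678 & 345039016678 & 345045016678 & 345049016678 & 345059016678 & 345123016678 & 345124016678 & 345125016678 & 345134016678 & 345135016678 & 345139016678 & 345145016678 & 345149016678 & 345159016678 & 012016678347 & 012016678348 & 012016678357 & []) (
 bound (017012236345 & 018012246345 & 019012256345 & 127012036345 & 128012046345 & 349345056012 & 126012057345 & 129012058345 & 459345037012 & 679678038012 & 359345048012 & 689678047012 & 027012136345 & 026012138345 & 029012148345 & 028012137345 & [])))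
 (group (79 & []) (689 & []) & group (89 & []) (679 & []) & []) (
 split 027 (
 drop (345134012027 & 345135012027 & 345136012027 & 345138012027 & 345139012027 & 345145012027 & 345146012027 & 345148012027 & 345149012027 & 345156012027 & 345158012027 & 345159012027 & 012027347345 & 012027357345 & 012027457345 & []) (
 split 348 (
 drop (012015345348 & 012018348345 & 012025345348 & 012028348345 & 012056345348 & 012057345348 & 012059345348 & 012125345348 & 012128348345 & 012157345348 & []) (
 bound (458345013012 & 459345023012 & 358345014012 & 359345024012 & 017012236345 & 019012246345 & 026012137345 & 029012147345 & 127012036345 & 126012039345 & 129012034345 & 349345058012 & [])))
 (group (35 & []) (458 & []) & group (89 & []) (349 & 459 & []) & group (45 & []) (358 & 359 & []) & []) (
 split 128 (
 drop (345034012128 & 345035012128 & 345036012128 & 345037012128 & 345039012128 & 345045012128 & []) (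
 bound (789027013345 & 017012236345 & 018012246345 & 019012256345 & 026012137345 & 028012147345 & 029012157345 & 126012038345 & 127012048345 & 129012058345 & [])))
 (group (89 & []) (129 & []) & []) (
 split 789 (
 drop (345013027789 & 345014027789 & 345015027789 & 345023027789 & 345024027789 & 345025027789 & 345034027789 & 345035027789 & 345036027789 & 345045027789 & 345046027789 & 345056027789 & 345123027789 & 345124027789 & []) (
 bound []))
 [] (
 split 126 (
 drop (345034012126 & 345035012126 & 345037012126 & 345038012126 & 345039012126 & 345045012126 & []) (
 bound (127012036345 & 017012236345 & 018012246345 & 019012256345 & 026012137345 & 028012147345 & 029012157345 & [])))
 (group (67 & 12 & []) (127 & []) & []) (
 split 137 (
 drop (345137012026 & 345137012028 & 345137012029 & []) (
 bound (017012236345 & 018012246345 & 019012256345 & 025023137147 & 024034137157 & 056035137124 & 046036137125 & 045047137123 & [])))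
 (group (35 & []) (157 & []) & group (67 & 12 & []) (236 & 256 & []) & group (34 & []) (147 & 246 & []) & []) (
 star 0)))))))
 (group (79 & []) (029 & []) & group (01 & []) (127 & 129 & []) & group (78 & []) (028 & 128 & []) & []) (
 split 026 (
 drop (345134012026 & 345135012026 & 345137012026 & 345138012026 & 345139012026 & 345145012026 & 345147012026 & 345148012026 & 345149012026 & 345157012026 & 345158012026 & 345159012026 & []) (
 split 123 (
 drop (012123345457 & 012123345458 & 012123345459 & []) (
 bound (126012034345 & 357345014012 & 358345024012 & 359345046012 & 789047012123 & 348345057012 & 347345059012 & 349345015012 & 017012236345 & 018012246345 & 019012256345 & 058023123146 & 045025123136 & 056035123124 & 048036123125 & 049037123156 & [])))
 (group (35 & []) (125 & []) & group (26 & []) (136 & 156 & []) & group (34 & []) (124 & 146 & []) & []) (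
 bound (126012034345 & 458345037012 & 457345039012 & 459345013012 & 358345047012 & 357345049012 & 359345014012 & 348345057012 & 347345059012 & 349345015012 & 017012236345 & 018012246345 & 019012256345 & []))))
 (group (01 & []) (126 & []) & []) (
 split 789 (
 split 347 (
 drop (012013347789 & 012014347789 & 012015345347 & 012017347345 & 012018789347 & 012019789347 & 012023347789 & 012024347789 & 012025345347 & 012034347789 & 012035347789 & 012036347789 & 012045347789 & 012046347789 & 012056345347 & 012058345347 & 012059345347 & 012123347789 & 012124347789 & 012125345347 & 012134347789 & 012135347789 & 012136347789 & 012145347789 & 012146347789 & 012156345347 & 012158345347 & 012159345347 & 012236347789 & []) (
 bound []))
 (group (35 & []) (457 & []) & group (79 & []) (349 & 459 & []) & group (78 & 45 & []) (358 & 359 & 458 & []) & group (78 & []) (348 & 357 & []) & []) (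
 bound (345013017789 & 345014018789 & 345015019789 & 034012157789 & 035012147789 & 045012137789 & 134012057789 & 135012047789 & 145012037789 & 023012148789 & 025012149789 & 036012158789 & 056012138789 & 024012139789 & 046012159789 & 123012048789 & 125012049789 & 136012058789 & 236012059789 & 124012038789 & [])))
 [] (
 split 347 (
 drop (012015345347 & 012017347345 & 012025345347 & 012056345347 & 012058345347 & 012059345347 & 012125345347 & 012156345347 & 012158345347 & 012159345347 & 012256345347 & []) (
 split 358 (
 drop (012014345358 & 012018358345 & 012024345358 & 012046345358 & 012047345358 & 012049345358 & 012124345358 & 012146345358 & 012147345358 & []) (
 bound (458345037012 & 457345039012 & 459345013012 & 019012236345 & 357345048012 & 359345148012 & 348345057012 & 349345157012 & [])))
 (group (34 & []) (458 & []) & group (89 & []) (359 & 459 & []) & []) (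
 split 057 (
 drop (012057345348 & 012057345349 & []) (
 bound (457345013012 & 357345014012 & 018012236345 & 019012246345 & 023057145146 & 024057135136 & 035057147124 & 036057157148 & 057037123149 & 045057137138 & 057046134139 & [])))
 (group (01 & []) (157 & []) & []) (
 split 357 (
 drop (012014345357 & 012024345357 & 012046345357 & 012048345357 & 012049345357 & 012124345357 & 012146345357 & 012148345357 & []) (
 bound (457345013012 & 012018348345 & 019012236345 & [])))
 (group (34 & []) (457 & []) & []) (
 split 018 (
 drop (345236012018 & 345246012018 & 012018348345 & []) (
 split 023 (
 bound (012019349345 & 035023124146 & 023037147145 & 023038148149 & 024045135136 & 046047137123 & []))
 (group (28 & []) (038 & []) & group (34 & []) (024 & 048 & []) & group (01 & []) (123 & 124 & 138 & 148 & []) & group (26 & []) (036 & 046 & 136 & 146 & []) & []) (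
 bound [])))
 (group (89 & []) (019 & []) & []) (
 split 013 (
 split 246 (
 bound (137013045246 & 139013048246 & 135013024246 & 138013046246 & 037013145246 & 039013148246 & 035013124246 & []))
 [] (
 split 014 (
 split 024 (
 bound (236023014145 & 045024123136 & 024047137135 & 024048138139 & 035036146124 & 037038148149 & []))
 [] (
 bound (236023014145 & 035036146124 & 037038148149 & 045046136123 & 047048138135 & [])))
 [] (
 bound (023035145146 & 024045135136 & 036037147124 & 236038047149 & 046048138123 & []))))
 (group (34 & []) (014 & []) & []) (
 bound (023035145146 & 246024037135 & 036038148124 & 236039045147 & 046047137123 & []))))))))
 (group (35 & []) (457 & []) & group (79 & []) (349 & 459 & []) & group (78 & 45 & []) (358 & 359 & 458 & []) & group (78 & []) (348 & 357 & []) & []) (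
 split 236 (
 drop (345236012017 & 345236012018 & 345236012019 & []) (
 split 047 (
 bound (256236013047 & 048047137236 & 236139049047 & 157047034236 & 147047035236 & 236135045047 & 136236024047 & 138236025047 & 123236046047 & 236125014047 & 015047246236 & 148047056236 & 149047036236 & 145047023236 & 156236037047 & 057047124236 & []))
 (group (01 & []) (147 & []) & group (79 & []) (049 & 149 & []) & group (45 & []) (057 & 059 & 157 & 159 & []) & group (78 & []) (048 & 058 & 148 & 158 & []) & []) (
 bound (015013236246 & 145014023236 & 045024236136 & 256025034134 & []))))
 (group (35 & []) (256 & []) & group (34 & []) (246 & []) & []) (
 split 023 (
 split 147 (
 split 158 (
 drop (023024147158 & 023025158147 & 023034147158 & 023035158147 & 023037147158 & 023038158147 & 023046147158 & 023047147158 & 023049147158 & 023056158147 & 023058158147 & 023059158147 & []) (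
 bound (148147057023 & 023036146147 & 039023124147 & 156147048023 & [])))
 (group (89 & []) (159 & []) & []) (
 split 058 (
 drop (147123023058 & 147124023058 & 147134023058 & 147136023058 & 147137023058 & 147139023058 & 023058145147 & 023058148147 & 023058156147 & 023058157147 & []) (
 bound (025023138147 & 038023125147 & 023036146147 & 149147037023 & [])))
 (group (89 & []) (059 & []) & []) (
 bound (157147046023 & 156147024023 & 056023123147 & 025023134147 & 023035145147 & 036023124147 & 038023125147 & 023039149147 & 146147037023 & 148147057023 & 045047137136 & 048049139135 & []))))
 (group (79 & []) (149 & []) & group (45 & []) (157 & 159 & []) & group (78 & []) (148 & 158 & []) & []) (
 split 146 (
 split 137 (
 drop (146137023025 & 146137023058 & 146137023059 & []) (
 bound (156146024023 & 145146036023 & 035023124146 & 037023125146 & 057023123146 & 045046136137 & 048047137135 & [])))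
 (group (79 & []) (139 & []) & group (78 & []) (138 & []) & []) (
 bound (156146024023 & 145146036023 & 035023124146 & 037023125146 & 025023134146 & 057023123146 & 058023136146 & [])))
 (group (45 & []) (156 & []) & []) (
 split 134 (
 split 124 (
 bound (056025124134 & 057035134124 & 058036134124 & 059037134124 & 038023124145 & 039034124125 & 024045135136 & 046047137123 & []))
 [] (
 split 125 (
 bound (036023125145 & 046024125135 & 025045134136 & 047034123125 & 048037137125 & 049038138125 & 056059139134 & []))
 [] (
 split 013 (
 split 014 (
 split 015 (
 split 017 (
 split 018 (
 split 019 (
 split 025 (
 split 024 (
 drop (025024134136 & 025024134137 & 025024134138 & 025024134139 & []) (
 star 0))
 [] (
 bound (056025123134 & 134137057025 & 134138058025 & 139134046025 & 136134045025 & [])))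
 [] (
 bound (057024134136 & 056045134123 & 058046134137 & 059047134138 & 048049139135 & [])))
 [] (
 bound (025024134136 & 056045134123 & 058046134137 & 057047134138 & 048049139135 & [])))
 [] (
 bound (025024134136 & 056045134123 & 058046134137 & 057047134138 & 048049139135 & [])))
 [] (
 bound (025024134136 & 056045134123 & 058046134137 & 057047134138 & 048049139135 & [])))
 [] (
 bound (025024134136 & 056045134123 & 058046134137 & 057047134138 & 048049139135 & [])))
 [] (
 bound (025024134136 & 056045134123 & 058046134137 & 057047134138 & 048049139135 & [])))
 [] (
 bound (025024134136 & 056045134123 & 058046134137 & 057047134138 & 048049139135 & [])))))
 (group (45 & []) (135 & []) & []) (
 split 137 (
 bound (024046136137 & 025047137138 & 048034137125 & 056035137124 & 045049139137 & 058057137123 & []))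
 (group (79 & []) (139 & []) & group (78 & []) (138 & []) & []) (
 split 123 (
 bound (045024123136 & 046034123125 & 056035123124 & []))
 [] (
 star 0))))))
 (group (35 & []) (025 & []) & group (26 & []) (036 & 056 & []) & group (01 & []) (123 & 125 & 136 & 156 & []) & group (34 & []) (024 & 046 & 124 & 146 & []) & []) (
 bound (034037157158 & 035038148147 & 045047137138 & 048049139135 & []))))))))))
 (group (12 & []) (026 & []) & group (69 & []) (019 & 029 & []) & group (25 & 14 & 03 & []) (346 & 349 & 356 & 359 & []) & group (67 & 02 & []) (027 & 127 & 129 & 347 & 357 & []) & group (68 & 24 & 13 & 05 & []) (017 & 018 & 128 & 358 & 457 & 458 & 459 & []) & group (68 & []) (028 & 126 & 348 & 456 & []) & []) (
 split 678 (
 split 036 (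
 drop (678036012124 & 678036012125 & 678036012145 & 678036012149 & 678036012159 & 678036012245 & 678036012249 & 678036012259 & 012036678789 & []) (
 bound (689678037012 & 679678038012 & 123012046678 & 135012047678 & 235012048678 & 134012056678 & 234012057678 & 139012058678 & 024012136678 & 025012137678 & 045012138678 & 014012236678 & 015012237678 & 049012238678 & 013012256678 & 034012257678 & 039012258678 & 023012156678 & 239012157678 & 035012146678 & 059012147678 & 158148246036 & [])))
 (group (12 & 24 & 13 & 05 & []) (156 & 046 & 256 & []) & group (68 & 01 & 25 & 14 & 03 & []) (048 & 146 & 148 & 238 & 258 & 056 & 136 & 138 & 248 & 038 & []) & group (67 & 35 & []) (037 & 047 & 057 & 058 & 137 & 147 & 157 & 158 & 237 & []) & group (02 & []) (236 & 246 & 247 & 257 & []) & []) (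
 bound (012039679678 & 012049689678 & 012059789678 & 013014245259 & [])))
 (group (79 & []) (689 & []) & group (89 & []) (679 & []) & group (69 & []) (789 & []) & []) (
 split 036 (
 split 147 (
 split 058 (
 drop (147123036058 & 036058125147 & 147134036058 & 147136036058 & 147137036058 & 147139036058 & 036058145147 & 147146036058 & 036058148147 & 036058157147 & 036058158147 & 036058159147 & 147234036058 & 147237036058 & []) (
 bound (038036156147 & 056036138147 & 036039149147 & 036059249147 & 247147135036 & 036023124147 & 256036013147 & 258058034147 & 259058037147 & 236036015147 & 238036045147 & 235036049147 & 239036014147 & [])))
 (group (89 & []) (059 & []) & group (67 & 34 & 01 & []) (158 & 159 & []) & group (25 & 14 & 03 & []) (238 & 239 & 248 & 249 & []) & []) (
 bound (157147024036 & 236036045147 & 247147015036 & 056036123147 & 245147013036 & 025036136147 & 256036137147 & 257147134036 & 235036014147 & 125147034036 & 036023124147 & 148147057036 & 145147037036 & 149147237036 & 035036146147 & 038036156147 & 039036246147 & 046036135258 & 047036139259 & [])))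
 (group (21 & 24 & 15 & 03 & []) (247 & 257 & 157 & []) & group (79 & []) (149 & 159 & 249 & 259 & []) & group (78 & []) (148 & 158 & 248 & 258 & []) & []) (
 split 124 (
 split 137 (
 drop (124137036056 & 124137036058 & 124137036059 & 036137124245 & []) (
 bound (145124023036 & 125124034036 & 057036123124 & 035036146124 & 037036156124 & 038036246124 & 039036256124 & 046014137235 & 045015137236 & 024025135137 & 048047137136 & [])))
 (group (79 & []) (139 & []) & group (12 & []) (237 & 239 & []) & group (78 & []) (138 & 238 & []) & []) (
 bound (245124013036 & 145124023036 & 125124034036 & 035036146124 & 037036156124 & 038036256124 & 039036246124 & 056036123124 & 057036134124 & [])))
 (group (21 & 24 & 15 & 03 & []) (245 & 125 & 145 & []) & []) (
 split 146 (
 split 014 (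
 bound (057014146236 & 238058014146 & 235059014146 & 237023014146 & 239025014146 & 037014146256 & 035013146246 & 038024146156 & 056015123234 & 045046136137 & 047048138135 & []))
 (group (25 & 14 & 03 & []) (134 & []) & []) (
 bound (035013146246 & 146015023237 & 025024146136 & 037034146156 & 238038045146 & 235039046146 & 146047059239 & 057048146123 & 058049146137 & [])))
 (group (21 & 24 & 15 & 03 & []) (246 & 256 & 156 & []) & []) (
 split 013 (
 split 014 (
 split 123 (
 bound (056014123237 & 058014123239 & 045014123236 & 048014123235 & 046014123238 & 057015123234 & 047024123135 & []))
 [] (
 bound (015014234236 & 045014136237 & 046014135235 & 047014138238 & 048014137239 & 025024134139 & [])))
 (group (45 & []) (015 & []) & []) (
 bound (024025135136 & 045046236123 & 047048138139 & 049056235137 & 057058238134 & [])))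
 (group (21 & 24 & 15 & 03 & []) (034 & 023 & 035 & []) & []) (
 bound (014015235236 & 024025135136 & 045047137123 & []))))))
 (group (12 & 24 & 13 & 05 & []) (156 & 046 & 256 & []) & group (69 & []) (039 & 049 & 159 & 259 & []) & group (02 & []) (056 & 059 & 236 & 239 & 246 & 249 & []) & group (68 & 01 & []) (058 & 138 & 139 & 148 & 149 & 158 & 238 & 248 & 258 & []) & group (67 & 02 & []) (037 & 038 & 047 & 048 & 057 & 157 & 237 & 247 & 257 & []) & group (01 & []) (136 & 137 & 146 & 147 & []) & []) (
 bound [])))))
 (group (46 & []) (356 & []) & group (38 & []) (458 & 568 & []) & group (59 & []) (349 & 369 & 489 & 689 & []) & group (56 & 37 & []) (467 & 468 & 479 & 567 & 579 & 589 & []) & group (47 & 39 & []) (347 & 358 & 368 & 378 & 379 & 456 & 569 & 578 & 678 & []) & group (59 & 46 & 37 & []) (346 & 348 & 357 & 359 & 367 & 389 & 457 & 459 & 469 & 478 & 679 & 789 & []) & []) (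
 split 034 (
 split 156 (
 split 237 (
 drop (156014034237 & 156015034237 & 156016034237 & 156018034237 & 156019034237 & 156045034237 & 156046034237 & 156056034237 & 156058034237 & 156059034237 & 156068034237 & 156069034237 & 034237125156 & 034237126156 & 034237127156 & 034237128156 & 034237129156 & 156145034237 & 156146034237 & 156148034237 & 156149034237 & 034237157156 & 034237167156 & 034237178156 & 034237179156 & 034237256156 & 034237257156 & 034237258156 & 034237259156 & 034237267156 & 034237268156 & 034237269156 & []) (
 bound (023034147156 & 168156025034 & 158156026034 & 037034124156 & 038034245156 & 234034017156 & 238034057156 & 039034246156 & 239034067156 & 024034137156 & 027034138156 & 028034139156 & 047034123156 & 247034013156 & 248034035156 & 029034134156 & 078034235156 & 048034236156 & 034079169156 & 089034135156 & 049034237278 & 249034136156 & 159279237034 & 189156036034 & [])))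
 (group (43 & 45 & 36 & 01 & []) (257 & 247 & 267 & []) & group (79 & []) (239 & 249 & 259 & 269 & []) & group (78 & []) (238 & 248 & 258 & 268 & []) & []) (
 split 234 (
 drop (156015034234 & 156016034234 & 156017034234 & 156018034234 & 156019034234 & 156056034234 & 156057034234 & 156058034234 & 156059034234 & 156067034234 & 156068034234 & 156069034234 & 034234125156 & 034234126156 & 034234127156 & 034234128156 & 034234129156 & 034234256156 & []) (
 split 037 (
 drop (156124034037 & 156145034037 & 156146034037 & 156148034037 & 156149034037 & 034037157156 & 034037167156 & 034037178156 & []) (
 bound (023034147156 & 278234013156 & 279234014156 & 168156025034 & 034038158156 & 159156026034 & 289234036156 & 189156046034 & 169156035034 & 024034137156 & 028034139156 & 027034134156 & 029034138156 & 047034123156 & 048034135156 & 049034136156 & 078034235156 & 079034236156 & [])))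
 (group (34 & []) (047 & []) & group (79 & []) (039 & 049 & []) & group (78 & []) (038 & 048 & []) & []) (
 bound (278234013156 & 279234014156 & 078034123156 & 079034124156 & 024034138156 & 027034139156 & 023034148156 & 028034149156 & 029034134156 & 089034135156 & 289234136156 & 157156026034 & 158156036034 & 159156046034 & 178156236034 & 179156246034 & 167156025034 & 168156035034 & 169156045034 & 189156235034 & []))))
 (group (46 & 35 & 01 & []) (256 & []) & []) (
 split 235 (
 drop (156235034047 & 156235034048 & 156235034049 & 156235034078 & 156235034079 & 156235034089 & 034235156167 & 034235156168 & 034235156169 & 034235156178 & 034235156179 & 034235156189 & []) (
 split 278 (
 drop (278235034014 & 278235034016 & 278235034019 & 278235034046 & 278235034069 & 278235034146 & 278235034149 & []) (
 bound (017034235289 & 018034235279 & 136034025278 & 045034123278 & 126156057034 & 134034058278 & 024034137156 & 056034138278 & 159156026034 & 015034236278 & 039034124156 & 013034245278 & 128156067034 & 145034068278 & 028034147156 & 023034148156 & 035034246278 & 034027125156 & 127156036034 & 156059029278 & 129278037034 & 034135157278 & 156139038278 & [])))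
 (group (79 & []) (289 & []) & group (89 & []) (279 & []) & []) (
 split 236 (
 drop (034236156157 & 034236156158 & 034236156159 & []) (
 split 057 (
 drop (236235057014 & 236235057017 & 236235057018 & 236235057019 & 034057156126 & 034057156128 & 034057156129 & 057235236146 & 236235057147 & []) (
 bound (246236013057 & 148016236235 & 124236035057 & 039034245156 & 038034149156 & 034037127156 & 034023125156 & 145057036236 & 045057137236 & 236138058057 & 236139059057 & 134236026057 & 136236025057 & 236123015057 & 024034135156 & [])))
 (group (56 & []) (067 & []) & group (79 & []) (059 & 069 & []) & group (78 & []) (058 & 068 & []) & []) (
 bound (127156056034 & 126156035034 & 125156036034 & 037034124156 & 038034245156 & 039034246156 & 027034134156 & 024034138156 & 028034139156 & 029034135156 & 034023128156 & 129156045034 & 014015235236 & 017016236235 & 018046236235 & 019145235236 & 147146236235 & 025235136148 & []))))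
 (group (46 & 35 & 01 & []) (245 & []) & []) (
 split 246 (
 drop (156246034037 & 156246034038 & 156246034039 & 034246156157 & 034246156158 & 034246156159 & []) (
 bound (017013235246 & 018014246235 & 019015235246 & 127156056034 & 125156036034 & 126156045034 & 027034134156 & 024034136156 & 023034145156 & 058235246149 & 057235246148 & 059235246146 & 035235246147 & 068246235139 & 034028129156 & 128156067034 & 029034135156 & 046246235137 & 069246235138 & [])))
 [] (
 split 057 (
 drop (034057156126 & 034057156128 & 034057156129 & []) (
 split 148 (
 drop (235057014148 & 235057016148 & 235057017148 & 235057018148 & 235057019148 & 156148034023 & 156148034027 & 156148034029 & 156148034037 & 156148034039 & 235057046148 & []) (
 bound (025235137148 & 127156035034 & 235056146148 & 149148058235 & 034024125156 & 038034145156 & 028034135156 & 159156067034 & 157156026034 & 158156036034 & [])))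
 (group (89 & []) (149 & []) & []) (
 split 146 (
 drop (235057014146 & 235057016146 & 235057017146 & 235057018146 & 235057019146 & 156146034023 & 156146034027 & 156146034028 & 156146034029 & 156146034037 & 156146034038 & 156146034039 & 235057046146 & 235057067146 & 235057068146 & 235057069146 & 057235123146 & 057235124146 & 057235134146 & []) (
 bound []))
 [] (
 split 127 (
 drop (034023127156 & 034024127156 & 034027127156 & 034028127156 & 034029127156 & 034035156127 & 034036156127 & 034037127156 & 034045156127 & 034046156127 & 034056156127 & 034058156127 & 034059156127 & 034068156127 & []) (
 bound (123235057067 & 157156026034 & 034038158156 & 039034124156 & [])))
 [] (
 split 158 (
 drop (034026156158 & 034028158156 & 034036156158 & 034038158156 & 034046156158 & 034067156158 & 034069156158 & []) (
 bound (123235057068 & 037034124156 & 034027157156 & 029034134156 & 024034135156 & 034023125156 & 039034145156 & 147014025235 & 045057137136 & 057058138139 & [])))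
 (group (89 & []) (159 & []) & []) (
 split 138 (
 drop (156138034024 & 156138034027 & 156138034029 & 138235057046 & []) (
 bound (124138035057 & 125156036034 & 023034145156 & 034037157156 & 038034147156 & 057025123138 & 057045134138 & 068057235139 & 136138058057 & 056057137138 & 026057135138 & [])))
 (group (89 & []) (139 & []) & []) (
 split 028 (
 drop (034028125156 & 156134034028 & 156135034028 & 156136034028 & 156137034028 & 156145034028 & 156147034028 & []) (
 star 0))
 (group (89 & []) (029 & []) & []) (
 split 135 (
 drop (156135034024 & []) (
 bound (125156036034 & 023034145156 & 034037157156 & 038034124156 & 039034147156 & 046014135235 & 067016135235 & 068017135235 & 069018135235 & 026057135134 & [])))
 [] (
 split 125 (
 drop (034023125156 & 034024125156 & 034027125156 & 034036156125 & 034046156125 & 034067156125 & []) (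
 bound (157156026034 & 037034124156 & 038034145156 & 039034147156 & [])))
 [] (
 split 157 (
 drop (034026156157 & 034027157156 & 034036156157 & 034037157156 & []) (
 bound (123235057067 & 024034136156 & 023034145156 & 038034124156 & 039034147156 & [])))
 [] (
 split 124 (
 drop (156124034037 & 156124034038 & []) (
 bound (134124026057 & 136124025057 & 024034137156 & 027034145156 & 023034147156 & 057035123124 & [])))
 [] (
 split 027 (
 drop (156134034027 & 156136034027 & 156145034027 & []) (
 star 0))
 [] (
 bound (037034145156 & 023034147156 & 046057235123 & 067057235134 & 024034136156 & 068014137235 & []))))))))))))))
 (group (79 & []) (059 & []) & group (46 & 35 & 01 & []) (137 & 139 & []) & group (78 & []) (058 & 138 & []) & []) (
 bound (157156026034 & 127156056034 & 126156035034 & 128156045034 & 158156069034 & 159156036034 & 125156046034 & 129156067034 & 024034135156 & 037034124156 & 027034134156 & 028034136156 & 038034149156 & 023034145156 & 029034146156 & 039034147156 & 148014025235 & 068016123235 & [])))))))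
 (group (34 & []) (245 & []) & group (56 & []) (236 & 246 & []) & []) (
 split 278 (
 split 037 (
 drop (156013037278 & 156014037278 & 156015037278 & 156016037278 & 156019037278 & 156035037278 & 156036037278 & 156045037278 & 156046037278 & 156056037278 & 156059037278 & 156069037278 & 156124034037 & 034037278125 & 034037278126 & 034037127156 & 034037278128 & 034037278129 & 156134037278 & 156135037278 & 156136037278 & 156139037278 & 156145034037 & 156146034037 & 156148034037 & 156149034037 & 034037157156 & 034037278158 & 034037167156 & 034037278168 & 034037178156 & []) (
 bound (279278018034 & 023034147156 & 169156025034 & 159156026034 & 027034138156 & 024034137156 & 047034123156 & [])))
 (group (43 & 45 & 36 & 01 & []) (157 & 047 & 167 & []) & group (78 & []) (038 & 048 & 158 & 168 & []) & []) (
 split 035 (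
 drop (156035023278 & 156035024278 & 156035027278 & 156035028278 & 156035029278 & 156035078278 & 156035079278 & 156035089278 & 278124034035 & 034035125278 & 034035156126 & 034035156127 & 034035156128 & 034035156129 & 278147034035 & 278148034035 & 034035156169 & []) (
 bound (289278017034 & 279278018034 & 159156036034 & 039034145156 & 045034123278 & 046034137278 & 056034138278 & 049034135156 & 134034026278 & 139034067278 & 149034068278 & 136034025278 & 146034057278 & [])))
 (group (43 & 45 & 36 & 01 & []) (145 & 046 & 136 & []) & group (34 & []) (036 & 045 & 135 & 146 & []) & []) (
 bound (289278017034 & 279278018034 & 169156025034 & 159156026034 & 039034124156 & 049034123156 & 134034057278 & 126156058034 & 139034067278 & 149034068278 & 024034137156 & 027034138156 & 056034148278 & 059034147278 & 034013125278 & 034023127156 & 156014028278 & 034015128278 & 034029129156 & 156016078278 & 034019178278 & 034079179156 & []))))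
 (group (79 & []) (289 & []) & group (89 & []) (279 & []) & []) (
 split 057 (
 drop (034057156126 & 034057156128 & 034057156129 & 034057156168 & 034057156169 & 034057156189 & []) (
 split 178 (
 drop (034025156178 & 034026156178 & 034027178156 & 034028178156 & 034035156178 & 034036156178 & 034037178156 & 034038178156 & 034045156178 & 034046156178 & 034047178156 & 034048178156 & 034056156178 & 034059156178 & 034069156178 & 034078178156 & 034079178156 & 034089178156 & []) (
 split 125 (
 drop (034023125156 & 034024125156 & 034029125156 & 034067156125 & 034068156125 & []) (
 star 1))
 (group (68 & 57 & []) (127 & []) & []) (
 split 159 (
 drop (034029159156 & 034039159156 & 034049159156 & 034067156159 & 034068156159 & []) (
 star 1))
 (group (68 & 57 & []) (179 & []) & []) (
 bound (167156058034 & 158156067034 & 157156068034 & 049034123156 & 039034124156 & 029034134156 & 024034135156 & [])))))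
 (group (89 & []) (179 & []) & []) (
 split 136 (
 drop (156136034024 & 156136034027 & 156136034028 & 156136034029 & 156136034047 & 156136034048 & 156136034049 & 156136034078 & 156136034079 & 156136034089 & []) (
 split 068 (
 drop (057068136123 & 057068136124 & 034068156125 & 034068156127 & 057068136134 & 057068136139 & 057068136149 & 034068156157 & 034068156159 & []) (
 bound (158156036034 & 138136046057 & 148136026057 & 146136035057 & 023034145156 & 034037167156 & 038034147156 & 025057137136 & [])))
 (group (89 & []) (069 & []) & []) (
 split 038 (
 drop (156124034038 & 156145034038 & 156146034038 & 156147034038 & []) (
 bound (034039159156 & 034023125156 & 057025123136 & 167156035034 & 157156036034 & 034037127156 & 138136046057 & 058057137136 & 057059139136 & 134136026057 & 057045148136 & [])))
 (group (89 & []) (039 & []) & []) (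
 split 148 (
 drop (156148034023 & 057026136148 & 057035136148 & 057036136148 & 156148034037 & 057045148136 & 057056136148 & 057058148136 & 057067136148 & []) (
 star 1))
 (group (89 & []) (149 & []) & []) (
 bound (023034145156 & 125156036034 & 146136035057 & 025057147136 & 123136056057 & 037034124156 & 157156026034 & 057045134136 & 058057137136 & 167156059034 & 127156046034 & []))))))
 (group (34 & []) (146 & []) & []) (
 split 127 (
 drop (034023127156 & 034024127156 & 034027127156 & 034028127156 & 034029127156 & 034035156127 & 034036156127 & 034037127156 & 034045156127 & 034046156127 & 034047127156 & 034056156127 & 034058156127 & 034059156127 & 034068156127 & 034069156127 & 034078127156 & []) (
 bound (167156025034 & 125156067034 & 089034134156 & 049034138156 & 048034123156 & 039034148156 & 038034124156 & 157156026034 & [])))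
 [] (
 split 167 (
 drop (034025156167 & 034027167156 & 034035156167 & 034037167156 & 034045156167 & 034047167156 & 034058156167 & 034059156167 & 034078167156 & 034079167156 & []) (
 bound (157156026034 & 159156068034 & 125156036034 & 158156046034 & 048034123156 & 024034139156 & 049034138156 & 038034124156 & 023034149156 & 039034148156 & 028034134156 & 029034135156 & 089034137156 & 069056145147 & [])))
 [] (
 split 158 (
 drop (034026156158 & 034028158156 & 034036156158 & 034038158156 & 034046156158 & 034048158156 & 034067156158 & 034069156158 & 034078158156 & 034089158156 & []) (
 split 135 (
 drop (156135034024 & 156135034027 & 156135034029 & 156135034047 & 156135034049 & 156135034079 & []) (
 bound (123135057068 & 034023125156 & 039034147156 & 037034124156 & 025057137134 & 057035138148 & 057045149139 & [])))
 (group (34 & []) (145 & []) & []) (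
 split 138 (
 drop (156138034024 & []) (
 bound (056057137138 & 034023125156 & 034037157156 & 034039159156 & 025057147138 & 057059139138 & 123138058057 & 134138068057 & 124138035057 & 057045148138 & [])))
 (group (34 & []) (148 & []) & []) (
 bound (023034147156 & 039034124156 & 037034149156 & 024034137156 & 049034123156 & 047034139156 & 034027125156 & 029034134156 & 157156068034 & [])))))
 (group (89 & []) (159 & []) & []) (
 split 027 (
 drop (034027125156 & 156134034027 & 156135034027 & 156138034027 & 156139034027 & 156145034027 & 156148034027 & 156149034027 & 034027157156 & []) (
 star 0))
 [] (
 split 135 (
 drop (156135034024 & 156135034028 & 156135034029 & 156135034047 & 156135034048 & 156135034049 & 156135034078 & 156135034079 & 156135034089 & []) (
 split 148 (
 drop (156148034023 & []) (
 bound (056057137148 & 038034145156 & 057025124148 & 138148045057 & 059057147148 & 149148058057 & 057035134148 & 057036123148 & 125156046034 & 139135057068 & [])))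
 (group (89 & []) (149 & []) & []) (
 bound (125156036034 & 023034147156 & 038034145156 & 039034124156 & 034037157156 & 026057135134 & 068057135139 & 046057135123 & 067057135138 & []))))
 (group (34 & []) (145 & []) & []) (
 split 125 (
 drop (034023125156 & 034024125156 & 034028125156 & 034029125156 & 034036156125 & 034046156125 & 034067156125 & 034068156125 & []) (
 bound (157156026034 & 037034148156 & 039034147156 & 038034149156 & 047034138156 & 049034137156 & 048034139156 & 078034123156 & 079034124156 & 089034134156 & [])))
 [] (
 split 078 (
 drop (156123034078 & 156124034078 & 156134034078 & 156139034078 & 156149034078 & 034078157156 & []) (
 star 0))
 (group (89 & []) (079 & []) & []) (
 split 137 (
 drop (156137034024 & 156137034028 & 156137034029 & 156137034048 & 156137034049 & 156137034089 & []) (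
 bound (157156036034 & 023034147156 & 038034149156 & 037034124156 & 039034148156 & 025057137134 & 026057137138 & 059057137123 & 045057137139 & [])))
 (group (34 & []) (147 & []) & []) (
 split 037 (
 drop (156124034037 & 156148034037 & 156149034037 & 034037157156 & []) (
 star 0))
 (group (34 & []) (047 & []) & []) (
 split 157 (
 drop (034026156157 & 034036156157 & 034046156157 & 034068156157 & []) (
 bound (023034148156 & 039034124156 & 038034149156 & 024034138156 & 029034134156 & 028034139156 & 048034123156 & [])))
 [] (
 split 028 (
 drop (156134034028 & 156139034028 & 156149034028 & []) (
 star 0))
 (group (89 & []) (029 & []) & []) (
 split 138 (
 drop (156138034024 & 156138034049 & []) (
 bound (023034148156 & 039034124156 & 057025123138 & 149138035057 & 057045134138 & 048034139156 & [])))
 (group (34 & []) (148 & []) & group (89 & []) (139 & 149 & []) & []) (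
 star 0))))))))))))))))
 (group (56 & []) (067 & []) & group (79 & []) (059 & 069 & []) & group (46 & 35 & 01 & []) (137 & 139 & 147 & 149 & []) & group (78 & []) (058 & 068 & 138 & 148 & []) & []) (
 split 037 (
 drop (156124034037 & 034037127156 & 156145034037 & 156146034037 & 034037157156 & 034037167156 & 034037178156 & 034037179156 & []) (
 split 028 (
 drop (034028125156 & 034028126156 & 034028128156 & 034028129156 & 156134034028 & 156135034028 & 156136034028 & 034028158156 & 034028168156 & []) (
 star 0))
 (group (89 & []) (029 & []) & []) (
 bound (168156025034 & 158156026034 & 034038128156 & 189156056034 & 034023125156 & 159156036034 & 129156046034 & 034039169156 & 126156035034 & 024034135156 & 027034134156 & 047034123156 & 048034136156 & []))))
 (group (43 & 45 & 36 & 01 & []) (157 & 047 & 167 & []) & group (79 & []) (039 & 049 & 159 & 169 & []) & group (78 & []) (038 & 048 & 158 & 168 & []) & []) (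
 bound (178156025034 & 179156026034 & 078034123156 & 079034124156 & 189156056034 & 126156035034 & 127156045034 & 125156036034 & 128156046034 & 023034145156 & 034024129156 & []))))))))
 (group (12 & []) (256 & []) & group (69 & []) (159 & 259 & []) & group (58 & []) (168 & 189 & 268 & 289 & []) & group (68 & 57 & []) (169 & 178 & 179 & 269 & 278 & 279 & []) & group (68 & []) (158 & 167 & 258 & 267 & []) & group (58 & []) (157 & 257 & []) & []) (
 split 125 (
 split 067 (
 drop (125123034067 & 125124034067 & 034067126125 & 034067127125 & 125134034067 & 125135034067 & 125138034067 & 125139034067 & 125145034067 & 125148034067 & 125149034067 & 125234034067 & 125235034067 & 125238034067 & 125239034067 & 125245034067 & 125248034067 & 125249034067 & []) (
 split 089 (
 drop (034089128125 & 034089129125 & 125136034089 & 125137034089 & 125146034089 & 125147034089 & []) (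
 star 0))
 [] (
 split 128 (
 drop (034035125128 & 034038128125 & 034045125128 & 034048128125 & 034056125128 & 034057125128 & 034059125128 & 034068128125 & []) (
 bound (129125058034 & 036034147125 & 037034146125 & 039034246125 & 069034247125 & 046034137125 & 049034237125 & 047034136125 & 079034236125 & [])))
 (group (89 & []) (129 & []) & []) (
 split 038 (
 drop (125146034038 & 125147034038 & 125246034038 & 125247034038 & []) (
 star 0))
 (group (43 & 46 & 37 & []) (068 & 048 & 078 & []) & group (89 & []) (039 & 049 & 069 & 079 & []) & []) (
 split 136 (
 drop (125136034047 & []) (
 bound (046034137125 & 037034146125 & 036034147125 & 136013024247 & 045014136236 & 058015136237 & [])))
 (group (34 & 47 & 36 & []) (137 & 147 & 146 & []) & group (12 & []) (236 & 237 & 246 & 247 & []) & []) (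
 bound []))))))
 (group (69 & []) (079 & []) & group (78 & []) (068 & 089 & []) & group (79 & []) (069 & 078 & []) & []) (
 split 036 (
 drop (125124034036 & 034036126125 & 125145034036 & 125147034036 & 125148034036 & 125149034036 & 125245034036 & 125247034036 & 125248034036 & 125249034036 & []) (
 split 047 (
 drop (125123034047 & 034047127125 & 125135034047 & 125136034047 & 125138034047 & 125139034047 & 125235034047 & 125236034047 & 125238034047 & 125239034047 & []) (
 split 137 (
 drop (125137034046 & 125137034048 & 125137034049 & []) (
 bound (129125058034 & 128125035034 & 037034146125 & 038034246125 & 045014137237 & 056015137234 & 025024134137 & [])))
 (group (12 & []) (237 & []) & group (67 & 34 & []) (146 & 246 & []) & []) (
 star 0)))
 (group (79 & []) (049 & []) & group (78 & []) (048 & []) & []) (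
 split 127 (
 drop (034035125127 & 034037127125 & 034045125127 & 034056125127 & 034058125127 & 034059125127 & []) (
 split 057 (
 drop (034057125128 & 034057125129 & []) (
 bound (046034123125 & 038034146125 & 039034246125 & 014057235236 & 015057237234 & 057016134238 & 057017136239 & 024057135138 & 025057137139 & [])))
 [] (
 split 046 (
 drop (125123034046 & 125135034046 & 125137034046 & 125138034046 & 125139034046 & 125235034046 & 125237034046 & 125238034046 & []) (
 bound (034038128125 & 034039129125 & [])))
 [] (
 split 013 (
 split 246 (
 drop (125246034038 & []) (
 bound (137013025246 & 139013028246 & 135013024246 & 138013026246 & 017013235246 & 019013238246 & 015013234246 & 018013236246 & [])))
 [] (
 split 014 (
 bound (034038128125 & 034039129125 & 015014234236 & 014017237235 & 014018238239 & 025023134146 & 024026136135 & 027028138139 & []))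
 [] (
 bound (034038128125 & 034039129125 & 015016236234 & 017018238235 & 146019023237 & 024025135136 & 026027137134 & []))))
 (group (12 & []) (023 & []) & []) (
 bound (034038128125 & 034039129125 & 014015235236 & 016017237234 & 018019239246 & 024025135136 & 026027137134 & []))))))
 (group (79 & []) (129 & []) & group (78 & []) (128 & []) & []) (
 split 146 (
 drop (125146034037 & 125146034038 & 125146034039 & []) (
 bound (046034123125 & 035013146246 & 146014023235 & 146015025237 & 146016027238 & 146017028239 & 057018146234 & 058019146236 & 029024146135 & 059026146134 & 045056136137 & [])))
 (group (12 & []) (246 & []) & []) (
 split 046 (
 drop (125123034046 & 125135034046 & 125137034046 & 125138034046 & 125139034046 & 125235034046 & 125237034046 & 125238034046 & 125239034046 & []) (
 star 0))
 [] (
 split 137 (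
 split 045 (
 bound (237137016045 & 239137018045 & 236137014045 & 238137015045 & 024045135137 & 137123025045 & 137136026045 & 138137027045 & 028045134137 & 137139029045 & 056045234137 & []))
 (group (46 & []) (056 & []) & []) (
 split 024 (
 bound (059024238137 & 058024123137 & 137135025024 & 026024134137 & 137138028024 & 137139029024 & 136137027024 & 014015235236 & 016017237234 & []))
 (group (46 & []) (026 & []) & []) (
 split 028 (
 bound (059028238137 & 058028123137 & 137135025028 & 029028138137 & 134137027028 & 136137057028 & 014015235236 & []))
 (group (89 & []) (029 & []) & []) (
 bound (058014137236 & 059015137234 & 025027137134 & 016017237235 & 057018123239 & [])))))
 (group (79 & []) (139 & []) & group (12 & []) (237 & 239 & []) & group (78 & []) (138 & 238 & []) & []) (
 split 134 (
 bound (057014134236 & 056015134234 & 026024134135 & 025045134136 & 058027123134 & []))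
 (group (12 & []) (234 & []) & group (46 & []) (136 & 236 & []) & []) (
 star 0))))))))
 (group (69 & []) (039 & []) & group (34 & []) (046 & 049 & []) & group (67 & []) (037 & 047 & []) & group (68 & []) (038 & 048 & []) & []) (
 split 056 (
 drop (034056125127 & 034056125128 & 034056125129 & []) (
 split 137 (
 bound (247137013056 & 237137014056 & 147137023056 & 148137235056 & 234137015056 & 245056016137 & 239137018056 & 246056017137 & 238137019056 & 126125035034 & 026056145137 & 024056135137 & 134137027056 & 056058138137 & 139137057056 & 056025123137 & 056028124137 & 029056146137 & 045056136137 & []))
 (group (34 & []) (147 & []) & group (79 & []) (139 & 149 & []) & group (12 & []) (237 & 239 & 247 & 249 & []) & group (78 & []) (138 & 148 & 238 & 248 & []) & []) (
 bound (126125035034 & 015056236234 & 025056136134 & 056045124123 & 013016246245 & 146014023235 & 026024145135 & []))))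
 (group (67 & []) (057 & []) & group (69 & []) (059 & []) & group (68 & []) (058 & []) & []) (
 split 035 (
 drop (034035125126 & 034035125127 & 034035125128 & 034035125129 & []) (
 split 146 (
 bound (147146026035 & 148146236035 & 035029149146 & 237035045146 & 235035014146 & 025035134146 & 246146013035 & 239035018146 & 238035017146 & 247146019035 & 248146015035 & 249146016035 & 028035137146 & 027035135146 & []))
 (group (69 & []) (149 & []) & group (12 & []) (246 & 249 & []) & group (67 & []) (147 & 247 & []) & group (68 & []) (148 & 248 & []) & []) (
 bound (136013024245 & 014015235236 & 016017237234 & 145018023239 & 045019123238 & 025027137134 & []))))
 (group (34 & []) (045 & []) & []) (
 split 016 (
 split 237 (
 split 248 (
 drop (016013237248 & 016014248237 & 016017237248 & 016018248237 & 016135237248 & 016136237248 & 016137237248 & 016139237248 & 016145248237 & 016146248237 & 016148248237 & 016149248237 & []) (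
 bound (238237147016 & 016015235237 & 019016236237 & 245237138016 & [])))
 (group (89 & []) (249 & []) & []) (
 split 148 (
 drop (237023016148 & 237025016148 & 237026016148 & 237027016148 & 237029016148 & 016148234237 & 237236016148 & 016148238237 & 016148245237 & 016148247237 & []) (
 bound (018016246237 & 016015235237 & 239237017016 & 145016028237 & [])))
 (group (89 & []) (149 & []) & []) (
 bound (146016025237 & 145016023237 & 247237135016 & 245237013016 & 016014234237 & 016015235237 & 238237017016 & 239237147016 & 018016236237 & 019016246237 & 024026136137 & 027028138134 & []))))
 (group (34 & []) (247 & []) & group (79 & []) (239 & 249 & []) & group (78 & []) (238 & 248 & []) & []) (
 split 235 (
 split 027 (
 drop (235027016146 & 235027016148 & 235027016149 & []) (
 bound (245235013016 & 234235015016 & 014016236235 & 017016246235 & 147016023235 & 024027137135 & 027025145134 & [])))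
 (group (79 & []) (029 & []) & group (78 & []) (028 & []) & []) (
 bound (245235013016 & 234235015016 & 014016236235 & 017016246235 & 146016023235 & 147016025235 & 148016026235 & [])))
 (group (34 & []) (245 & []) & []) (
 split 023 (
 split 236 (
 bound (145014023236 & 147146236023 & 148015023236 & 149017023236 & 018016236234 & 019013236246 & 024025135136 & 026027137134 & []))
 [] (
 split 246 (
 bound (015016246234 & 135013024246 & 137017025246 & 138018026246 & 139019027246 & 028023134145 & 029023136146 & []))
 [] (
 split 013 (
 split 014 (
 split 015 (
 split 017 (
 split 018 (
 split 019 (
 split 123 (
 split 124 (
 split 126 (
 split 127 (
 split 128 (
 split 129 (
 split 145 (
 split 134 (
 drop (145134023026 & 145134023027 & 145134023028 & 145134023029 & []) (
 star 1))
 [] (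
 bound (146145025023 & 023027147145 & 023028148145 & 029023136145 & 026023135145 & [])))
 [] (
 bound (025023134146 & 026023135147 & 027023136148 & 028023137149 & 024029139138 & [])))
 [] (
 bound (025023134146 & 026023135145 & 027023136148 & 028023137147 & 024029139138 & [])))
 [] (
 bound (025023134146 & 026023135145 & 027023136148 & 028023137147 & 024029139138 & [])))
 [] (
 bound (025023134146 & 026023135145 & 027023136148 & 028023137147 & 024029139138 & [])))
 [] (
 bound (025023134146 & 026023135145 & 027023136148 & 028023137147 & 024029139138 & [])))
 [] (
 bound (025023134146 & 026023135145 & 027023136148 & 028023137147 & 024029139138 & [])))
 [] (
 bound (025023134146 & 026023135145 & 027023136148 & 028023137147 & 024029139138 & [])))
 [] (
 bound (025023134146 & 026023135145 & 027023136148 & 028023137147 & 024029139138 & [])))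
 [] (
 bound (025023134146 & 026023135145 & 027023136148 & 028023137147 & 024029139138 & [])))
 [] (
 bound (025023134146 & 026023135145 & 027023136148 & 028023137147 & 024029139138 & [])))
 [] (
 bound (025023134146 & 026023135145 & 027023136148 & 028023137147 & 024029139138 & [])))
 [] (
 bound (025023134146 & 026023135145 & 027023136148 & 028023137147 & 024029139138 & [])))
 [] (
 bound (025023134146 & 026023135145 & 027023136148 & 028023137147 & 024029139138 & [])))))
 (group (34 & []) (024 & []) & []) (
 split 027 (
 bound (135013027246 & 145014027236 & 025027137134 & 026027147138 & 027028148136 & 027029139146 & []))
 (group (79 & []) (029 & []) & group (78 & []) (028 & []) & []) (
 split 025 (
 bound (137013025246 & 147014025236 & 026025135134 & []))
 [] (
 star 1))))))
 (group (69 & []) (019 & []) & group (12 & []) (026 & 029 & []) & group (67 & []) (017 & 027 & []) & group (68 & []) (018 & 028 & []) & []) (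
 split 015 (
 split 023 (
 bound (146015023237 & 148015023239 & 145015023236 & 147015023238 & 013015245246 & 149014023235 & 247024015135 & 248025015136 & []))
 (group (34 & []) (024 & []) & []) (
 bound (013015245246 & 014015235236 & 247025015136 & 015135234248 & 015137237249 & 015148238239 & [])))
 (group (12 & []) (025 & []) & []) (
 split 013 (
 split 014 (
 bound (236023014145 & 246024013135 & 013137247245 & 013138248249 & 014147237235 & 014148238239 & []))
 [] (
 bound (246024013135 & 013137247245 & 013138248249 & 023235145146 & 147148238236 & [])))
 (group (12 & []) (023 & []) & group (34 & []) (014 & 024 & []) & []) (
 bound (135136246247 & 137138248245 & [])))))))))
 (group (59 & []) (129 & []) & group (56 & []) (126 & []) & group (57 & []) (127 & []) & group (58 & []) (128 & []) & []) (
 split 135 (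
 split 246 (
 split 017 (
 drop (135017024246 & 135017026246 & 135017027246 & 135017028246 & 135017029246 & 135017046246 & 135017047246 & 135017048246 & 135017049246 & 135017067246 & 135017068246 & 135017069246 & 246234135017 & 246235135017 & 246236135017 & 246238135017 & []) (
 bound (015135237246 & 135018248246 & 249246016135 & 137135025246 & 138135045246 & 139135056246 & 035135147246 & 038135149246 & 037135145246 & 039135148246 & 057135123246 & 058135124246 & 059135134246 & 078017136246 & 079017146246 & [])))
 (group (79 & []) (019 & []) & group (24 & 13 & []) (037 & 039 & []) & group (56 & 34 & 12 & []) (027 & 029 & 047 & 049 & []) & group (78 & []) (018 & 028 & 038 & 048 & []) & []) (
 split 057 (
 drop (135057024246 & 135057026246 & 135057046246 & 135057067246 & 135057068246 & 135057069246 & 246123135057 & 246124135057 & 246134135057 & []) (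
 bound (013135245246 & 015135237246 & 035135147246 & 135058248246 & 249246016135 & 089057145246 & 078057235246 & 079057135138 & 137135025246 & 139135045246 & [])))
 (group (79 & []) (059 & []) & group (56 & 34 & 12 & []) (067 & 069 & []) & group (78 & []) (058 & 068 & []) & []) (
 bound (046246123135 & 035135124246 & 026246134135 & 015135234246 & 135013024246 & 247246016135 & 248246036135 & 249246136135 & 137135025246 & 138135045246 & 139135056246 & 078014135235 & 079023135145 & []))))
 (group (67 & []) (247 & []) & group (69 & []) (249 & []) & group (68 & []) (248 & []) & []) (
 split 026 (
 split 147 (
 drop (026023135147 & 135147024026 & 026025135147 & 135147027026 & 026035135147 & 026036135147 & 026038135147 & 026039135147 & 135147046026 & 135147047026 & 135147048026 & 135147049026 & 026056135147 & 026058135147 & 026059135147 & 135147067026 & 135147078026 & []) (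
 bound (134135057026 & 137135045026 & 145135037026 & 068026123135 & 069026124135 & 089026234135 & 028026136135 & 138135245026 & 135139029026 & 148135237026 & [])))
 (group (79 & []) (149 & []) & group (78 & []) (148 & []) & []) (
 split 145 (
 drop (026023135145 & 135145024026 & 026036135145 & 026037135145 & 026038135145 & 026039135145 & 135145046026 & 135145047026 & 135145048026 & 135145049026 & 026236135145 & 026237135145 & 026238135145 & []) (
 bound (027026136135 & 028026146135 & 135139029026 & 137135045026 & 134135058026 & 138135025026 & 067026123135 & 068026124135 & 069026234135 & 078026235135 & 079026245135 & [])))
 [] (
 split 078 (
 drop (135123026078 & 135124026078 & 135136026078 & 135137078026 & 135138078026 & 135146026078 & 135234026078 & 135235026078 & 135236026078 & 135239026078 & 135245026078 & []) (
 star 0))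
 (group (79 & []) (089 & []) & group (89 & []) (079 & []) & []) (
 split 137 (
 drop (026025135137 & 135137027026 & 026045135137 & 135137047026 & 026056135137 & 026058135137 & 026059135137 & 135137067026 & 026245135137 & []) (
 bound (135134024026 & 138135057026 & 028026146135 & 029026136135 & 068026124135 & 069026234135 & 135139049026 & 048026236135 & 046026123135 & 014015235237 & 016018238239 & [])))
 (group (79 & []) (139 & []) & group (78 & []) (138 & []) & []) (
 split 134 (
 drop (135134024026 & 026025135134 & 135134046026 & 135134047026 & 135134048026 & 135134049026 & 026056135134 & 026057135134 & 026058135134 & 026059135134 & []) (
 bound (027026136135 & 028026146135 & 068026237135 & 067026239135 & 069026123135 & 036013124245 & 014015235236 & [])))
 [] (
 split 067 (
 drop (135123026067 & 135124026067 & 135234026067 & 135235026067 & 135238026067 & 135239026067 & 135245026067 & []) (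
 star 0))
 (group (79 & []) (069 & []) & group (78 & []) (068 & []) & []) (
 split 136 (
 drop (135136026024 & 135136026027 & 135136026028 & 135136026029 & 135136026047 & 135136026048 & 135136026049 & []) (
 bound (046026123135 & 136013025245 & 045014136236 & 057015136234 & 058016136237 & 059017136238 & [])))
 [] (
 split 146 (
 drop (135146026027 & 135146026028 & 135146026029 & []) (
 bound (047026236135 & 049026238135 & 046026123135 & 048026235135 & 037013146245 & 146014023237 & 146015025239 & 057016146234 & 035036146124 & [])))
 [] (
 split 047 (
 drop (135123026047 & 135235026047 & 135236026047 & 135238026047 & 135239026047 & []) (
 star 0))
 (group (79 & []) (049 & []) & group (78 & []) (048 & []) & []) (
 split 046 (
 drop (135123026046 & 135235026046 & 135237026046 & 135238026046 & 135239026046 & []) (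
 star 0))
 [] (
 split 237 (
 split 014 (
 bound (237235015014 & 045014123237 & 016014245237 & 237238018014 & 236237017014 & 239237057014 & 019014234237 & []))
 [] (
 bound (016013237245 & 015017237234 & 018019239237 & 056035237124 & 045057237123 & 059058238237 & [])))
 (group (79 & []) (239 & []) & group (78 & []) (238 & []) & []) (
 split 123 (
 bound (045014123236 & 056015123234 & 057035123124 & 016013235245 & []))
 [] (
 split 124 (
 bound (036013124245 & 057014124236 & 056015124234 & []))
 [] (
 star 0))))))))))))))
 (group (69 & []) (029 & []) & group (24 & 13 & []) (046 & 049 & []) & group (67 & []) (027 & 047 & []) & group (68 & []) (028 & 048 & []) & []) (
 split 067 (
 bound (245135013067 & 235135014067 & 234135018067 & 238135019067 & 239135015067 & 145135023067 & 124135038067 & 148135039067 & 149135035067 & 134135025067 & 123135058067 & 138135059067 & 139135045067 & 024067136135 & 078067146135 & 079067236135 & 068067137135 & 069067147135 & 089067237135 & []))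
 (group (69 & []) (079 & []) & group (78 & []) (068 & 089 & []) & group (79 & []) (069 & 078 & []) & []) (
 split 024 (
 split 245 (
 drop (024245135136 & 024245135137 & 024245135138 & 024245135139 & []) (
 bound (036013124245 & 016014245235 & 017015245234 & 018019239245 & 037023245145 & 038025245146 & 039035245147 & 045056236123 & 057058148134 & [])))
 [] (
 split 013 (
 split 014 (
 split 234 (
 bound (015014234236 & 017014234235 & 018014234239 & 016014234237 & 019014234238 & 137135056024 & 139135058024 & 136135025024 & 138135045024 & 057023234146 & 059035234124 & 036037147145 & []))
 [] (
 split 235 (
 bound (014016236235 & 014017237235 & 014018238235 & 239235015014 & 147014036235 & 149014038235 & 146014023235 & 148014035235 & 137135056024 & 139135058024 & 136135025024 & []))
 [] (
 bound (137135056024 & 139135058024 & 136135025024 & 138135045024 & 014016236237 & 014018238239 & 023035145146 & 036037147124 & 057038123149 & 059039134148 & []))))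
 (group (24 & 13 & []) (023 & []) & []) (
 bound (137135056024 & 139135058024 & 136135025024 & 138135045024 & 015016236234 & 017018238235 & 146019035237 & 036037147124 & 038039149145 & 057059239123 & [])))
 [] (
 bound (137135056024 & 139135058024 & 136135025024 & 138135045024 & 014015235236 & 016017237234 & 145018023239 & 146019035238 & 036037147124 & 057038123149 & 059039134148 & []))))
 [] (
 split 245 (
 split 013 (
 bound (137013056245 & 139013058245 & 136013025245 & 138013045245 & 037013146245 & 039013148245 & 036013124245 & 038013145245 & 017013236245 & 019013238245 & 016013234245 & 018013235245 & []))
 [] (
 bound (016014245235 & 017015245234 & 018019239245 & 036023245145 & 245025037136 & 038035245124 & 137039045245 & 056245123138 & 057245134139 & 058059149146 & 147148238236 & [])))
 [] (
 split 056 (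
 split 147 (
 bound (235056014147 & 234147016056 & 236056017147 & 237147015056 & 124147037056 & 025056136147 & 056058148147 & 056059149147 & 137147045056 & 123147057056 & 035056146147 & []))
 (group (79 & []) (149 & []) & group (24 & 13 & []) (237 & 239 & []) & group (78 & []) (148 & 238 & []) & []) (
 bound (015056236234 & 025056136134 & 035056146124 & 056057137123 & 056058138139 & [])))
 (group (69 & []) (059 & []) & group (45 & 01 & []) (146 & 149 & []) & group (67 & 25 & 03 & []) (147 & 237 & 239 & []) & group (68 & 45 & 01 & []) (057 & 058 & 148 & []) & group (25 & 03 & []) (236 & 238 & []) & []) (
 bound [])))))))
 (group (34 & []) (145 & []) & group (56 & []) (136 & 146 & []) & group (12 & []) (235 & 236 & 245 & 246 & []) & group (58 & []) (138 & 148 & 238 & 248 & []) & group (59 & []) (139 & 149 & 239 & 249 & []) & group (57 & []) (137 & 147 & 237 & 247 & []) & []) (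
 star 0))))
 (group (46 & []) (036 & []) & group (38 & []) (048 & 068 & []) & group (02 & []) (234 & 236 & 248 & 268 & []) & group (47 & 01 & []) (136 & 137 & 168 & 178 & 237 & 278 & []) & group (47 & 39 & []) (069 & 078 & 079 & 148 & 149 & 169 & 249 & 269 & 279 & []) & group (49 & 35 & []) (046 & 047 & 056 & 059 & 089 & 146 & 156 & 157 & 189 & 246 & 247 & 256 & 257 & 259 & 289 & []) & group (36 & 01 & []) (035 & 038 & 039 & 049 & 057 & 067 & 134 & 135 & 138 & 139 & 147 & 159 & 179 & 235 & 238 & 239 & 267 & []) & group (35 & []) (037 & 045 & 058 & 145 & 158 & 245 & 258 & []) & group (46 & []) (167 & []) & []) (
 -- The remaining triples share at least two vertices with 012: 1 + 3 * 7 = 22 in all.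
 bound [])))
 (group (03 & []) (123 & []) & group (14 & []) (024 & 234 & []) & group (25 & []) (015 & 045 & 135 & 345 & []) & group (01 & []) (023 & 035 & 124 & 145 & []) & group (02 & []) (013 & 014 & 034 & 125 & 235 & 245 & []) & group (06 & []) (126 & 136 & 146 & 156 & 236 & 246 & 346 & 356 & 456 & []) & group (17 & []) (027 & 037 & 047 & 057 & 237 & 247 & 257 & 267 & 357 & 367 & 457 & 467 & 567 & []) & group (28 & []) (018 & 038 & 048 & 078 & 138 & 148 & 158 & 168 & 348 & 358 & 368 & 378 & 458 & 468 & 478 & 578 & 678 & []) & group (39 & []) (019 & 029 & 049 & 059 & 079 & 089 & 129 & 159 & 169 & 189 & 249 & 259 & 269 & 279 & 459 & 469 & 489 & 569 & 579 & 589 & 679 & 689 & 789 & []) & group (01 & []) (025 & 026 & 036 & 046 & 056 & 058 & 068 & 069 & 127 & 134 & 137 & 147 & 149 & 157 & 178 & 179 & []) & group (23 & []) (028 & 039 & 128 & 139 & 248 & 256 & 258 & 268 & 278 & 347 & 349 & 359 & 369 & 379 & []) & group (69 & []) (016 & 067 & 167 & 239 & 289 & 389 & 479 & 568 & []) & group (02 & []) (017 & 238 & []) & [])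
 (bound [])

-- The dichotomies and the descent on the number of colours

-- The edge bounds are chosen such that exceptions and sparse classes cannot fill all triples: 34 <
-- 35, 7 + 2 * 24 < 56, 5 + 3 * 26 < 84 and 4 * 29 < 120. The last argument is one more than the
-- number of new exceptions allowed, or 0 where no descent takes place.
module R₇ = Checker 6 34 0
module R₈ = Checker 7 24 0
module R₉ = Checker 8 26 3
module R₁₀ = Checker 9 29 6

abstract
  dichotomy₇ : ∀ E → Admissible E → R₇.SparseOrStarlike E
  dichotomy₇ = R₇.certified certificate₇ refl

  dichotomy₈ : ∀ E → Admissible E → R₈.SparseOrStarlike E
  dichotomy₈ = R₈.certified certificate₈ refl

  dichotomy₉ : ∀ E → Admissible E → R₉.SparseOrStarlike E
  dichotomy₉ = R₉.certified certificate₉ refl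

  dichotomy₁₀ : ∀ E → Admissible E → R₁₀.SparseOrStarlike E
  dichotomy₁₀ = R₁₀.certified certificate₁₀ refl

no-Cover₇ : ¬ Cover 7 1 0
no-Cover₇ C with delete-centre {6} {34} {0} dichotomy₇ refl refl C
... | _ , () , _

no-Cover₈ : ¬ Cover 8 2 7
no-Cover₈ C with delete-centre {7} {24} {0} dichotomy₈ refl refl C
... | _ , () , _

no-Cover₉ : ¬ Cover 9 3 5
no-Cover₉ C with delete-centre {8} {26} {3} dichotomy₉ refl refl C
-- The five old exceptions and at most two new ones make up the seven allowed on eight vertices.
... | e , e<3 , C′ = no-Cover₈ (Cover-mono (+-monoʳ-≤ 5 (<⇒≤pred e<3)) C′)

no-Cover₁₀ : ¬ Cover 10 4 0
no-Cover₁₀ C with delete-centre {9} {29} {6} dichotomy₁₀ refl refl C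
... | e , e<6 , C′ = no-Cover₉ (Cover-mono (<⇒≤pred e<6) C′)

-- Two and three colours enter the descent from four colours at a later stage, with no exceptions
-- where it tolerates seven and five. One colour is outside the descent, which ends at eight
-- vertices.
no-Cover : ∀ r → 1 ≤ r → r ≤ 4 → ¬ Cover (r + 6) r 0
no-Cover 1 _ _ C = no-Cover₇ C
no-Cover 2 _ _ C = no-Cover₈ (Cover-mono z≤n C)
no-Cover 3 _ _ C = no-Cover₉ (Cover-mono z≤n C)
no-Cover 4 _ _ C = no-Cover₁₀ C
no-Cover (suc (suc (suc (suc (suc r))))) _ (s≤s (s≤s (s≤s (s≤s ()))))

arrows : ∀ r → 1 ≤ r → r ≤ 4 → Arrows (r + 6) 𝒫₄ r
arrows r 1≤r r≤4 χ with decidable-stable (monochromatic? χ) (no-Cover r 1≤r r≤4 ∘ colouring⇒Cover χ)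
... | c , e₀ , e₁ , e₂ , e₃ , p , h₀ , h₁ , h₂ , h₃ = c ,
  copy χ c (λ i → vertices _ (edge (quad e₀ e₁ e₂ e₃) i))
    (path-pattern (quad e₀ e₁ e₂ e₃) p (proj₁ h₀ ∷ proj₁ h₁ ∷ proj₁ h₂ ∷ proj₁ h₃ ∷ []))
    (All-members (quad e₀ e₁ e₂ e₃) (coloured h₀ ∷ coloured h₁ ∷ coloured h₂ ∷ coloured h₃ ∷ []))
  where
  coloured : ∀ {t} → HasColour χ c t → 3Graph.Edges (colorClass χ c) (vertices _ t)
  coloured (p , h) = ∣vertices∣ p , h

theorem1p2 : ∀ (r : ℕ) → 1 ≤ r → r ≤ 4 → IsRamseyNumber 𝒫₄ r (r + 6)
theorem1p2 r 1≤r r≤4 = arrows r 1≤r r≤4 , λ n → arrows⇒≥ r n 1≤r
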